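{- Let $d\ge 1$ and let $(S_t)_{t\in\mathbb{N}}$ be any family of subsets of $\mathbb{N}^d$. With Properties 1, 2, 3, 3a, 3b and 4 as defined in the context, the following implications hold for the family $(S_t)$: Property 4 implies Property 2; Property 4 implies Property 3a; Property 4 implies Property 3b; Property 2 implies Property 1; Property 3a implies Property 3; Property 3b implies Property 3; and Property 3 implies Property 1.
   Context: $\mathbb{N}=\{0,1,2,\dots\}$. A function $g:\mathbb{N}\to\mathbb{Q}$ is a quasi-polynomial if there exist a period $m\ge 1$ and polynomials $p_0,\dots,p_{m-1}\in\mathbb{Q}[t]$ with $g(t)=p_i(t)$ whenever $t\equiv i \bmod m$. A function on $\mathbb{N}$ is eventually a quasi-polynomial if there is $T$ such that it agrees with a quasi-polynomial for all $t\ge T$. A set $A\subseteq\mathbb{N}$ is eventually periodic if there exist $T$ and $m\ge1$ such that for all $t\ge T$, $t\in A\iff t+m\in A$. A vector in $\mathbb{Z}^d$ is lexicographically positive if it is nonzero and its first nonzero entry is positive. For $\mathbf{x}=(x_1,\dots,x_d)$ and $\mathbf{s}\in\mathbb{Z}^d$, $\mathbf{x}^{\mathbf{s}}=x_1^{s_1}\cdots x_d^{s_d}$. For a family $(S_t)_{t\in\mathbb{N}}$ of subsets of $\mathbb{N}^d$: Property 1: The set of $t$ such that $S_t$ is nonempty is eventually periodic. Property 2: There exists a function $g:\mathbb{N}\to\mathbb{N}$ such that $g(t)=|S_t|$ whenever $S_t$ has finite cardinality, and $g$ is eventually a quasi-polynomial. Moreover, the set of $t$ such that $S_t$ has finite cardinality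 is eventually periodic. Property 3: There exists a function $\mathbf{x}:\mathbb{N}\to\mathbb{N}^d$ such that, if $S_t$ is nonempty, then $\mathbf{x}(t)\in S_t$, and the coordinate functions of $\mathbf{x}$ are eventually quasi-polynomials. Moreover, the set of $t$ such that $S_t$ is nonempty is eventually periodic. Property 3a: For every $\mathbf{c}\in\mathbb{Z}^d\setminus\{0\}$, there exists a function $\mathbf{x}:\mathbb{N}\to\mathbb{N}^d$ such that, if $\max_{\mathbf{y}\in S_t}\mathbf{c}\cdot\mathbf{y}$ exists, then it is attained at $\mathbf{x}(t)\in S_t$, and the coordinate functions of $\mathbf{x}$ are eventually quasi-polynomials. Moreover, the set of $t$ such that the maximum exists is eventually periodic. Property 3b: For every $k\in\mathbb{N}$, there exist functions $\mathbf{x}_1,\dots,\mathbf{x}_k:\mathbb{N}\to\mathbb{N}^d$ such that, if $|S_t|\ge k$, then $\mathbf{x}_1(t),\dots,\mathbf{x}_k(t)$ are distinct elements of $S_t$, and the coordinate functions of the $\mathbf{x}_i$ are eventually quasi-polynomials. Moreover, the set of $t$ such that $|S_t|\ge k$ is eventually periodic. Property 4: There exists a period $m\ge 1$ such that, for each residue $i$ modulo $m$ and all sufficiently large $t\equiv i\bmod m$, $$\sum_{\mathbf{s}\in S_t}\mathbf{x}^{\mathbf{s}}=\frac{\sum_{j=1}^{n_i}\alpha_{ij}\mathbf{x}^{\mathbf{q}_{ij}(t)}}{(1-\mathbf{x}^{\mathbf{b}_{i1}(t)})\cdots(1-\mathbf{x}^{\mathbf{b}_{ik_i}(t)})},$$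 where $n_i,k_i\in\mathbb{N}$ and $\alpha_{ij}\in\mathbb{Q}$ do not depend on $t$, the coordinates of $\mathbf{q}_{ij}$ and $\mathbf{b}_{ij}$ are polynomials in $\mathbb{Q}[t]$ with $\mathbf{q}_{ij}(t),\mathbf{b}_{ij}(t)\in\mathbb{Z}^d$ for such $t$, and the $\mathbf{b}_{ij}(t)$ are lexicographically positive. Here a rational function is identified with the Laurent series obtained by expanding each factor $1/(1-\mathbf{x}^{\mathbf{b}})$ as $1+\mathbf{x}^{\mathbf{b}}+\mathbf{x}^{2\mathbf{b}}+\cdots$, which converges near $(e^{ -\varepsilon},e^{ -\varepsilon^2},\dots,e^{ -\varepsilon^d})$ for sufficiently small $\varepsilon>0$. -}

module Defs where

open import Data.Nat.Base as ℕ using (ℕ; zero; suc)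
open import Data.Nat.DivMod using (_mod_)
open import Data.Integer.Base as ℤ using (ℤ; +_)
open import Data.Integer.Properties as ℤₚ using ()
open import Data.Rational.Base as ℚ using (ℚ; 0ℚ; 1ℚ)
open import Data.Rational.Properties as ℚₚ using ()
open import Data.Bool.Base using (if_then_else_)
open import Data.Fin.Base as Fin using (Fin; toℕ)
open import Data.List.Base using (List; foldr)
open import Data.Vec.Base using (Vec; lookup; map; replicate; zipWith)
open import Data.Vec.Properties using (≡-dec)
open import Data.Vec.Functional using (Vector; head; tail)
open import Data.Product using (∃-syntax; Σ-syntax; _×_)
open import Function.Bundles using (_⇔_)
open import Function.Definitions using (Injective)
open import Level using (0ℓ)
open import Relation.Binary.PropositionalEquality using (_≡_; _≢_)
open import Relation.Nullary using (does)
open import Relation.Unary using (Pred; _∈_; Satisfiable)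

import Algebra.Properties.CommutativeMonoid.Sum ℤₚ.+-0-commutativeMonoid as ℤSum
import Algebra.Properties.CommutativeMonoid.Sum ℚₚ.+-0-commutativeMonoid as ℚSum

------------------------------------------------------------------------
-- Quasi-polynomials

fromℤ : ℤ → ℚ
fromℤ i = i ℚ./ 1

fromℕ : ℕ → ℚ
fromℕ n = fromℤ (+ n)

-- Elements of ℚ[t], as coefficient lists with the constant term first;
-- trailing zeros are allowed.

Poly : Set
Poly = List ℚ

eval : Poly → ℚ → ℚ
eval p x = foldr (λ a r → a ℚ.+ x ℚ.* r) 0ℚ p

-- Here and below, a period m ≥ 1 is written suc m.

IsQuasiPolynomial : (ℕ → ℚ) → Set
IsQuasiPolynomial g =
  ∃[ m ] Σ[ p ∈ (Fin (suc m) → Poly) ]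
    (∀ t → g t ≡ eval (p (t mod suc m)) (fromℕ t))

EventuallyQuasiPolynomial : (ℕ → ℚ) → Set
EventuallyQuasiPolynomial g =
  ∃[ h ] IsQuasiPolynomial h × ∃[ T ] (∀ t → T ℕ.≤ t → g t ≡ h t)

EventuallyPeriodic : Pred ℕ 0ℓ → Set
EventuallyPeriodic A =
  ∃[ T ] ∃[ m ] (∀ t → T ℕ.≤ t → (t ∈ A ⇔ t ℕ.+ suc m ∈ A))

CoordinatesEventuallyQuasiPolynomial : ∀ {d} → (ℕ → Vec ℕ d) → Set
CoordinatesEventuallyQuasiPolynomial x =
  ∀ i → EventuallyQuasiPolynomial (λ t → fromℕ (lookup (x t) i))

------------------------------------------------------------------------
-- Subsets of ℕᵈ

Subset : ℕ → Set₁
Subset d = Pred (Vec ℕ d) 0ℓ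

Family : ℕ → Set₁
Family d = ℕ → Subset d

HasCardinality : ∀ {d} → Subset d → ℕ → Set
HasCardinality {d} A n =
  Σ[ f ∈ (Fin n → Vec ℕ d) ]
    Injective _≡_ _≡_ f × (∀ y → (y ∈ A ⇔ (∃[ i ] f i ≡ y)))

Finite : ∀ {d} → Subset d → Set
Finite A = ∃[ n ] HasCardinality A n

-- |A| ≥ k, for a possibly infinite A.

HasAtLeast : ∀ {d} → ℕ → Subset d → Set
HasAtLeast {d} k A =
  Σ[ f ∈ (Fin k → Vec ℕ d) ] Injective _≡_ _≡_ f × (∀ i → f i ∈ A)

_·_ : ∀ {d} → Vec ℤ d → Vec ℕ d → ℤ
c · y = ℤSum.sum (λ i → lookup c i ℤ.* (+ lookup y i))

AttainsMaximum : ∀ {d} → Vec ℤ d → Subset d → Vec ℕ d → Set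
AttainsMaximum c A x = x ∈ A × (∀ y → y ∈ A → (c · y) ℤ.≤ (c · x))

MaximumExists : ∀ {d} → Vec ℤ d → Subset d → Set
MaximumExists c A = ∃[ x ] AttainsMaximum c A x

------------------------------------------------------------------------
-- Laurent series

-- F s is the coefficient of 𝐱ˢ.

LaurentSeries : ℕ → Set
LaurentSeries d = Vec ℤ d → ℚ

LexPositive : ∀ {d} → Vec ℤ d → Set
LexPositive b =
  ∃[ i ] (ℤ.0ℤ ℤ.< lookup b i × (∀ j → j Fin.< i → lookup b j ≡ ℤ.0ℤ))

-- F = ∑_{s ∈ A} 𝐱ˢ

IsGeneratingFunction : ∀ {d} → Subset d → LaurentSeries d → Set
IsGeneratingFunction A F =
  (∀ y → y ∈ A → F (map +_ y) ≡ 1ℚ) ×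
  (∀ s → (∀ y → y ∈ A → map +_ y ≢ s) → F s ≡ 0ℚ)

monomial : ∀ {d} → Vec ℤ d → LaurentSeries d
monomial q s = if does (≡-dec ℤₚ._≟_ q s) then 1ℚ else 0ℚ

laurentPolynomial : ∀ {d n} → Vector ℚ n → Vector (Vec ℤ d) n → LaurentSeries d
laurentPolynomial α q s = ℚSum.sum (λ j → α j ℚ.* monomial (q j) s)

-- v = f 0 + f 1 + f 2 + ⋯, where only finitely many terms are nonzero.

IsFiniteSum : (ℕ → ℚ) → ℚ → Set
IsFiniteSum f v =
  ∃[ N ] ((∀ n → N ℕ.≤ n → f n ≡ 0ℚ) × v ≡ ℚSum.sum {N} (λ i → f (toℕ i)))

-- G = F · (1 + 𝐱ᵇ + 𝐱²ᵇ + ⋯). The coefficient of 𝐱ˢ in F · 𝐱ⁿᵇ is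
-- that of 𝐱ˢ⁻ⁿᵇ in F.

IsGeometricMultiple : ∀ {d} → LaurentSeries d → Vec ℤ d → LaurentSeries d → Set
IsGeometricMultiple F b G =
  ∀ s → IsFiniteSum (λ n → F (zipWith ℤ._-_ s (map (+ n ℤ.*_) b))) (G s)

-- G is the expansion of F / ((1 - 𝐱ᵇ⁰) ⋯ (1 - 𝐱ᵇ⁽ᵏ⁻¹⁾)). When F is a Laurent
-- polynomial and every bⱼ is lexicographically positive, all the sums
-- involved are finite, so that G exists and is unique.

IsExpansion : ∀ {d} k → LaurentSeries d → Vector (Vec ℤ d) k → LaurentSeries d → Set
IsExpansion zero    F b G = ∀ s → G s ≡ F s
IsExpansion (suc k) F b G =
  ∃[ H ] IsExpansion k F (tail b) H × IsGeometricMultiple H (head b) G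

-- p(t) = v, for p ∈ ℚ[t]ᵈ and v ∈ ℤᵈ.

TakesValue : ∀ {d} → Vec Poly d → ℕ → Vec ℤ d → Set
TakesValue p t v = ∀ i → eval (lookup p i) (fromℕ t) ≡ fromℤ (lookup v i)

------------------------------------------------------------------------
-- The properties

Property1 : ∀ {d} → Family d → Set
Property1 S = EventuallyPeriodic (λ t → Satisfiable (S t))

Property2 : ∀ {d} → Family d → Set
Property2 S =
  (Σ[ g ∈ (ℕ → ℕ) ]
    (∀ t → Finite (S t) → HasCardinality (S t) (g t)) ×
    EventuallyQuasiPolynomial (λ t → fromℕ (g t))) ×
  EventuallyPeriodic (λ t → Finite (S t))

Property3 : ∀ {d} → Family d → Set
Property3 {d} S =
  (Σ[ x ∈ (ℕ → Vec ℕ d) ]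
    (∀ t → Satisfiable (S t) → x t ∈ S t) ×
    CoordinatesEventuallyQuasiPolynomial x) ×
  EventuallyPeriodic (λ t → Satisfiable (S t))

Property3a : ∀ {d} → Family d → Set
Property3a {d} S = ∀ (c : Vec ℤ d) → c ≢ replicate d ℤ.0ℤ →
  (Σ[ x ∈ (ℕ → Vec ℕ d) ]
    (∀ t → MaximumExists c (S t) → AttainsMaximum c (S t) (x t)) ×
    CoordinatesEventuallyQuasiPolynomial x) ×
  EventuallyPeriodic (λ t → MaximumExists c (S t))

Property3b : ∀ {d} → Family d → Set
Property3b {d} S = ∀ k →
  (Σ[ x ∈ (Fin k → ℕ → Vec ℕ d) ]
    (∀ t → HasAtLeast k (S t) →
      (∀ i → x i t ∈ S t) × (∀ i j → i ≢ j → x i t ≢ x j t)) ×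
    (∀ i → CoordinatesEventuallyQuasiPolynomial (x i))) ×
  EventuallyPeriodic (λ t → HasAtLeast k (S t))

RationalGeneratingFunctionAt : ∀ {d n k} → Subset d → ℕ →
  Vector ℚ n → Vector (Vec Poly d) n → Vector (Vec Poly d) k → Set
RationalGeneratingFunctionAt {d} {n} {k} A t α q b =
  Σ[ qₜ ∈ Vector (Vec ℤ d) n ] Σ[ bₜ ∈ Vector (Vec ℤ d) k ]
    (∀ j → TakesValue (q j) t (qₜ j)) ×
    (∀ j → TakesValue (b j) t (bₜ j)) ×
    (∀ j → LexPositive (bₜ j)) ×
    (∃[ F ] IsGeneratingFunction A F ×
            IsExpansion k (laurentPolynomial α qₜ) bₜ F)

Property4 : ∀ {d} → Family d → Set
Property4 {d} S = ∃[ m ] ∀ (i : Fin (suc m)) →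
  ∃[ n ] ∃[ k ] Σ[ α ∈ Vector ℚ n ]
  Σ[ q ∈ Vector (Vec Poly d) n ] Σ[ b ∈ Vector (Vec Poly d) k ]
  ∃[ T ] (∀ t → T ℕ.≤ t → t mod suc m ≡ i →
    RationalGeneratingFunctionAt (S t) t α q b)

-- Write the generating function of S_t as N / ((1 − 𝐱^b₁) ⋯ (1 − 𝐱^bₖ)). Comparing least terms for a translation-invariant
-- order shows that the least element of S_t is the exponent of the least term of N minus the sum of the negative bⱼ,
-- a vector whose entries are eventually polynomial in t on a residue class. With the order "larger c · y first, then
-- lexicographic" this is a maximiser of c · y; removing elements one at a time gives k distinct ones.
--
-- Whether c · y is bounded on S_t is decided as follows. A series F with nonnegative coefficients may be multiplied by
-- 1 + 𝐱^β + ⋯ + 𝐱^((C−1)β), with β = b / C and C = c · b, without affecting boundedness, and this replaces every factor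
-- 1 − 𝐱ᵇ with c · b > 0 by 1 − 𝐱^β (as in Pringsheim's theorem, only the poles on the positive axis matter). Hence F is
-- bounded exactly if N is divisible by all these 1 − 𝐱^β, counted with multiplicity, that is, if certain moments of N
-- along the lines parallel to β vanish. These moments are rational functions of t, so that each of them eventually
-- vanishes or eventually does not. To have room for the vectors β, all series are indexed by ℚᵈ.
--
-- If S_t is finite, pairing the identity F · ∏ (1 − 𝐱^bⱼ) = N with the k-th power of a generic linear functional shows that
-- |S_t| is a rational function of t; being integer-valued, it is a polynomial on each residue class.
module Submission where

open import Defs
open import Axiom.ExcludedMiddle using (ExcludedMiddle)
open import Data.Bool.Base using (if_then_else_)
open import Data.Empty using (⊥; ⊥-elim)
open import Data.Fin.Base using (Fin; zero; suc; toℕ; punchIn)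
import Data.Fin.Properties as Finₚ
open import Data.Integer.Base as ℤ using (ℤ)
import Data.Integer.Properties as ℤₚ
import Data.Integer.Tactic.RingSolver as ℤSolver
open import Data.List.Base as List using (List; []; _∷_; _++_; [_]; length; concatMap; upTo)
open import Data.List.Membership.Propositional using (_∈_)
open import Data.List.Membership.Propositional.Properties using (∈-map⁺; ∈-concatMap⁺; ∈-upTo⁺)
import Data.List.Properties as Listₚ
open import Data.List.Relation.Unary.All as All using (All; []; _∷_)
import Data.List.Relation.Unary.All.Properties as Allₚ
open import Data.List.Relation.Unary.Any as Any using (Any; here; there)
open import Data.Nat.Base as ℕ using (ℕ; zero; suc)
open import Data.Nat.DivMod using (_mod_; [m+kn]%n≡m%n; m<n⇒m%n≡m)
import Data.Nat.Properties as ℕₚ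
open import Data.Product using (∃-syntax; _×_; _,_; proj₁; proj₂)
open import Data.Rational.Base as ℚ using (ℚ; 0ℚ; 1ℚ; _+_; _*_; _-_; -_; _<_; _≤_; ↥_; ↧_; toℚᵘ)
import Data.Rational.Properties as ℚₚ
open import Data.Rational.Unnormalised.Base as ℚᵘ using (mkℚᵘ; *≡*; *≤*; *<*)
import Data.Rational.Unnormalised.Properties as ℚᵘₚ
open import Data.Sum.Base as Sum using (_⊎_; inj₁; inj₂)
open import Data.Vec.Base as Vec using (Vec; []; _∷_; lookup; zipWith; replicate; toList)
open import Data.Vec.Functional using (Vector)
import Data.Vec.Properties as Vecₚ
open import Function.Base using (_∘_)
open import Function.Bundles using (_⇔_; mk⇔; Equivalence)
open import Function.Definitions using (Injective)
open import Level using (0ℓ)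
open import Relation.Binary.Definitions using (Tri; tri<; tri≈; tri>)
open import Relation.Binary.PropositionalEquality hiding ([_])
open import Relation.Nullary
open import Relation.Nullary.Decidable using (dec⇒maybe; decidable-stable)
open import Relation.Unary using (Satisfiable)
open import Tactic.RingSolver using (solve-∀)
open import Tactic.RingSolver.Core.AlmostCommutativeRing using (AlmostCommutativeRing; fromCommutativeRing)
import Algebra.Properties.CommutativeMonoid.Sum ℚₚ.+-0-commutativeMonoid as ℚSum

-- The quotient of `N` by `1 − 𝐱^β` may have a number of terms that grows with `t`, so divisibility
-- cannot be settled by dividing uniformly in `t`. A moment, by contrast, is an expression of fixed
-- shape in the exponents. Division is carried out only at a single fixed `t`, to show that the
-- vanishing of the moments is the right criterion. The normalisation `c · β = 1` makes any two
-- directions equal or not parallel. Factors in different directions then do not interfere: one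
-- merely translates the lines belonging to the other, and a function of finite support that is
-- invariant under a nonzero translation vanishes. The entries of `β = b / C` are quotients of
-- polynomials in `t`, hence germs of rational functions, whose equality and sign are eventually
-- constant. Integrality of the selected points turns germs back into polynomials at the end.
-- Convergence never enters. Its role is taken by `Tame`: a series vanishes far back along every
-- lexicographically positive direction. This makes multiplication by each `1 − 𝐱ᵇ` injective.

ℚring : AlmostCommutativeRing 0ℓ 0ℓ
ℚring = fromCommutativeRing ℚₚ.+-*-commutativeRing λ x → dec⇒maybe (0ℚ ℚₚ.≟ x)

-- The embedding of the integers into the rationals.

toℚᵘ-fromℤ : ∀ i → toℚᵘ (fromℤ i) ℚᵘ.≃ mkℚᵘ i 0
toℚᵘ-fromℤ i = ℚₚ.toℚᵘ-fromℚᵘ (mkℚᵘ i 0)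

fromℤ-+ : ∀ i j → fromℤ (i ℤ.+ j) ≡ fromℤ i + fromℤ j
fromℤ-+ i j = ℚₚ.toℚᵘ-injective (begin
  toℚᵘ (fromℤ (i ℤ.+ j))               ≈⟨ toℚᵘ-fromℤ (i ℤ.+ j) ⟩
  mkℚᵘ (i ℤ.+ j) 0                     ≈⟨ *≡* (cong (ℤ._* ℤ.+ 1) (sym (cong₂ ℤ._+_ (ℤₚ.*-identityʳ i) (ℤₚ.*-identityʳ j)))) ⟩
  mkℚᵘ i 0 ℚᵘ.+ mkℚᵘ j 0               ≈⟨ ℚᵘₚ.+-cong (toℚᵘ-fromℤ i) (toℚᵘ-fromℤ j) ⟨
  toℚᵘ (fromℤ i) ℚᵘ.+ toℚᵘ (fromℤ j)   ≈⟨ ℚₚ.toℚᵘ-homo-+ (fromℤ i) (fromℤ j) ⟨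
  toℚᵘ (fromℤ i + fromℤ j)             ∎)
  where open ℚᵘₚ.≃-Reasoning

fromℤ-* : ∀ i j → fromℤ (i ℤ.* j) ≡ fromℤ i * fromℤ j
fromℤ-* i j = ℚₚ.toℚᵘ-injective (begin
  toℚᵘ (fromℤ (i ℤ.* j))               ≈⟨ toℚᵘ-fromℤ (i ℤ.* j) ⟩
  mkℚᵘ i 0 ℚᵘ.* mkℚᵘ j 0               ≈⟨ ℚᵘₚ.*-cong (toℚᵘ-fromℤ i) (toℚᵘ-fromℤ j) ⟨
  toℚᵘ (fromℤ i) ℚᵘ.* toℚᵘ (fromℤ j)   ≈⟨ ℚₚ.toℚᵘ-homo-* (fromℤ i) (fromℤ j) ⟨
  toℚᵘ (fromℤ i * fromℤ j)             ∎)
  where open ℚᵘₚ.≃-Reasoning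

fromℤ-neg : ∀ i → fromℤ (ℤ.- i) ≡ - fromℤ i
fromℤ-neg i = ℚₚ.toℚᵘ-injective (begin
  toℚᵘ (fromℤ (ℤ.- i))  ≈⟨ toℚᵘ-fromℤ (ℤ.- i) ⟩
  ℚᵘ.- mkℚᵘ i 0         ≈⟨ ℚᵘₚ.-‿cong (toℚᵘ-fromℤ i) ⟨
  ℚᵘ.- toℚᵘ (fromℤ i)   ≈⟨ ℚₚ.toℚᵘ-homo‿- (fromℤ i) ⟨
  toℚᵘ (- fromℤ i)      ∎)
  where open ℚᵘₚ.≃-Reasoning

fromℤ-- : ∀ i j → fromℤ (i ℤ.- j) ≡ fromℤ i - fromℤ j
fromℤ-- i j = trans (fromℤ-+ i (ℤ.- j)) (cong (fromℤ i +_) (fromℤ-neg j))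

fromℤ-mono-≤ : ∀ {i j} → i ℤ.≤ j → fromℤ i ≤ fromℤ j
fromℤ-mono-≤ {i} {j} i≤j = ℚₚ.toℚᵘ-cancel-≤
  (ℚᵘₚ.≤-respˡ-≃ (ℚᵘₚ.≃-sym (toℚᵘ-fromℤ i)) (ℚᵘₚ.≤-respʳ-≃ (ℚᵘₚ.≃-sym (toℚᵘ-fromℤ j))
    (*≤* (subst₂ ℤ._≤_ (sym (ℤₚ.*-identityʳ i)) (sym (ℤₚ.*-identityʳ j)) i≤j))))

fromℤ-mono-< : ∀ {i j} → i ℤ.< j → fromℤ i < fromℤ j
fromℤ-mono-< {i} {j} i<j = ℚₚ.toℚᵘ-cancel-<
  (ℚᵘₚ.<-respˡ-≃ (ℚᵘₚ.≃-sym (toℚᵘ-fromℤ i)) (ℚᵘₚ.<-respʳ-≃ (ℚᵘₚ.≃-sym (toℚᵘ-fromℤ j))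
    (*<* (subst₂ ℤ._<_ (sym (ℤₚ.*-identityʳ i)) (sym (ℤₚ.*-identityʳ j)) i<j))))

fromℤ-cancel-≤ : ∀ {i j} → fromℤ i ≤ fromℤ j → i ℤ.≤ j
fromℤ-cancel-≤ {i} {j} p = ℤₚ.≮⇒≥ λ j<i → ℚₚ.<-irrefl refl (ℚₚ.<-≤-trans (fromℤ-mono-< {j} {i} j<i) p)

fromℤ-cancel-< : ∀ {i j} → fromℤ i < fromℤ j → i ℤ.< j
fromℤ-cancel-< {i} {j} p = ℤₚ.≰⇒> λ j≤i → ℚₚ.<-irrefl refl (ℚₚ.<-≤-trans p (fromℤ-mono-≤ {j} {i} j≤i))

fromℤ-injective : ∀ {i j} → fromℤ i ≡ fromℤ j → i ≡ j
fromℤ-injective {i} {j} p = ℤₚ.≤-antisym (fromℤ-cancel-≤ {i} {j} (ℚₚ.≤-reflexive p)) (fromℤ-cancel-≤ {j} {i} (ℚₚ.≤-reflexive (sym p)))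

fromℕ-suc : ∀ n → fromℕ (suc n) ≡ 1ℚ + fromℕ n
fromℕ-suc n = fromℤ-+ (ℤ.+ 1) (ℤ.+ n)

fromℕ-+ : ∀ m n → fromℕ (m ℕ.+ n) ≡ fromℕ m + fromℕ n
fromℕ-+ m n = fromℤ-+ (ℤ.+ m) (ℤ.+ n)

fromℕ-mono-≤ : ∀ {m n} → m ℕ.≤ n → fromℕ m ≤ fromℕ n
fromℕ-mono-≤ {m} {n} p = fromℤ-mono-≤ {ℤ.+ m} {ℤ.+ n} (ℤ.+≤+ p)

fromℕ-injective : ∀ {m n} → fromℕ m ≡ fromℕ n → m ≡ n
fromℕ-injective {m} {n} p = ℤₚ.+-injective (fromℤ-injective {ℤ.+ m} {ℤ.+ n} p)

0≤fromℕ : ∀ n → 0ℚ ≤ fromℕ n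
0≤fromℕ n = fromℕ-mono-≤ {0} {n} ℕ.z≤n

0<fromℕ-suc : ∀ n → 0ℚ < fromℕ (suc n)
0<fromℕ-suc n = fromℤ-mono-< {ℤ.+ 0} {ℤ.+ suc n} (ℤ.+<+ (ℕ.s≤s ℕ.z≤n))

0<1 : 0ℚ < 1ℚ
0<1 = 0<fromℕ-suc 0

-- Ordered fields

+-pos : ∀ {p q} → 0ℚ < p → 0ℚ < q → 0ℚ < p + q
+-pos a b = ℚₚ.+-mono-< a b

+-nonneg : ∀ {p q} → 0ℚ ≤ p → 0ℚ ≤ q → 0ℚ ≤ p + q
+-nonneg a b = ℚₚ.+-mono-≤ a b

+-pos-nonneg : ∀ {p q} → 0ℚ < p → 0ℚ ≤ q → 0ℚ < p + q
+-pos-nonneg a b = ℚₚ.+-mono-<-≤ a b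

*-pos : ∀ {p q} → 0ℚ < p → 0ℚ < q → 0ℚ < p * q
*-pos {p} {q} a b = ℚₚ.positive⁻¹ (p * q) {{ℚₚ.pos*pos⇒pos p {{ℚ.positive a}} q {{ℚ.positive b}}}}

*-nonneg : ∀ {p q} → 0ℚ ≤ p → 0ℚ ≤ q → 0ℚ ≤ p * q
*-nonneg {p} {q} a b = ℚₚ.nonNegative⁻¹ (p * q) {{ℚₚ.nonNeg*nonNeg⇒nonNeg p {{ℚ.nonNegative a}} q {{ℚ.nonNegative b}}}}

neg-pos : ∀ {p} → p < 0ℚ → 0ℚ < - p
neg-pos a = ℚₚ.neg-antimono-< a

neg-involutive : ∀ p → - - p ≡ p
neg-involutive = solve-∀ ℚring

minus-swap : ∀ p q → q - p ≡ - (p - q)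
minus-swap = solve-∀ ℚring

neg-pos⁻ : ∀ {p} → 0ℚ < - p → p < 0ℚ
neg-pos⁻ {p} a = subst (_< 0ℚ) (neg-involutive p) (ℚₚ.neg-antimono-< a)

diff-pos : ∀ {p q} → p < q → 0ℚ < q - p
diff-pos {p} {q} a = subst (_< q - p) (ℚₚ.+-inverseʳ p) (ℚₚ.+-monoˡ-< (- p) a)

diff-nonneg : ∀ {p q} → p ≤ q → 0ℚ ≤ q - p
diff-nonneg {p} {q} a = subst (_≤ q - p) (ℚₚ.+-inverseʳ p) (ℚₚ.+-monoˡ-≤ (- p) a)

+-cancel-diff : ∀ p q → q - p + p ≡ q
+-cancel-diff = solve-∀ ℚring

diff-pos⁻ : ∀ {p q} → 0ℚ < q - p → p < q
diff-pos⁻ {p} {q} a = subst₂ _<_ (ℚₚ.+-identityˡ p) (+-cancel-diff p q) (ℚₚ.+-monoˡ-< p a)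

diff-nonneg⁻ : ∀ {p q} → 0ℚ ≤ q - p → p ≤ q
diff-nonneg⁻ {p} {q} a = subst₂ _≤_ (ℚₚ.+-identityˡ p) (+-cancel-diff p q) (ℚₚ.+-monoˡ-≤ p a)

diff≡0 : ∀ {p q} → p - q ≡ 0ℚ → p ≡ q
diff≡0 {p} {q} e = trans (sym (+-cancel-diff q p)) (trans (cong (_+ q) e) (ℚₚ.+-identityˡ q))

sign : ∀ p → 0ℚ < p ⊎ p ≡ 0ℚ ⊎ 0ℚ < - p
sign p with ℚₚ.<-cmp p 0ℚ
... | tri< a _ _ = inj₂ (inj₂ (neg-pos a))
... | tri≈ _ b _ = inj₂ (inj₁ b)
... | tri> _ _ c = inj₁ c

pos≢0 : ∀ {p} → 0ℚ < p → p ≢ 0ℚ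
pos≢0 a e = ℚₚ.<-irrefl (sym e) a

square-nonneg : ∀ p → 0ℚ ≤ p * p
square-nonneg p with sign p
... | inj₁ a = ℚₚ.<⇒≤ (*-pos a a)
... | inj₂ (inj₁ refl) = ℚₚ.≤-refl
... | inj₂ (inj₂ a) = subst (0ℚ ≤_) (lemma p) (ℚₚ.<⇒≤ (*-pos a a))
  where
  lemma : ∀ p → - p * - p ≡ p * p
  lemma = solve-∀ ℚring

-- The inverse is total, with 1/0 = 0.

inverse : ℚ → ℚ
inverse p with p ℚₚ.≟ 0ℚ
... | yes _ = 0ℚ
... | no p≢0 = (ℚ.1/ p) {{ℚ.≢-nonZero p≢0}}

*-inverse : ∀ {p} → p ≢ 0ℚ → p * inverse p ≡ 1ℚ
*-inverse {p} p≢0 with p ℚₚ.≟ 0ℚ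
... | yes e = ⊥-elim (p≢0 e)
... | no p≢0′ = ℚₚ.*-inverseʳ p {{ℚ.≢-nonZero p≢0′}}

*-≢0 : ∀ {p q} → p ≢ 0ℚ → q ≢ 0ℚ → p * q ≢ 0ℚ
*-≢0 {p} {q} a b e = b (begin
  q                    ≡⟨ ℚₚ.*-identityˡ q ⟨
  1ℚ * q               ≡⟨ cong (_* q) (*-inverse a) ⟨
  p * inverse p * q    ≡⟨ lemma p (inverse p) q ⟩
  inverse p * (p * q)  ≡⟨ cong (inverse p *_) e ⟩
  inverse p * 0ℚ       ≡⟨ ℚₚ.*-zeroʳ (inverse p) ⟩
  0ℚ                   ∎)
  where
  open ≡-Reasoning
  lemma : ∀ x y z → x * y * z ≡ y * (x * z)
  lemma = solve-∀ ℚring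

*-cancel-0 : ∀ {p q} → p ≢ 0ℚ → p * q ≡ 0ℚ → q ≡ 0ℚ
*-cancel-0 {p} {q} a e with q ℚₚ.≟ 0ℚ
... | yes q≡0 = q≡0
... | no q≢0 = ⊥-elim (*-≢0 a q≢0 e)

inverse-pos : ∀ {p} → 0ℚ < p → 0ℚ < inverse p
inverse-pos {p} 0<p with sign (inverse p)
... | inj₁ a = a
... | inj₂ (inj₁ e) = ⊥-elim (pos≢0 0<1 (trans (sym (*-inverse (pos≢0 0<p))) (trans (cong (p *_) e) (ℚₚ.*-zeroʳ p))))
... | inj₂ (inj₂ a) = ⊥-elim (ℚₚ.<-irrefl refl (ℚₚ.<-trans 0<1 (neg-pos⁻ (subst (0ℚ <_) eq (*-pos 0<p a)))))
  where
  eq : p * - inverse p ≡ - 1ℚ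
  eq = trans (sym (ℚₚ.neg-distribʳ-* p (inverse p))) (cong -_ (*-inverse (pos≢0 0<p)))

fromℤ-↥ : ∀ p → p * fromℤ (↧ p) ≡ fromℤ (↥ p)
fromℤ-↥ p@record{} = ℚₚ.toℚᵘ-injective (begin
  toℚᵘ (p * fromℤ (↧ p))            ≈⟨ ℚₚ.toℚᵘ-homo-* p (fromℤ (↧ p)) ⟩
  toℚᵘ p ℚᵘ.* toℚᵘ (fromℤ (↧ p))    ≈⟨ ℚᵘₚ.*-cong (ℚᵘₚ.≃-refl {toℚᵘ p}) (toℚᵘ-fromℤ (↧ p)) ⟩
  toℚᵘ p ℚᵘ.* mkℚᵘ (↧ p) 0          ≈⟨ *≡* lemma ⟩
  mkℚᵘ (↥ p) 0                      ≈⟨ toℚᵘ-fromℤ (↥ p) ⟨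
  toℚᵘ (fromℤ (↥ p))                ∎)
  where
  open ℚᵘₚ.≃-Reasoning
  lemma : (↥ p ℤ.* ↧ p) ℤ.* ℤ.+ 1 ≡ ↥ p ℤ.* ℤ.+ (ℚ.↧ₙ p ℕ.* 1)
  lemma = trans (ℤₚ.*-identityʳ (↥ p ℤ.* ↧ p)) (cong (λ d → ↥ p ℤ.* ℤ.+ d) (sym (ℕₚ.*-identityʳ (ℚ.↧ₙ p))))

archimedean : ∀ p → ∃[ n ] (∀ m → n ℕ.≤ m → p ≤ fromℕ m)
archimedean p@record{} = n , λ m n≤m → ℚₚ.≤-trans bound (fromℕ-mono-≤ {n} {m} n≤m)
  where
  n = ℤ.∣ ↥ p ∣
  num≤ : ∀ i → i ℤ.≤ ℤ.+ ℤ.∣ i ∣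
  num≤ (ℤ.+ k) = ℤₚ.≤-refl
  num≤ (ℤ.-[1+ k ]) = ℤ.-≤+
  n≤ : ∀ d → ℤ.+ n ℤ.≤ ℤ.+ n ℤ.* ℤ.+ suc d
  n≤ d = subst (ℤ.+ n ℤ.≤_) (ℤₚ.pos-* n (suc d)) (ℤ.+≤+ (ℕₚ.m≤m*n n (suc d)))
  bound : p ≤ fromℕ n
  bound = ℚₚ.toℚᵘ-cancel-≤ (ℚᵘₚ.≤-respʳ-≃ (ℚᵘₚ.≃-sym (toℚᵘ-fromℤ (ℤ.+ n)))
    (*≤* (subst (ℤ._≤ ℤ.+ n ℤ.* ↧ p) (sym (ℤₚ.*-identityʳ (↥ p))) (ℤₚ.≤-trans (num≤ (↥ p)) (n≤ _)))))

archimedean-* : ∀ {ε} → 0ℚ < ε → ∀ p → ∃[ n ] (∀ m → n ℕ.≤ m → p ≤ fromℕ m * ε)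
archimedean-* {ε} 0<ε p with archimedean (p * inverse ε)
... | n , bound = n , λ m n≤m → subst (_≤ fromℕ m * ε) eq
        (ℚₚ.*-monoʳ-≤-nonNeg ε {{ℚ.nonNegative (ℚₚ.<⇒≤ 0<ε)}} (bound m n≤m))
  where
  lemma : ∀ x y z → x * y * z ≡ x * (z * y)
  lemma = solve-∀ ℚring
  eq : p * inverse ε * ε ≡ p
  eq = trans (lemma p (inverse ε) ε) (trans (cong (p *_) (*-inverse (pos≢0 0<ε))) (ℚₚ.*-identityʳ p))

square-pos : ∀ {p} → p ≢ 0ℚ → 0ℚ < p * p
square-pos {p} p≢0 with sign (p * p)
... | inj₁ a = a
... | inj₂ (inj₁ z) = ⊥-elim (*-≢0 p≢0 p≢0 z)
... | inj₂ (inj₂ n) = ⊥-elim (ℚₚ.<-irrefl refl (ℚₚ.<-≤-trans (neg-pos⁻ n) (square-nonneg p)))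

*-pos-cancel : ∀ {p q} → 0ℚ < q → 0ℚ < p * q → 0ℚ < p
*-pos-cancel {p} {q} 0<q 0<pq with sign p
... | inj₁ a = a
... | inj₂ (inj₁ refl) = ⊥-elim (ℚₚ.<-irrefl (sym (ℚₚ.*-zeroˡ q)) 0<pq)
... | inj₂ (inj₂ a) = ⊥-elim (ℚₚ.<-asym 0<pq (neg-pos⁻ (subst (0ℚ <_) (sym (ℚₚ.neg-distribˡ-* p q)) (*-pos a 0<q))))

-- Eventual and settled predicates

Ev : (ℕ → Set) → Set
Ev P = ∃[ T ] (∀ t → T ℕ.≤ t → P t)

module _ {P Q : ℕ → Set} where

  Ev-map : (∀ t → P t → Q t) → Ev P → Ev Q
  Ev-map f (T , p) = T , λ t T≤t → f t (p t T≤t)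

  Ev-× : Ev P → Ev Q → Ev (λ t → P t × Q t)
  Ev-× (T , p) (T′ , q) = T ℕ.⊔ T′ , λ t le →
    p t (ℕₚ.≤-trans (ℕₚ.m≤m⊔n T T′) le) , q t (ℕₚ.≤-trans (ℕₚ.m≤n⊔m T T′) le)

Ev-map₂ : {P Q R : ℕ → Set} → (∀ t → P t → Q t → R t) → Ev P → Ev Q → Ev R
Ev-map₂ f p q = Ev-map (λ t (a , b) → f t a b) (Ev-× p q)

Ev-always : {P : ℕ → Set} → (∀ t → P t) → Ev P
Ev-always p = 0 , λ t _ → p t

Ev-All : {X : Set} {P : X → ℕ → Set} {xs : List X} →
         All (λ x → Ev (P x)) xs → Ev (λ t → All (λ x → P x t) xs)
Ev-All [] = Ev-always λ _ → []
Ev-All (p ∷ ps) = Ev-map₂ (λ _ → _∷_) p (Ev-All ps)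

Ev-Fin : ∀ {n} {P : Fin n → ℕ → Set} → (∀ i → Ev (P i)) → Ev (λ t → ∀ i → P i t)
Ev-Fin {zero} p = Ev-always λ _ ()
Ev-Fin {suc n} p = Ev-map₂ (λ { _ a b zero → a ; _ a b (suc i) → b i }) (p zero) (Ev-Fin (p ∘ suc))

-- Much stronger than deciding `P t` for each `t`: a single alternative has to hold for all large
-- `t`. On a residue class this is what yields eventual periodicity.
Settled : (ℕ → Set) → Set
Settled P = Ev P ⊎ Ev (λ t → ¬ P t)

settled-const : {P : Set} → Dec P → Settled (λ _ → P)
settled-const (yes p) = inj₁ (Ev-always λ _ → p)
settled-const (no ¬p) = inj₂ (Ev-always λ _ → ¬p)

module _ {P Q : ℕ → Set} where

  settled-iff : Ev (λ t → (P t → Q t) × (Q t → P t)) → Settled P → Settled Q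
  settled-iff e (inj₁ p) = inj₁ (Ev-map₂ (λ _ (f , _) → f) e p)
  settled-iff e (inj₂ p) = inj₂ (Ev-map₂ (λ _ (_ , g) ¬p → ¬p ∘ g) e p)

  settled-⇔ : (∀ t → P t → Q t) → (∀ t → Q t → P t) → Settled P → Settled Q
  settled-⇔ f g = settled-iff (Ev-always λ t → f t , g t)

  settled-× : Settled P → Settled Q → Settled (λ t → P t × Q t)
  settled-× (inj₁ p) (inj₁ q) = inj₁ (Ev-× p q)
  settled-× (inj₂ p) _ = inj₂ (Ev-map (λ _ ¬p → ¬p ∘ proj₁) p)
  settled-× _ (inj₂ q) = inj₂ (Ev-map (λ _ ¬q → ¬q ∘ proj₂) q)

  settled-⊎ : Settled P → Settled Q → Settled (λ t → P t ⊎ Q t)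
  settled-⊎ (inj₁ p) _ = inj₁ (Ev-map (λ _ → inj₁) p)
  settled-⊎ _ (inj₁ q) = inj₁ (Ev-map (λ _ → inj₂) q)
  settled-⊎ (inj₂ p) (inj₂ q) = inj₂ (Ev-map₂ (λ { _ ¬p _ (inj₁ x) → ¬p x ; _ _ ¬q (inj₂ y) → ¬q y }) p q)

  settled-→ : Settled P → Settled Q → Settled (λ t → P t → Q t)
  settled-→ _ (inj₁ q) = inj₁ (Ev-map (λ _ q _ → q) q)
  settled-→ (inj₂ p) _ = inj₁ (Ev-map (λ _ ¬p x → ⊥-elim (¬p x)) p)
  settled-→ (inj₁ p) (inj₂ q) = inj₂ (Ev-map₂ (λ _ x ¬q f → ¬q (f x)) p q)

settled-¬ : {P : ℕ → Set} → Settled P → Settled (λ t → ¬ P t)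
settled-¬ s = settled-→ s (settled-const {⊥} (no λ ()))

settled-All : {X : Set} {P : X → ℕ → Set} {xs : List X} →
              All (λ x → Settled (P x)) xs → Settled (λ t → All (λ x → P x t) xs)
settled-All [] = inj₁ (Ev-always λ _ → [])
settled-All (s ∷ ss) = settled-⇔ (λ _ (a , b) → a ∷ b) (λ { _ (a ∷ b) → a , b }) (settled-× s (settled-All ss))

settled-bounded : {P : ℕ → ℕ → Set} → ∀ n → (∀ i → Settled (P i)) → Settled (λ t → ∀ i → i ℕ.< n → P i t)
settled-bounded zero s = inj₁ (Ev-always λ _ _ ())
settled-bounded {P} (suc n) s = settled-⇔
  (λ { t (a , b) zero _ → a ; t (a , b) (suc i) (ℕ.s≤s i<n) → b i i<n })
  (λ t f → f 0 (ℕ.s≤s ℕ.z≤n) , λ i i<n → f (suc i) (ℕ.s≤s i<n))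
  (settled-× (s 0) (settled-bounded n (s ∘ suc)))

-- Polynomials

addP : Poly → Poly → Poly
addP [] q = q
addP p [] = p
addP (a ∷ p) (b ∷ q) = a + b ∷ addP p q

scaleP : ℚ → Poly → Poly
scaleP a = List.map (a *_)

mulP : Poly → Poly → Poly
mulP [] q = []
mulP (a ∷ p) q = addP (scaleP a q) (0ℚ ∷ mulP p q)

horner-+ : ∀ a b x u v → a + b + x * (u + v) ≡ a + x * u + (b + x * v)
horner-+ = solve-∀ ℚring

horner-* : ∀ a b x u → a * b + x * (a * u) ≡ a * (b + x * u)
horner-* = solve-∀ ℚring

eval-addP : ∀ p q x → eval (addP p q) x ≡ eval p x + eval q x
eval-addP [] q x = sym (ℚₚ.+-identityˡ _)
eval-addP (a ∷ p) [] x = sym (ℚₚ.+-identityʳ _)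
eval-addP (a ∷ p) (b ∷ q) x =
  trans (cong (λ e → a + b + x * e) (eval-addP p q x)) (horner-+ a b x (eval p x) (eval q x))

eval-scaleP : ∀ a p x → eval (scaleP a p) x ≡ a * eval p x
eval-scaleP a [] x = sym (ℚₚ.*-zeroʳ a)
eval-scaleP a (b ∷ p) x = trans (cong (λ e → a * b + x * e) (eval-scaleP a p x)) (horner-* a b x (eval p x))

eval-mulP : ∀ p q x → eval (mulP p q) x ≡ eval p x * eval q x
eval-mulP [] q x = sym (ℚₚ.*-zeroˡ (eval q x))
eval-mulP (a ∷ p) q x = begin
  eval (addP (scaleP a q) (0ℚ ∷ mulP p q)) x             ≡⟨ eval-addP (scaleP a q) (0ℚ ∷ mulP p q) x ⟩
  eval (scaleP a q) x + (0ℚ + x * eval (mulP p q) x)     ≡⟨ cong₂ (λ u v → u + (0ℚ + x * v)) (eval-scaleP a q x) (eval-mulP p q x) ⟩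
  a * eval q x + (0ℚ + x * (eval p x * eval q x))        ≡⟨ lemma a x (eval p x) (eval q x) ⟩
  (a + x * eval p x) * eval q x                          ∎
  where
  open ≡-Reasoning
  lemma : ∀ a x u v → a * v + (0ℚ + x * (u * v)) ≡ (a + x * u) * v
  lemma = solve-∀ ℚring

eval-const : ∀ a x → a + x * 0ℚ ≡ a
eval-const = solve-∀ ℚring

eval-zeros : ∀ {p} → All (_≡ 0ℚ) p → ∀ x → eval p x ≡ 0ℚ
eval-zeros [] x = refl
eval-zeros (refl ∷ z) x = trans (cong (λ e → 0ℚ + x * e) (eval-zeros z x)) (trans (ℚₚ.+-identityˡ _) (ℚₚ.*-zeroʳ x))

-- The uniform bound `ε` drives the induction: if the inner Horner value is at least `ε`, then `x`
-- times it outgrows any constant term `a`. Positivity of the inner value alone would not give this.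
growth : ∀ p {z} → 0ℚ < z → ∃[ ε ] 0ℚ < ε × Ev (λ t → ε ≤ eval (p ++ [ z ]) (fromℕ t))
growth [] {z} 0<z = z , 0<z , Ev-always λ t → ℚₚ.≤-reflexive (sym (eval-const z (fromℕ t)))
growth (a ∷ p) 0<z with growth p 0<z
... | ε , 0<ε , ev = ε , 0<ε , Ev-map₂ (λ t → step (fromℕ t) (eval (p ++ [ _ ]) (fromℕ t)) (0≤fromℕ t)) ev (archimedean-* 0<ε (ε - a))
  where
  lemma : ∀ x e a ε → x * (e - ε) + (x * ε - (ε - a)) ≡ a + x * e - ε
  lemma = solve-∀ ℚring
  step : ∀ x e → 0ℚ ≤ x → ε ≤ e → ε - a ≤ x * ε → ε ≤ a + x * e
  step x e 0≤x ε≤e le = diff-nonneg⁻ (subst (0ℚ ≤_) (lemma x e a ε)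
    (+-nonneg (*-nonneg 0≤x (diff-nonneg ε≤e)) (diff-nonneg le)))

growth-pos : ∀ p {z} → 0ℚ < z → Ev (λ t → 0ℚ < eval (p ++ [ z ]) (fromℕ t))
growth-pos p 0<z with growth p 0<z
... | _ , 0<ε , ev = Ev-map (λ _ → ℚₚ.<-≤-trans 0<ε) ev

growth-neg : ∀ p {z} → 0ℚ < - z → Ev (λ t → 0ℚ < - eval (p ++ [ z ]) (fromℕ t))
growth-neg p {z} 0<-z = Ev-map (λ t → subst (0ℚ <_) (negated p (fromℕ t))) (growth-pos (List.map -_ p) 0<-z)
  where
  lemma : ∀ a x u → - a + x * - u ≡ - (a + x * u)
  lemma = solve-∀ ℚring
  negated : ∀ p x → eval (List.map -_ p ++ [ - z ]) x ≡ - eval (p ++ [ z ]) x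
  negated [] x = trans (eval-const (- z) x) (cong -_ (sym (eval-const z x)))
  negated (a ∷ p) x = trans (cong (λ e → - a + x * e) (negated p x)) (lemma a x _)

-- Coefficient lists may end in zeros; stripping them exposes the true leading coefficient `z`.
leadingForm : ∀ p → All (_≡ 0ℚ) p ⊎ (∃[ p′ ] ∃[ z ] z ≢ 0ℚ × (∀ x → eval p x ≡ eval (p′ ++ [ z ]) x))
leadingForm [] = inj₁ []
leadingForm (a ∷ p) with leadingForm p | a ℚₚ.≟ 0ℚ
... | inj₂ (p′ , z , z≢0 , e) | _ = inj₂ (a ∷ p′ , z , z≢0 , λ x → cong (λ u → a + x * u) (e x))
... | inj₁ zs | yes a≡0 = inj₁ (a≡0 ∷ zs)
... | inj₁ zs | no a≢0 = inj₂ ([] , a , a≢0 , λ x → cong (λ u → a + x * u) (eval-zeros zs x))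

polySign : ∀ p → All (_≡ 0ℚ) p ⊎ Ev (λ t → 0ℚ < eval p (fromℕ t)) ⊎ Ev (λ t → 0ℚ < - eval p (fromℕ t))
polySign p = Sum.map₂ by-leading (leadingForm p)
  where
  by-leading : (∃[ p′ ] ∃[ z ] z ≢ 0ℚ × (∀ x → eval p x ≡ eval (p′ ++ [ z ]) x)) →
               Ev (λ t → 0ℚ < eval p (fromℕ t)) ⊎ Ev (λ t → 0ℚ < - eval p (fromℕ t))
  by-leading (p′ , z , z≢0 , e) = by-sign (sign z)
    where
    by-sign : 0ℚ < z ⊎ z ≡ 0ℚ ⊎ 0ℚ < - z → Ev (λ t → 0ℚ < eval p (fromℕ t)) ⊎ Ev (λ t → 0ℚ < - eval p (fromℕ t))
    by-sign (inj₁ 0<z) = inj₁ (Ev-map (λ t → subst (0ℚ <_) (sym (e (fromℕ t)))) (growth-pos p′ 0<z))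
    by-sign (inj₂ (inj₁ z≡0)) = ⊥-elim (z≢0 z≡0)
    by-sign (inj₂ (inj₂ z<0)) = inj₂ (Ev-map (λ t → subst (λ u → 0ℚ < - u) (sym (e (fromℕ t)))) (growth-neg p′ z<0))

neg≢0 : ∀ {p} → 0ℚ < - p → p ≢ 0ℚ
neg≢0 a refl = pos≢0 a refl

poly-≢0 : ∀ p → All (_≡ 0ℚ) p ⊎ Ev (λ t → eval p (fromℕ t) ≢ 0ℚ)
poly-≢0 p = Sum.map₂ Sum.[ Ev-map (λ _ → pos≢0) , Ev-map (λ _ → neg≢0) ]′ (polySign p)

settled-poly-pos : ∀ p → Settled (λ t → 0ℚ < eval p (fromℕ t))
settled-poly-pos p = Sum.[ (λ zs → inj₂ (Ev-always λ t a → pos≢0 a (eval-zeros zs (fromℕ t)))) ,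
  Sum.map₂ (Ev-map (λ t a b → ℚₚ.<-asym b (neg-pos⁻ a))) ]′ (polySign p)

-- Germs at infinity of rational functions

record Germ (f : ℕ → ℚ) : Set where
  constructor germ
  field
    numerator denominator : Poly
    quotient : Ev (λ t → eval denominator (fromℕ t) ≢ 0ℚ × f t * eval denominator (fromℕ t) ≡ eval numerator (fromℕ t))

germ-cong : ∀ {f g} → Ev (λ t → f t ≡ g t) → Germ f → Germ g
germ-cong e (germ P Q ev) = germ P Q (Ev-map₂ (λ { t refl′ (a , b) → a , trans (cong (_* eval Q (fromℕ t)) (sym refl′)) b }) e ev)

germ-≗ : ∀ {f g} → (∀ t → f t ≡ g t) → Germ f → Germ g
germ-≗ e = germ-cong (Ev-always e)

germ-poly : ∀ p → Germ (λ t → eval p (fromℕ t))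
germ-poly p = germ p [ 1ℚ ] (Ev-always λ t →
  (λ e → pos≢0 0<1 (trans (sym (eval-const 1ℚ (fromℕ t))) e)) ,
  trans (cong (eval p (fromℕ t) *_) (eval-const 1ℚ (fromℕ t))) (ℚₚ.*-identityʳ _))

germ-const : ∀ a → Germ (λ _ → a)
germ-const a = germ-≗ (λ t → eval-const a (fromℕ t)) (germ-poly [ a ])

module _ {f g : ℕ → ℚ} where

  germ-+ : Germ f → Germ g → Germ (λ t → f t + g t)
  germ-+ (germ P Q e) (germ P′ Q′ e′) =
    germ (addP (mulP P Q′) (mulP P′ Q)) (mulP Q Q′) (Ev-map₂ (λ t → step (fromℕ t) (f t) (g t)) e e′)
    where
    open ≡-Reasoning
    lemma : ∀ u v q q′ → (u + v) * (q * q′) ≡ (u * q) * q′ + (v * q′) * q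
    lemma = solve-∀ ℚring
    step : ∀ x u v → eval Q x ≢ 0ℚ × u * eval Q x ≡ eval P x → eval Q′ x ≢ 0ℚ × v * eval Q′ x ≡ eval P′ x →
           eval (mulP Q Q′) x ≢ 0ℚ × (u + v) * eval (mulP Q Q′) x ≡ eval (addP (mulP P Q′) (mulP P′ Q)) x
    step x u v (a , b) (a′ , b′) = subst (_≢ 0ℚ) (sym (eval-mulP Q Q′ x)) (*-≢0 a a′) , (begin
      (u + v) * eval (mulP Q Q′) x                              ≡⟨ cong ((u + v) *_) (eval-mulP Q Q′ x) ⟩
      (u + v) * (eval Q x * eval Q′ x)                          ≡⟨ lemma u v (eval Q x) (eval Q′ x) ⟩
      (u * eval Q x) * eval Q′ x + (v * eval Q′ x) * eval Q x   ≡⟨ cong₂ (λ u v → u * eval Q′ x + v * eval Q x) b b′ ⟩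
      eval P x * eval Q′ x + eval P′ x * eval Q x               ≡⟨ cong₂ _+_ (eval-mulP P Q′ x) (eval-mulP P′ Q x) ⟨
      eval (mulP P Q′) x + eval (mulP P′ Q) x                   ≡⟨ eval-addP (mulP P Q′) (mulP P′ Q) x ⟨
      eval (addP (mulP P Q′) (mulP P′ Q)) x                     ∎)

  germ-* : Germ f → Germ g → Germ (λ t → f t * g t)
  germ-* (germ P Q e) (germ P′ Q′ e′) =
    germ (mulP P P′) (mulP Q Q′) (Ev-map₂ (λ t → step (fromℕ t) (f t) (g t)) e e′)
    where
    open ≡-Reasoning
    lemma : ∀ u v q q′ → (u * v) * (q * q′) ≡ (u * q) * (v * q′)
    lemma = solve-∀ ℚring
    step : ∀ x u v → eval Q x ≢ 0ℚ × u * eval Q x ≡ eval P x → eval Q′ x ≢ 0ℚ × v * eval Q′ x ≡ eval P′ x →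
           eval (mulP Q Q′) x ≢ 0ℚ × (u * v) * eval (mulP Q Q′) x ≡ eval (mulP P P′) x
    step x u v (a , b) (a′ , b′) = subst (_≢ 0ℚ) (sym (eval-mulP Q Q′ x)) (*-≢0 a a′) , (begin
      (u * v) * eval (mulP Q Q′) x          ≡⟨ cong ((u * v) *_) (eval-mulP Q Q′ x) ⟩
      (u * v) * (eval Q x * eval Q′ x)      ≡⟨ lemma u v (eval Q x) (eval Q′ x) ⟩
      (u * eval Q x) * (v * eval Q′ x)      ≡⟨ cong₂ _*_ b b′ ⟩
      eval P x * eval P′ x                  ≡⟨ eval-mulP P P′ x ⟨
      eval (mulP P P′) x                    ∎)

module _ {f : ℕ → ℚ} where

  germ-neg : Germ f → Germ (λ t → - f t)
  germ-neg g = germ-≗ (λ t → lemma (f t)) (germ-* (germ-const (- 1ℚ)) g)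
    where
    lemma : ∀ u → - 1ℚ * u ≡ - u
    lemma = solve-∀ ℚring

  -- Only the numerator counts, and a polynomial is identically zero or eventually nonzero. All
  -- other settledness results for vectors, orders and moments come from this one and from
  -- `settled-pos`.
  settled-≡0 : Germ f → Settled (λ t → f t ≡ 0ℚ)
  settled-≡0 (germ P Q e) = Sum.map (λ zs → Ev-map (λ t → zero-quotient zs (fromℕ t) (f t)) e)
      (Ev-map₂ (λ t → nonzero-quotient (fromℕ t) (f t)) e) (poly-≢0 P)
    where
    zero-quotient : All (_≡ 0ℚ) P → ∀ x u → eval Q x ≢ 0ℚ × u * eval Q x ≡ eval P x → u ≡ 0ℚ
    zero-quotient zs x u (a , b) = *-cancel-0 a (trans (ℚₚ.*-comm _ u) (trans b (eval-zeros zs x)))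
    nonzero-quotient : ∀ x u → eval Q x ≢ 0ℚ × u * eval Q x ≡ eval P x → eval P x ≢ 0ℚ → u ≢ 0ℚ
    nonzero-quotient x u (a , b) P≢0 u≡0 = P≢0 (trans (sym b) (trans (cong (_* eval Q x) u≡0) (ℚₚ.*-zeroˡ (eval Q x))))

  -- From `f Q = P` follows `f Q² = P Q`, so `f` has the sign of the polynomial `P Q`.
  settled-pos : Germ f → Settled (λ t → 0ℚ < f t)
  settled-pos (germ P Q e) = settled-iff (Ev-map (λ t → iff (fromℕ t) (f t)) e) (settled-poly-pos (mulP P Q))
    where
    lemma : ∀ u q → u * (q * q) ≡ (u * q) * q
    lemma = solve-∀ ℚring
    iff : ∀ x u → eval Q x ≢ 0ℚ × u * eval Q x ≡ eval P x →
          (0ℚ < eval (mulP P Q) x → 0ℚ < u) × (0ℚ < u → 0ℚ < eval (mulP P Q) x)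
    iff x u (a , b) = (λ p → *-pos-cancel (square-pos a) (subst (0ℚ <_) (sym eq) p)) ,
                      (λ p → subst (0ℚ <_) eq (*-pos p (square-pos a)))
      where
      eq : u * (eval Q x * eval Q x) ≡ eval (mulP P Q) x
      eq = trans (lemma u _) (trans (cong (_* eval Q x) b) (sym (eval-mulP P Q x)))

germ-- : ∀ {f g} → Germ f → Germ g → Germ (λ t → f t - g t)
germ-- a b = germ-+ a (germ-neg b)

settled-≡ : ∀ {f g} → Germ f → Germ g → Settled (λ t → f t ≡ g t)
settled-≡ {f} {g} a b = settled-⇔ (λ _ → diff≡0) (λ t e → trans (cong (λ u → f t - u) (sym e)) (ℚₚ.+-inverseʳ (f t))) (settled-≡0 (germ-- a b))

-- A germ that eventually vanishes has the inverse `0ℚ` by the convention for `inverse`. Otherwise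
-- the numerator is eventually nonzero and the two polynomials change places.
germ-inverse : ∀ {f} → Germ f → Germ (λ t → inverse (f t))
germ-inverse {f} g@(germ P Q e) = Sum.[ (λ z → germ-cong (Ev-map (λ t f≡0 → cong inverse (sym f≡0)) z) (germ-const 0ℚ)) ,
    (λ nz → germ Q P (Ev-map₂ (λ t → step (fromℕ t) (f t)) e nz)) ]′ (settled-≡0 g)
  where
  open ≡-Reasoning
  lemma : ∀ i u q → i * (u * q) ≡ (u * i) * q
  lemma = solve-∀ ℚring
  step : ∀ x u → eval Q x ≢ 0ℚ × u * eval Q x ≡ eval P x → u ≢ 0ℚ → eval P x ≢ 0ℚ × inverse u * eval P x ≡ eval Q x
  step x u (a , b) u≢0 = subst (_≢ 0ℚ) b (*-≢0 u≢0 a) , (begin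
    inverse u * eval P x          ≡⟨ cong (inverse u *_) b ⟨
    inverse u * (u * eval Q x)    ≡⟨ lemma (inverse u) u (eval Q x) ⟩
    (u * inverse u) * eval Q x    ≡⟨ cong (_* eval Q x) (*-inverse u≢0) ⟩
    1ℚ * eval Q x                 ≡⟨ ℚₚ.*-identityˡ (eval Q x) ⟩
    eval Q x                      ∎)

germ-if : ∀ {P : ℕ → Set} {f g h : ℕ → ℚ} → Settled P → Germ f → Germ g →
          (∀ t → P t → h t ≡ f t) → (∀ t → ¬ P t → h t ≡ g t) → Germ h
germ-if (inj₁ p) a b hf hg = germ-cong (Ev-map (λ t x → sym (hf t x)) p) a
germ-if (inj₂ p) a b hf hg = germ-cong (Ev-map (λ t x → sym (hg t x)) p) b

-- Rational vectors, linear functionals and backward rays.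

infixl 6 _⊕_ _⊖_
infixr 7 _⊙_

_⊕_ _⊖_ : ∀ {d} → Vec ℚ d → Vec ℚ d → Vec ℚ d
_⊕_ = zipWith _+_
_⊖_ = zipWith _-_

_⊙_ : ∀ {d} → ℚ → Vec ℚ d → Vec ℚ d
a ⊙ v = Vec.map (a *_) v

0ᵛ : ∀ {d} → Vec ℚ d
0ᵛ = replicate _ 0ℚ

⊖-⊖-comm : ∀ {d} (s a b : Vec ℚ d) → (s ⊖ a) ⊖ b ≡ (s ⊖ b) ⊖ a
⊖-⊖-comm [] [] [] = refl
⊖-⊖-comm (x ∷ s) (y ∷ a) (z ∷ b) = cong₂ _∷_ (lemma x y z) (⊖-⊖-comm s a b)
  where
  lemma : ∀ x y z → (x - y) - z ≡ (x - z) - y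
  lemma = solve-∀ ℚring

⊖-⊕-cancel : ∀ {d} (s b : Vec ℚ d) → (s ⊖ b) ⊕ b ≡ s
⊖-⊕-cancel [] [] = refl
⊖-⊕-cancel (x ∷ s) (y ∷ b) = cong₂ _∷_ (+-cancel-diff y x) (⊖-⊕-cancel s b)

⊕-⊖-cancel : ∀ {d} (s b : Vec ℚ d) → (s ⊕ b) ⊖ b ≡ s
⊕-⊖-cancel [] [] = refl
⊕-⊖-cancel (x ∷ s) (y ∷ b) = cong₂ _∷_ (lemma x y) (⊕-⊖-cancel s b)
  where
  lemma : ∀ x y → (x + y) - y ≡ x
  lemma = solve-∀ ℚring

⊕-assoc : ∀ {d} (a b c : Vec ℚ d) → (a ⊕ b) ⊕ c ≡ a ⊕ (b ⊕ c)
⊕-assoc = Vecₚ.zipWith-assoc ℚₚ.+-assoc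

⊕-comm : ∀ {d} (a b : Vec ℚ d) → a ⊕ b ≡ b ⊕ a
⊕-comm = Vecₚ.zipWith-comm ℚₚ.+-comm

⊕-identityʳ : ∀ {d} (a : Vec ℚ d) → a ⊕ 0ᵛ ≡ a
⊕-identityʳ = Vecₚ.zipWith-identityʳ ℚₚ.+-identityʳ

⊖-self : ∀ {d} (a : Vec ℚ d) → a ⊖ a ≡ 0ᵛ
⊖-self [] = refl
⊖-self (x ∷ a) = cong₂ _∷_ (ℚₚ.+-inverseʳ x) (⊖-self a)

⊖≡0 : ∀ {d} {a b : Vec ℚ d} → a ⊖ b ≡ 0ᵛ → a ≡ b
⊖≡0 {a = a} {b} e = trans (sym (⊖-⊕-cancel a b)) (trans (cong (_⊕ b) e) (trans (⊕-comm 0ᵛ b) (⊕-identityʳ b)))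

infix 4 _≟ᵛ_

_≟ᵛ_ : ∀ {d} (v w : Vec ℚ d) → Dec (v ≡ w)
_≟ᵛ_ = Vecₚ.≡-dec ℚₚ._≟_

record IsLinear {d} (u : Vec ℚ d → ℚ) : Set where
  field
    homo-⊕ : ∀ v w → u (v ⊕ w) ≡ u v + u w
    homo-⊙ : ∀ a v → u (a ⊙ v) ≡ a * u v

  homo-⊖ : ∀ v w → u (v ⊖ w) ≡ u v - u w
  homo-⊖ v w = begin
    u (v ⊖ w)                ≡⟨ lemma (u (v ⊖ w)) (u w) ⟩
    u (v ⊖ w) + u w - u w    ≡⟨ cong (_- u w) (homo-⊕ (v ⊖ w) w) ⟨
    u ((v ⊖ w) ⊕ w) - u w    ≡⟨ cong (λ z → u z - u w) (⊖-⊕-cancel v w) ⟩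
    u v - u w                ∎
    where
    open ≡-Reasoning
    lemma : ∀ x y → x ≡ x + y - y
    lemma = solve-∀ ℚring

lookup-linear : ∀ {d} (i : Fin d) → IsLinear (λ v → lookup v i)
lookup-linear i = record
  { homo-⊕ = Vecₚ.lookup-zipWith _+_ i
  ; homo-⊙ = λ a → Vecₚ.lookup-map i (a *_)
  }

dot : ∀ {d} → Vec ℚ d → Vec ℚ d → ℚ
dot [] [] = 0ℚ
dot (c ∷ cs) (x ∷ v) = c * x + dot cs v

dot-linear : ∀ {d} (c : Vec ℚ d) → IsLinear (dot c)
dot-linear c = record { homo-⊕ = homo-⊕ c ; homo-⊙ = homo-⊙ c }
  where
  homo-⊕ : ∀ {d} (c v w : Vec ℚ d) → dot c (v ⊕ w) ≡ dot c v + dot c w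
  homo-⊕ [] [] [] = refl
  homo-⊕ (c ∷ cs) (x ∷ v) (y ∷ w) = trans (cong (c * (x + y) +_) (homo-⊕ cs v w)) (lemma c x y (dot cs v) (dot cs w))
    where
    lemma : ∀ c x y u v → c * (x + y) + (u + v) ≡ (c * x + u) + (c * y + v)
    lemma = solve-∀ ℚring
  homo-⊙ : ∀ {d} (c : Vec ℚ d) a v → dot c (a ⊙ v) ≡ a * dot c v
  homo-⊙ [] a [] = sym (ℚₚ.*-zeroʳ a)
  homo-⊙ (c ∷ cs) a (x ∷ v) = trans (cong (c * (a * x) +_) (homo-⊙ cs a v)) (lemma c a x (dot cs v))
    where
    lemma : ∀ c a x u → c * (a * x) + a * u ≡ a * (c * x + u)
    lemma = solve-∀ ℚring

-- A vector of length `d` read as a polynomial of degree less than `d`. The length in the type keeps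
-- the degree bound that division with remainder needs.
evalAt : ∀ {d} → ℚ → Vec ℚ d → ℚ
evalAt y v = eval (toList v) y

evalAt-linear : ∀ {d} y → IsLinear (evalAt {d} y)
evalAt-linear y = record { homo-⊕ = homo-⊕ ; homo-⊙ = homo-⊙ }
  where
  homo-⊕ : ∀ {d} (v w : Vec ℚ d) → evalAt y (v ⊕ w) ≡ evalAt y v + evalAt y w
  homo-⊕ [] [] = refl
  homo-⊕ (a ∷ v) (b ∷ w) = trans (cong (λ e → a + b + y * e) (homo-⊕ v w)) (horner-+ a b y (evalAt y v) (evalAt y w))
  homo-⊙ : ∀ {d} a (v : Vec ℚ d) → evalAt y (a ⊙ v) ≡ a * evalAt y v
  homo-⊙ a [] = sym (ℚₚ.*-zeroʳ a)
  homo-⊙ a (b ∷ v) = trans (cong (λ e → a * b + y * e) (homo-⊙ a v)) (horner-* a b y (evalAt y v))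

-- The vector `s − n b`, built by repeated subtraction so that telescoping arguments along a ray
-- unfold one step at a time.
back : ∀ {d} → ℕ → Vec ℚ d → Vec ℚ d → Vec ℚ d
back zero b s = s
back (suc n) b s = back n b (s ⊖ b)

back-⊖ : ∀ {d} n (b s a : Vec ℚ d) → back n b (s ⊖ a) ≡ back n b s ⊖ a
back-⊖ zero b s a = refl
back-⊖ (suc n) b s a = trans (cong (back n b) (⊖-⊖-comm s a b)) (back-⊖ n b (s ⊖ b) a)

back-linear : ∀ {d} {u : Vec ℚ d → ℚ} → IsLinear u → ∀ n b s → u (back n b s) ≡ u s - fromℕ n * u b
back-linear {u = u} lin zero b s = lemma (u s) (u b)
  where
  lemma : ∀ x y → x ≡ x - 0ℚ * y
  lemma = solve-∀ ℚring
back-linear {u = u} lin (suc n) b s = begin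
  u (back n b (s ⊖ b))              ≡⟨ back-linear lin n b (s ⊖ b) ⟩
  u (s ⊖ b) - fromℕ n * u b         ≡⟨ cong (_- fromℕ n * u b) (homo-⊖ s b) ⟩
  u s - u b - fromℕ n * u b         ≡⟨ lemma (u s) (u b) (fromℕ n) ⟩
  u s - (1ℚ + fromℕ n) * u b        ≡⟨ cong (λ m → u s - m * u b) (fromℕ-suc n) ⟨
  u s - fromℕ (suc n) * u b         ∎
  where
  open ≡-Reasoning
  open IsLinear lin
  lemma : ∀ x y n → x - y - n * y ≡ x - (1ℚ + n) * y
  lemma = solve-∀ ℚring

lookup-ext : ∀ {d} {v w : Vec ℚ d} → (∀ i → lookup v i ≡ lookup w i) → v ≡ w
lookup-ext {v = []} {[]} e = refl
lookup-ext {v = _ ∷ _} {_ ∷ _} e = cong₂ _∷_ (e zero) (lookup-ext (e ∘ suc))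

back-⊙ : ∀ {d} n (b s : Vec ℚ d) → back n b s ≡ s ⊖ fromℕ n ⊙ b
back-⊙ n b s = lookup-ext λ i → begin
  lookup (back n b s) i               ≡⟨ back-linear (lookup-linear i) n b s ⟩
  lookup s i - fromℕ n * lookup b i   ≡⟨ cong (λ x → lookup s i - x) (IsLinear.homo-⊙ (lookup-linear i) (fromℕ n) b) ⟨
  lookup s i - lookup (fromℕ n ⊙ b) i ≡⟨ IsLinear.homo-⊖ (lookup-linear i) s (fromℕ n ⊙ b) ⟨
  lookup (s ⊖ fromℕ n ⊙ b) i          ∎
  where open ≡-Reasoning

nonzero-coordinate : ∀ {d} {v : Vec ℚ d} → v ≢ 0ᵛ → ∃[ i ] lookup v i ≢ 0ℚ
nonzero-coordinate {v = []} v≢0 = ⊥-elim (v≢0 refl)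
nonzero-coordinate {v = x ∷ v} v≢0 with x ℚₚ.≟ 0ℚ
... | no x≢0 = zero , x≢0
... | yes refl with nonzero-coordinate {v = v} (v≢0 ∘ cong (0ℚ ∷_))
... | i , e = suc i , e

-- In a coordinate where `b` is nonzero, the difference of `s − n b` and `q` is a polynomial of
-- degree one in `n`, hence eventually nonzero.
back-escapes : ∀ {d} {b : Vec ℚ d} → b ≢ 0ᵛ → ∀ s q → Ev (λ n → back n b s ≢ q)
back-escapes {b = b} b≢0 s q with nonzero-coordinate b≢0
... | i , bᵢ≢0 = from (poly-≢0 ((lookup s i - lookup q i) ∷ - lookup b i ∷ []))
  where
  lemma : ∀ x y n b → (x - y) + n * (- b + n * 0ℚ) ≡ (x - n * b) - y
  lemma = solve-∀ ℚring
  p : Poly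
  p = (lookup s i - lookup q i) ∷ - lookup b i ∷ []
  from : All (_≡ 0ℚ) p ⊎ Ev (λ t → eval p (fromℕ t) ≢ 0ℚ) → Ev (λ n → back n b s ≢ q)
  from (inj₁ (_ ∷ e ∷ [])) = ⊥-elim (bᵢ≢0 (trans (sym (neg-involutive (lookup b i))) (cong -_ e)))
  from (inj₂ e) = Ev-map (λ n p≢0 eq → p≢0 (trans (lemma (lookup s i) (lookup q i) (fromℕ n) (lookup b i))
    (trans (cong (_- lookup q i) (trans (sym (back-linear (lookup-linear i) n b s)) (cong (λ v → lookup v i) eq)))
      (ℚₚ.+-inverseʳ (lookup q i))))) e

-- Lexicographic positivity

LP : ∀ {d} → Vec ℚ d → Set
LP [] = ⊥
LP (x ∷ v) = 0ℚ < x ⊎ (x ≡ 0ℚ × LP v)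

LP-⊕ : ∀ {d} {v w : Vec ℚ d} → LP v → LP w → LP (v ⊕ w)
LP-⊕ {v = _ ∷ _} {_ ∷ _} (inj₁ a) (inj₁ b) = inj₁ (+-pos a b)
LP-⊕ {v = _ ∷ _} {_ ∷ _} (inj₁ a) (inj₂ (refl , _)) = inj₁ (subst (0ℚ <_) (sym (ℚₚ.+-identityʳ _)) a)
LP-⊕ {v = _ ∷ _} {_ ∷ _} (inj₂ (refl , _)) (inj₁ b) = inj₁ (subst (0ℚ <_) (sym (ℚₚ.+-identityˡ _)) b)
LP-⊕ {v = _ ∷ _} {_ ∷ _} (inj₂ (refl , a)) (inj₂ (refl , b)) = inj₂ (refl , LP-⊕ a b)

LP-⊙ : ∀ {d} {a} {v : Vec ℚ d} → 0ℚ < a → LP v → LP (a ⊙ v)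
LP-⊙ {v = _ ∷ _} 0<a (inj₁ p) = inj₁ (*-pos 0<a p)
LP-⊙ {a = a} {v = _ ∷ _} 0<a (inj₂ (refl , p)) = inj₂ (ℚₚ.*-zeroʳ a , LP-⊙ 0<a p)

LP-irrefl : ∀ {d} → ¬ LP (0ᵛ {d})
LP-irrefl {suc d} (inj₁ a) = ℚₚ.<-irrefl refl a
LP-irrefl {suc d} (inj₂ (_ , p)) = LP-irrefl p

LP⇒≢0 : ∀ {d} {v : Vec ℚ d} → LP v → v ≢ 0ᵛ
LP⇒≢0 p refl = LP-irrefl p

LP-cmp : ∀ {d} (v : Vec ℚ d) → LP v ⊎ v ≡ 0ᵛ ⊎ LP (0ᵛ ⊖ v)
LP-cmp [] = inj₂ (inj₁ refl)
LP-cmp (x ∷ v) with sign x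
... | inj₁ a = inj₁ (inj₁ a)
... | inj₂ (inj₂ a) = inj₂ (inj₂ (inj₁ (subst (0ℚ <_) (sym (ℚₚ.+-identityˡ (- x))) a)))
... | inj₂ (inj₁ refl) with LP-cmp v
...   | inj₁ p = inj₁ (inj₂ (refl , p))
...   | inj₂ (inj₁ refl) = inj₂ (inj₁ refl)
...   | inj₂ (inj₂ p) = inj₂ (inj₂ (inj₂ (refl , p)))

LP⇒positive-coordinate : ∀ {d} {v : Vec ℚ d} → LP v → ∃[ i ] 0ℚ < lookup v i
LP⇒positive-coordinate {v = _ ∷ _} (inj₁ a) = zero , a
LP⇒positive-coordinate {v = _ ∷ _} (inj₂ (_ , p)) with LP⇒positive-coordinate p
... | i , a = suc i , a

-- Series and difference operators

Series : ℕ → Set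
Series d = Vec ℚ d → ℚ

-- Multiplication by `1 − 𝐱ᵇ`, acting on coefficient functions.
∇ : ∀ {d} → Vec ℚ d → Series d → Series d
∇ b G s = G s - G (s ⊖ b)

∇* : ∀ {d} → List (Vec ℚ d) → Series d → Series d
∇* [] G = G
∇* (b ∷ bs) G = ∇ b (∇* bs G)

module _ {d : ℕ} where

  ∇-cong : ∀ b {G H : Series d} → G ≗ H → ∇ b G ≗ ∇ b H
  ∇-cong b e s = cong₂ _-_ (e s) (e (s ⊖ b))

  ∇*-cong : ∀ bs {G H : Series d} → G ≗ H → ∇* bs G ≗ ∇* bs H
  ∇*-cong [] e = e
  ∇*-cong (b ∷ bs) e = ∇-cong b (∇*-cong bs e)

  ∇-comm : ∀ a b (G : Series d) → ∇ a (∇ b G) ≗ ∇ b (∇ a G)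
  ∇-comm a b G s = trans (cong (λ v → G s - G (s ⊖ b) - (G (s ⊖ a) - G v)) (⊖-⊖-comm s a b))
                         (lemma (G s) (G (s ⊖ b)) (G (s ⊖ a)) (G ((s ⊖ b) ⊖ a)))
    where
    lemma : ∀ x y z w → x - y - (z - w) ≡ x - z - (y - w)
    lemma = solve-∀ ℚring

  ∇*-∇ : ∀ bs a (G : Series d) → ∇* bs (∇ a G) ≗ ∇ a (∇* bs G)
  ∇*-∇ [] a G s = refl
  ∇*-∇ (b ∷ bs) a G s = trans (∇-cong b (∇*-∇ bs a G) s) (∇-comm b a (∇* bs G) s)

  ∇-zero : ∀ b {G : Series d} → (∀ s → G s ≡ 0ℚ) → ∀ s → ∇ b G s ≡ 0ℚ
  ∇-zero b z s = cong₂ _-_ (z s) (z (s ⊖ b))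

  ∇*-zero : ∀ bs {G : Series d} → (∀ s → G s ≡ 0ℚ) → ∀ s → ∇* bs G s ≡ 0ℚ
  ∇*-zero [] z = z
  ∇*-zero (b ∷ bs) z = ∇-zero b (∇*-zero bs z)

  ∇-− : ∀ b (G H : Series d) s → ∇ b (λ s → G s - H s) s ≡ ∇ b G s - ∇ b H s
  ∇-− b G H s = lemma (G s) (H s) (G (s ⊖ b)) (H (s ⊖ b))
    where
    lemma : ∀ x y z w → (x - y) - (z - w) ≡ (x - z) - (y - w)
    lemma = solve-∀ ℚring

  -- For tame series, multiplication by 1 − 𝐱ᵇ is injective.

  record Tame (G : Series d) : Set where
    constructor tame
    field
      vanishes : ∀ {b} → LP b → ∀ s → Ev (λ n → G (back n b s) ≡ 0ℚ)

  open Tame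

  tame-− : ∀ {G H} → Tame G → Tame H → Tame (λ s → G s - H s)
  tame-− g h = tame λ p s → Ev-map₂ (λ _ → cong₂ _-_) (vanishes g p s) (vanishes h p s)

  tame-shift : ∀ {G} a → Tame G → Tame (λ s → G (s ⊖ a))
  tame-shift {G} a g = tame λ {b} p s → Ev-map (λ n e → trans (cong G (sym (back-⊖ n b s a))) e) (vanishes g p (s ⊖ a))

  tame-∇ : ∀ {G} b → Tame G → Tame (∇ b G)
  tame-∇ b g = tame-− g (tame-shift b g)

  tame-∇* : ∀ {G} bs → Tame G → Tame (∇* bs G)
  tame-∇* [] g = g
  tame-∇* (b ∷ bs) g = tame-∇ b (tame-∇* bs g)

  -- The hypothesis makes `G` constant along `s`, `s − b`, `s − 2b`, and so on, and tameness makes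
  -- it zero at the far end.
  tame-zero-along : ∀ {b G s} → LP b → Tame G → (∀ n → ∇ b G (back n b s) ≡ 0ℚ) → G s ≡ 0ℚ
  tame-zero-along {b} {G} {s} p g z with vanishes g p s
  ... | T , e = trans (invariant T s z) (e T ℕₚ.≤-refl)
    where
    invariant : ∀ n s → (∀ n → ∇ b G (back n b s) ≡ 0ℚ) → G s ≡ G (back n b s)
    invariant zero s z = refl
    invariant (suc n) s z = trans (diff≡0 (z 0)) (invariant n (s ⊖ b) (z ∘ suc))

  tame-∇*≡0 : ∀ {bs G} → All LP bs → Tame G → (∀ s → ∇* bs G s ≡ 0ℚ) → ∀ s → G s ≡ 0ℚ
  tame-∇*≡0 [] g z = z
  tame-∇*≡0 {b ∷ bs} {G} (p ∷ ps) g z = tame-∇*≡0 ps g λ s → tame-zero-along {b} {∇* bs G} p (tame-∇* bs g) (λ n → z (back n b s))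

-- Formal sums

Formal : ℕ → Set
Formal d = List (ℚ × Vec ℚ d)

-- A formal sum acts on test functions like a finitely supported measure. Coefficients, moments and
-- cardinalities are all obtained by varying `φ`.
⟨_,_⟩ : ∀ {d} → Formal d → (Vec ℚ d → ℚ) → ℚ
⟨ [] , φ ⟩ = 0ℚ
⟨ (α , q) ∷ L , φ ⟩ = α * φ q + ⟨ L , φ ⟩

δ : ∀ {d} → Vec ℚ d → Vec ℚ d → ℚ
δ s q = if does (q ≟ᵛ s) then 1ℚ else 0ℚ

δ-≡ : ∀ {d} {s q : Vec ℚ d} → q ≡ s → δ s q ≡ 1ℚ
δ-≡ {s = s} {q} e with q ≟ᵛ s
... | yes _ = refl
... | no ne = ⊥-elim (ne e)

δ-≢ : ∀ {d} {s q : Vec ℚ d} → q ≢ s → δ s q ≡ 0ℚ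
δ-≢ {s = s} {q} ne with q ≟ᵛ s
... | yes e = ⊥-elim (ne e)
... | no _ = refl

δ-⇔ : ∀ {d} {s q s′ q′ : Vec ℚ d} → (q ≡ s → q′ ≡ s′) → (q′ ≡ s′ → q ≡ s) → δ s q ≡ δ s′ q′
δ-⇔ {s = s} {q} f g with q ≟ᵛ s
... | yes e = sym (δ-≡ (f e))
... | no ne = sym (δ-≢ (ne ∘ g))

coeff : ∀ {d} → Formal d → Series d
coeff L s = ⟨ L , δ s ⟩

infix 4 _≐_

_≐_ : ∀ {d} → Series d → Formal d → Set
G ≐ L = ∀ s → G s ≡ coeff L s

negate : ∀ {d} → Formal d → Formal d
negate = List.map λ (α , q) → - α , q

shift : ∀ {d} → Vec ℚ d → Formal d → Formal d
shift b = List.map λ (α , q) → α , q ⊕ b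

times : ∀ {d} → Vec ℚ d → Formal d → Formal d
times b L = L ++ negate (shift b L)

times* : ∀ {d} → List (Vec ℚ d) → Formal d → Formal d
times* [] L = L
times* (b ∷ bs) L = times b (times* bs L)

module _ {d : ℕ} where

  pair-++ : ∀ (L M : Formal d) φ → ⟨ L ++ M , φ ⟩ ≡ ⟨ L , φ ⟩ + ⟨ M , φ ⟩
  pair-++ [] M φ = sym (ℚₚ.+-identityˡ _)
  pair-++ ((α , q) ∷ L) M φ = trans (cong (α * φ q +_) (pair-++ L M φ)) (sym (ℚₚ.+-assoc (α * φ q) ⟨ L , φ ⟩ ⟨ M , φ ⟩))

  pair-negate : ∀ (L : Formal d) φ → ⟨ negate L , φ ⟩ ≡ - ⟨ L , φ ⟩
  pair-negate [] φ = refl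
  pair-negate ((α , q) ∷ L) φ = trans (cong (- α * φ q +_) (pair-negate L φ)) (lemma α (φ q) ⟨ L , φ ⟩)
    where
    lemma : ∀ a f u → - a * f + - u ≡ - (a * f + u)
    lemma = solve-∀ ℚring

  pair-shift : ∀ b (L : Formal d) φ → ⟨ shift b L , φ ⟩ ≡ ⟨ L , (λ q → φ (q ⊕ b)) ⟩
  pair-shift b [] φ = refl
  pair-shift b ((α , q) ∷ L) φ = cong (α * φ (q ⊕ b) +_) (pair-shift b L φ)

  pair-cong : ∀ {L : Formal d} {φ ψ} → All (λ (_ , q) → φ q ≡ ψ q) L → ⟨ L , φ ⟩ ≡ ⟨ L , ψ ⟩
  pair-cong [] = refl
  pair-cong {(α , _) ∷ _} (e ∷ es) = cong₂ (λ x y → α * x + y) e (pair-cong es)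

  pair-≗ : ∀ (L : Formal d) {φ ψ} → φ ≗ ψ → ⟨ L , φ ⟩ ≡ ⟨ L , ψ ⟩
  pair-≗ L e = pair-cong (All.universal (λ (_ , q) → e q) L)

  pair-zero : ∀ (L : Formal d) → ⟨ L , (λ _ → 0ℚ) ⟩ ≡ 0ℚ
  pair-zero [] = refl
  pair-zero ((α , _) ∷ L) = trans (cong (α * 0ℚ +_) (pair-zero L)) (trans (ℚₚ.+-identityʳ (α * 0ℚ)) (ℚₚ.*-zeroʳ α))

  pair-+ : ∀ (L : Formal d) φ ψ → ⟨ L , (λ q → φ q + ψ q) ⟩ ≡ ⟨ L , φ ⟩ + ⟨ L , ψ ⟩
  pair-+ [] φ ψ = refl
  pair-+ ((α , q) ∷ L) φ ψ = trans (cong (α * (φ q + ψ q) +_) (pair-+ L φ ψ)) (lemma α (φ q) (ψ q) ⟨ L , φ ⟩ ⟨ L , ψ ⟩)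
    where
    lemma : ∀ a f g u v → a * (f + g) + (u + v) ≡ (a * f + u) + (a * g + v)
    lemma = solve-∀ ℚring

  pair-scale : ∀ (L : Formal d) a φ → ⟨ L , (λ q → a * φ q) ⟩ ≡ a * ⟨ L , φ ⟩
  pair-scale [] a φ = sym (ℚₚ.*-zeroʳ a)
  pair-scale ((α , q) ∷ L) a φ = trans (cong (α * (a * φ q) +_) (pair-scale L a φ)) (lemma α a (φ q) ⟨ L , φ ⟩)
    where
    lemma : ∀ α a f u → α * (a * f) + a * u ≡ a * (α * f + u)
    lemma = solve-∀ ℚring

  pair-times : ∀ b (L : Formal d) φ → ⟨ times b L , φ ⟩ ≡ ⟨ L , φ ⟩ - ⟨ L , (λ q → φ (q ⊕ b)) ⟩
  pair-times b L φ = trans (pair-++ L (negate (shift b L)) φ)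
    (cong (⟨ L , φ ⟩ +_) (trans (pair-negate (shift b L) φ) (cong -_ (pair-shift b L φ))))

  coeff-shift : ∀ b (L : Formal d) s → ⟨ L , (λ q → δ s (q ⊕ b)) ⟩ ≡ coeff L (s ⊖ b)
  coeff-shift b L s = pair-≗ L λ q → δ-⇔ (λ e → trans (sym (⊕-⊖-cancel q b)) (cong (_⊖ b) e))
                                         (λ e → trans (cong (_⊕ b) e) (⊖-⊕-cancel s b))

  coeff-times : ∀ b (L : Formal d) → ∇ b (coeff L) ≐ times b L
  coeff-times b L s = sym (trans (pair-times b L (δ s)) (cong (λ x → coeff L s - x) (coeff-shift b L s)))

  coeff-times* : ∀ bs (L : Formal d) → ∇* bs (coeff L) ≐ times* bs L
  coeff-times* [] L s = refl
  coeff-times* (b ∷ bs) L s = trans (∇-cong b (coeff-times* bs L) s) (coeff-times b (times* bs L) s)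

  remove : Vec ℚ d → Formal d → Formal d
  remove q [] = []
  remove q ((α , r) ∷ L) with r ≟ᵛ q
  ... | yes _ = remove q L
  ... | no _ = (α , r) ∷ remove q L

  remove-length : ∀ q (L : Formal d) → length (remove q L) ℕ.≤ length L
  remove-length q [] = ℕ.z≤n
  remove-length q ((α , r) ∷ L) with r ≟ᵛ q
  ... | yes _ = ℕₚ.m≤n⇒m≤1+n (remove-length q L)
  ... | no _ = ℕ.s≤s (remove-length q L)

  pair-remove : ∀ q (L : Formal d) φ → ⟨ L , φ ⟩ ≡ ⟨ remove q L , φ ⟩ + coeff L q * φ q
  pair-remove q [] φ = sym (trans (ℚₚ.+-identityˡ (0ℚ * φ q)) (ℚₚ.*-zeroˡ (φ q)))
  pair-remove q ((α , r) ∷ L) φ with r ≟ᵛ q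
  ... | yes refl = trans (cong (α * φ r +_) (pair-remove r L φ)) (lemma α (φ r) ⟨ remove r L , φ ⟩ (coeff L r))
    where
    lemma : ∀ a f u c → a * f + (u + c * f) ≡ u + (a * 1ℚ + c) * f
    lemma = solve-∀ ℚring
  ... | no _ = trans (cong (α * φ r +_) (pair-remove q L φ)) (lemma α (φ r) ⟨ remove q L , φ ⟩ (coeff L q) (φ q))
    where
    lemma : ∀ a g u c f → a * g + (u + c * f) ≡ (a * g + u) + (a * 0ℚ + c) * f
    lemma = solve-∀ ℚring

  -- Like terms are not collected, so the sum need not be the empty list. All copies of one exponent
  -- `q` are removed together, at the cost of their total coefficient, which is zero; the length
  -- then decreases.
  pair-coeff≡0 : ∀ {L : Formal d} → (∀ s → coeff L s ≡ 0ℚ) → ∀ φ → ⟨ L , φ ⟩ ≡ 0ℚ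
  pair-coeff≡0 {L} = go (length L) L ℕₚ.≤-refl
    where
    removed : ∀ q L → (∀ s → coeff L s ≡ 0ℚ) → ∀ φ → ⟨ L , φ ⟩ ≡ ⟨ remove q L , φ ⟩
    removed q L z φ = trans (pair-remove q L φ) (trans (cong (λ c → ⟨ remove q L , φ ⟩ + c * φ q) (z q)) (lemma ⟨ remove q L , φ ⟩ (φ q)))
      where
      lemma : ∀ u f → u + 0ℚ * f ≡ u
      lemma = solve-∀ ℚring
    shorter : ∀ n α q (L : Formal d) → length L ℕ.≤ n → length (remove q ((α , q) ∷ L)) ℕ.≤ n
    shorter n α q L le with q ≟ᵛ q
    ... | yes _ = ℕₚ.≤-trans (remove-length q L) le
    ... | no ne = ⊥-elim (ne refl)
    go : ∀ n (L : Formal d) → length L ℕ.≤ n → (∀ s → coeff L s ≡ 0ℚ) → ∀ φ → ⟨ L , φ ⟩ ≡ 0ℚ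
    go n [] le z φ = refl
    go (suc n) L@((α , q) ∷ L′) (ℕ.s≤s le) z φ = trans (removed q L z φ)
      (go n (remove q L) (shorter n α q L′ le) (λ s → trans (sym (removed q L z (δ s))) (z s)) φ)

  pair-coeff : ∀ {L M : Formal d} → coeff L ≐ M → ∀ φ → ⟨ L , φ ⟩ ≡ ⟨ M , φ ⟩
  pair-coeff {L} {M} e φ = diff≡0 (trans (sym (difference φ)) (pair-coeff≡0 {L ++ negate M} (λ s →
      trans (difference (δ s)) (trans (cong (_- coeff M s) (e s)) (ℚₚ.+-inverseʳ (coeff M s)))) φ))
    where
    difference : ∀ φ → ⟨ L ++ negate M , φ ⟩ ≡ ⟨ L , φ ⟩ - ⟨ M , φ ⟩
    difference φ = trans (pair-++ L (negate M) φ) (cong (⟨ L , φ ⟩ +_) (pair-negate M φ))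

  -- A finite sum eventually vanishes along any line, as each exponent is met at most once.

  pair-escapes : ∀ {κ : Vec ℚ d} → κ ≢ 0ᵛ → ∀ p (L : Formal d) (g : Vec ℚ d → Vec ℚ d) (w : Vec ℚ d → ℚ) →
                 Ev (λ n → ⟨ L , (λ q → δ (back n κ p) (g q) * w q) ⟩ ≡ 0ℚ)
  pair-escapes {κ} κ≢0 p L g w = Ev-map vanish (Ev-All (All.universal (λ (_ , q) → back-escapes κ≢0 p (g q)) L))
    where
    vanish : ∀ n → All (λ (_ , q) → back n κ p ≢ g q) L → ⟨ L , (λ q → δ (back n κ p) (g q) * w q) ⟩ ≡ 0ℚ
    vanish n ne = trans (pair-cong (All.map (λ {(_ , q)} e → trans (cong (_* w q) (δ-≢ (e ∘ sym))) (ℚₚ.*-zeroˡ (w q))) ne)) (pair-zero L)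

  tame-coeff : ∀ (L : Formal d) → Tame (coeff L)
  tame-coeff L = tame λ {b} p s → Ev-map (λ n e → trans (pair-≗ L (λ q → sym (ℚₚ.*-identityʳ (δ (back n b s) q)))) e)
    (pair-escapes (LP⇒≢0 p) s L (λ q → q) (λ _ → 1ℚ))

∇*-comm : ∀ {d} as bs (G : Series d) → ∇* as (∇* bs G) ≗ ∇* bs (∇* as G)
∇*-comm [] bs G s = refl
∇*-comm (a ∷ as) bs G s = trans (∇-cong a (∇*-comm as bs G) s) (sym (∇*-∇ bs a (∇* as G) s))

-- Falling factorials and multiplicities of directions.

falling : ℕ → ℚ → ℚ
falling zero x = 1ℚ
falling (suc i) x = falling i x * (x - fromℕ i)

-- As `falling i x` is the `i`-th derivative of `z^x` at `z = 1`, this is the Leibniz rule for the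
-- derivative of order `i + 1` of `z · z^x`.
falling-suc : ∀ i x → falling (suc i) (x + 1ℚ) ≡ falling (suc i) x + fromℕ (suc i) * falling i x
falling-suc zero x = lemma x
  where
  lemma : ∀ x → 1ℚ * (x + 1ℚ - 0ℚ) ≡ 1ℚ * (x - 0ℚ) + 1ℚ * 1ℚ
  lemma = solve-∀ ℚring
falling-suc (suc i) x = begin
  falling (suc i) (x + 1ℚ) * (x + 1ℚ - fromℕ (suc i))
    ≡⟨ cong₂ (λ u v → u * (x + 1ℚ - v)) (falling-suc i x) (fromℕ-suc i) ⟩
  (g * (x - n) + fromℕ (suc i) * g) * (x + 1ℚ - (1ℚ + n))
    ≡⟨ cong (λ m → (g * (x - n) + m * g) * (x + 1ℚ - (1ℚ + n))) (fromℕ-suc i) ⟩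
  (g * (x - n) + (1ℚ + n) * g) * (x + 1ℚ - (1ℚ + n))
    ≡⟨ lemma g x n ⟩
  g * (x - n) * (x - (1ℚ + n)) + (1ℚ + (1ℚ + n)) * (g * (x - n))
    ≡⟨ cong₂ (λ u v → g * (x - n) * (x - u) + v * (g * (x - n))) (fromℕ-suc i) (trans (fromℕ-suc (suc i)) (cong (1ℚ +_) (fromℕ-suc i))) ⟨
  g * (x - n) * (x - fromℕ (suc i)) + fromℕ (suc (suc i)) * (g * (x - n)) ∎
  where
  open ≡-Reasoning
  g = falling i x
  n = fromℕ i
  lemma : ∀ g x n → (g * (x - n) + (1ℚ + n) * g) * (x + 1ℚ - (1ℚ + n)) ≡ g * (x - n) * (x - (1ℚ + n)) + (1ℚ + (1ℚ + n)) * (g * (x - n))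
  lemma = solve-∀ ℚring

-- Order β βs i says that i is less than the multiplicity of β in βs.

Order : ∀ {d} → Vec ℚ d → List (Vec ℚ d) → ℕ → Set
Order β [] i = ⊥
Order β (x ∷ xs) zero = β ≡ x ⊎ Order β xs zero
Order β (x ∷ xs) (suc i) = (β ≡ x × Order β xs i) ⊎ Order β xs (suc i)

order-there : ∀ {d} {β x : Vec ℚ d} {xs} i → Order β xs i → Order β (x ∷ xs) i
order-there zero = inj₂
order-there (suc i) = inj₂

order-pred : ∀ {d} {β : Vec ℚ d} {xs} i → Order β xs (suc i) → Order β xs i
order-pred {xs = x ∷ xs} i (inj₁ (_ , o)) = order-there i o
order-pred {xs = x ∷ xs} i (inj₂ o) = order-there i (order-pred i o)

-- Series on whose support a linear functional is bounded above.

module _ {d : ℕ} {u : Vec ℚ d → ℚ} (lin : IsLinear u) where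

  open IsLinear lin
  open Tame

  record Bounded (G : Series d) : Set where
    constructor bounded
    field
      bound : ℚ
      beyond : ∀ s → bound < u s → G s ≡ 0ℚ

  open Bounded

  bounded-combine : ∀ {G H K} → (∀ s → G s ≡ 0ℚ → H s ≡ 0ℚ → K s ≡ 0ℚ) → Bounded G → Bounded H → Bounded K
  bounded-combine f (bounded B g) (bounded B′ h) = bounded (B ℚ.⊔ B′) λ s lt →
    f s (g s (ℚₚ.≤-<-trans (ℚₚ.p≤p⊔q B B′) lt)) (h s (ℚₚ.≤-<-trans (ℚₚ.p≤q⊔p B B′) lt))

  bounded-cong : ∀ {G H} → G ≗ H → Bounded G → Bounded H
  bounded-cong e (bounded B g) = bounded B λ s lt → trans (sym (e s)) (g s lt)

  bounded-shift : ∀ {G} a → Bounded G → Bounded (λ s → G (s ⊖ a))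
  bounded-shift a (bounded B g) = bounded (B + u a) λ s lt → g (s ⊖ a)
    (diff-pos⁻ (subst (0ℚ <_) (trans (lemma B (u a) (u s)) (cong (_- B) (sym (homo-⊖ s a)))) (diff-pos lt)))
    where
    lemma : ∀ b a s → s - (b + a) ≡ (s - a) - b
    lemma = solve-∀ ℚring

  bounded-− : ∀ {G H} → Bounded G → Bounded H → Bounded (λ s → G s - H s)
  bounded-− = bounded-combine λ _ → cong₂ _-_

  bounded-∇ : ∀ {G} b → Bounded G → Bounded (∇ b G)
  bounded-∇ b g = bounded-− g (bounded-shift b g)

  bounded-∇* : ∀ {G} bs → Bounded G → Bounded (∇* bs G)
  bounded-∇* [] g = g
  bounded-∇* (b ∷ bs) g = bounded-∇ b (bounded-∇* bs g)

  bounded-coeff : ∀ L → Bounded (coeff L)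
  bounded-coeff [] = bounded 0ℚ λ _ _ → refl
  bounded-coeff ((α , q) ∷ L) = bounded-combine (λ s → cong₂ _+_) single (bounded-coeff L)
    where
    single : Bounded (λ s → α * δ s q)
    single = bounded (u q) λ s lt → trans (cong (α *_) (δ-≢ {s = s} {q} λ { refl → ℚₚ.<-irrefl refl lt })) (ℚₚ.*-zeroʳ α)

  -- Since `u b ≤ 0`, going back along `b` does not lower `u`. From a point beyond the bound the
  -- whole ray stays beyond it, `∇ b G` vanishes there, and `tame-zero-along` applies.
  bounded-∇⁻¹ : ∀ {b G} → LP b → u b ≤ 0ℚ → Tame G → Bounded (∇ b G) → Bounded G
  bounded-∇⁻¹ {b} p ub≤0 g (bounded B h) = bounded B λ s lt → tame-zero-along p g λ n →
    h (back n b s) (ℚₚ.<-≤-trans lt (diff-nonneg⁻ (subst (0ℚ ≤_)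
      (trans (lemma (fromℕ n) (u b) (u s)) (cong (_- u s) (sym (back-linear lin n b s))))
      (*-nonneg (0≤fromℕ n) (diff-nonneg ub≤0)))))
    where
    lemma : ∀ n b s → n * (0ℚ - b) ≡ (s - n * b) - s
    lemma = solve-∀ ℚring

  bounded-∇*⁻¹ : ∀ {bs G} → All (λ b → LP b × u b ≤ 0ℚ) bs → Tame G → Bounded (∇* bs G) → Bounded G
  bounded-∇*⁻¹ [] g h = h
  bounded-∇*⁻¹ {b ∷ bs} ((p , le) ∷ ps) g h = bounded-∇*⁻¹ ps g (bounded-∇⁻¹ p le (tame-∇* bs g) h)

  -- Division of a formal sum by 1 − 𝐱^β

  Graded : ℚ → Formal d → Set
  Graded u₀ = All λ (_ , q) → ∃[ n ] u q ≡ u₀ + fromℕ n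

  Level : ℚ → Formal d → Set
  Level u₀ = All λ (_ , q) → u q ≡ u₀

  level-coeff : ∀ {u₀ L s} → Level u₀ L → u s ≢ u₀ → coeff L s ≡ 0ℚ
  level-coeff {L = L} {s} lev ne = trans
    (pair-cong (All.map (λ {(_ , q)} e → δ-≢ {s = s} {q} λ { refl → ne e }) lev)) (pair-zero L)

  -- The identity is demanded for every `φ`: it is used for coefficients as well as for the test
  -- functions that define moments.
  record Division (u₀ : ℚ) (β : Vec ℚ d) (L : Formal d) : Set where
    field
      remainder quotient : Formal d
      remainder-level : Level u₀ remainder
      quotient-graded : Graded u₀ quotient
      division : ∀ φ → ⟨ L , φ ⟩ ≡ ⟨ remainder , φ ⟩ + (⟨ quotient , φ ⟩ - ⟨ quotient , (λ q → φ (q ⊕ β)) ⟩)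

  -- The identity `𝐱^q = 𝐱^(q−β) − (1 − 𝐱^β) 𝐱^(q−β)` lowers the level by one. After `n` steps the
  -- monomial has reached the level `u₀`.
  divide-monomial : ∀ {u₀ β} → u β ≡ 1ℚ → ∀ α n q → u q ≡ u₀ + fromℕ n → Division u₀ β ((α , q) ∷ [])
  divide-monomial {u₀} uβ α zero q e = record
    { remainder = (α , q) ∷ [] ; quotient = []
    ; remainder-level = trans e (ℚₚ.+-identityʳ u₀) ∷ [] ; quotient-graded = []
    ; division = λ φ → lemma (α * φ q)
    }
    where
    lemma : ∀ x → x + 0ℚ ≡ x + 0ℚ + (0ℚ - 0ℚ)
    lemma = solve-∀ ℚring
  divide-monomial {u₀} {β} uβ α (suc n) q e = record
    { remainder = remainder ; quotient = (- α , q ⊖ β) ∷ quotient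
    ; remainder-level = remainder-level ; quotient-graded = (n , level) ∷ quotient-graded
    ; division = λ φ → trans (cong (λ r → α * φ r + 0ℚ) (sym (⊖-⊕-cancel q β)))
        (step α (φ (q ⊖ β)) (φ (q ⊖ β ⊕ β)) ⟨ remainder , φ ⟩ ⟨ quotient , φ ⟩ ⟨ quotient , (λ q → φ (q ⊕ β)) ⟩ (division φ))
    }
    where
    level : u (q ⊖ β) ≡ u₀ + fromℕ n
    level = trans (homo-⊖ q β) (trans (cong₂ _-_ (trans e (cong (u₀ +_) (fromℕ-suc n))) uβ) (lemma u₀ (fromℕ n)))
      where
      lemma : ∀ u n → u + (1ℚ + n) - 1ℚ ≡ u + n
      lemma = solve-∀ ℚring
    previous : Division u₀ β ((α , q ⊖ β) ∷ [])
    previous = divide-monomial uβ α n (q ⊖ β) level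
    open Division previous
    step : ∀ α f g r h k → α * f + 0ℚ ≡ r + (h - k) → α * g + 0ℚ ≡ r + ((- α * f + h) - (- α * g + k))
    step α f g r h k e = trans (lemma₁ α f g) (trans (cong (λ x → x + (- α * f) + α * g) e) (lemma₂ α f g r h k))
      where
      lemma₁ : ∀ α f g → α * g + 0ℚ ≡ α * f + 0ℚ + (- α * f) + α * g
      lemma₁ = solve-∀ ℚring
      lemma₂ : ∀ α f g r h k → r + (h - k) + (- α * f) + α * g ≡ r + ((- α * f + h) - (- α * g + k))
      lemma₂ = solve-∀ ℚring

  divide : ∀ {u₀ β} → u β ≡ 1ℚ → ∀ {L} → Graded u₀ L → Division u₀ β L
  divide uβ [] = record
    { remainder = [] ; quotient = [] ; remainder-level = [] ; quotient-graded = [] ; division = λ _ → refl }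
  divide {u₀} {β} uβ {(α , q) ∷ L} ((n , e) ∷ gr) = record
    { remainder = D₁.remainder ++ D₂.remainder ; quotient = D₁.quotient ++ D₂.quotient
    ; remainder-level = Allₚ.++⁺ D₁.remainder-level D₂.remainder-level
    ; quotient-graded = Allₚ.++⁺ D₁.quotient-graded D₂.quotient-graded
    ; division = λ φ → begin
        α * φ q + ⟨ L , φ ⟩
          ≡⟨ cong₂ _+_ (trans (sym (ℚₚ.+-identityʳ (α * φ q))) (D₁.division φ)) (D₂.division φ) ⟩
        ⟨ D₁.remainder , φ ⟩ + (⟨ D₁.quotient , φ ⟩ - ⟨ D₁.quotient , φ ∘ (_⊕ β) ⟩) +
          (⟨ D₂.remainder , φ ⟩ + (⟨ D₂.quotient , φ ⟩ - ⟨ D₂.quotient , φ ∘ (_⊕ β) ⟩))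
          ≡⟨ lemma ⟨ D₁.remainder , φ ⟩ ⟨ D₁.quotient , φ ⟩ _ ⟨ D₂.remainder , φ ⟩ ⟨ D₂.quotient , φ ⟩ _ ⟩
        (⟨ D₁.remainder , φ ⟩ + ⟨ D₂.remainder , φ ⟩) + ((⟨ D₁.quotient , φ ⟩ + ⟨ D₂.quotient , φ ⟩)
          - (⟨ D₁.quotient , φ ∘ (_⊕ β) ⟩ + ⟨ D₂.quotient , φ ∘ (_⊕ β) ⟩))
          ≡⟨ cong₂ _+_ (pair-++ D₁.remainder D₂.remainder φ)
               (cong₂ _-_ (pair-++ D₁.quotient D₂.quotient φ) (pair-++ D₁.quotient D₂.quotient (φ ∘ (_⊕ β)))) ⟨
        ⟨ D₁.remainder ++ D₂.remainder , φ ⟩ +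
          (⟨ D₁.quotient ++ D₂.quotient , φ ⟩ - ⟨ D₁.quotient ++ D₂.quotient , φ ∘ (_⊕ β) ⟩) ∎
    }
    where
    open ≡-Reasoning
    first : Division u₀ β ((α , q) ∷ [])
    first = divide-monomial uβ α n q e
    rest : Division u₀ β L
    rest = divide uβ gr
    module D₁ = Division first
    module D₂ = Division rest
    lemma : ∀ r h k r′ h′ k′ → r + (h - k) + (r′ + (h′ - k′)) ≡ (r + r′) + ((h + h′) - (k + k′))
    lemma = solve-∀ ℚring

  -- The projection along β onto the kernel of u, for u β = 1.

  π : Vec ℚ d → Vec ℚ d → Vec ℚ d
  π β s = s ⊖ u s ⊙ β

  -- On the line over `p` parallel to `β`, the formal sum `L` is a finite sum of powers `z^(u q)` of
  -- `z = 𝐱^β`, up to the factor `𝐱^p`. The moment is the `i`-th derivative of that sum at `z = 1`.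
  moment : ℕ → Vec ℚ d → Vec ℚ d → Formal d → ℚ
  moment i β p L = ⟨ L , (λ s → δ p (π β s) * falling i (u s)) ⟩

  -- The numerator cancels the poles at 𝐱^β = 1: the order of vanishing is tested by the moments along lines parallel to β.

  Flat : List (Vec ℚ d) → Formal d → Set
  Flat βs L = ∀ β i → Order β βs i → ∀ p → moment i β p L ≡ 0ℚ

  π-⊕ : ∀ β s t → π β (s ⊕ t) ≡ π β s ⊕ π β t
  π-⊕ β s t = trans (cong (λ x → (s ⊕ t) ⊖ x ⊙ β) (homo-⊕ s t)) (coordinates s t β (u s) (u t))
    where
    lemma : ∀ x y b a c → x + y - (a + c) * b ≡ (x - a * b) + (y - c * b)
    lemma = solve-∀ ℚring
    coordinates : ∀ {n} (s t β : Vec ℚ n) a c → (s ⊕ t) ⊖ (a + c) ⊙ β ≡ (s ⊖ a ⊙ β) ⊕ (t ⊖ c ⊙ β)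
    coordinates [] [] [] a c = refl
    coordinates (x ∷ s) (y ∷ t) (b ∷ β) a c = cong₂ _∷_ (lemma x y b a c) (coordinates s t β a c)

  1⊙ : ∀ {n} (v : Vec ℚ n) → 1ℚ ⊙ v ≡ v
  1⊙ [] = refl
  1⊙ (x ∷ v) = cong₂ _∷_ (ℚₚ.*-identityˡ x) (1⊙ v)

  ⊖-0ᵛ : ∀ {n} (v : Vec ℚ n) → v ⊖ 0ᵛ ≡ v
  ⊖-0ᵛ [] = refl
  ⊖-0ᵛ (x ∷ v) = cong₂ _∷_ (ℚₚ.+-identityʳ x) (⊖-0ᵛ v)

  π-direction : ∀ β′ {β} → u β ≡ 1ℚ → π β′ β ≡ β ⊖ β′
  π-direction β′ {β} uβ = cong (β ⊖_) (trans (cong (_⊙ β′) uβ) (1⊙ β′))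

  π-self : ∀ {β} → u β ≡ 1ℚ → π β β ≡ 0ᵛ
  π-self {β} uβ = trans (π-direction β uβ) (⊖-self β)

  δ-level : ∀ {β s q} → u s ≡ u q → δ s q ≡ δ (π β s) (π β q)
  δ-level {β} {s} {q} e = δ-⇔ (λ { refl → refl }) λ p → trans (sym (⊖-⊕-cancel q (u q ⊙ β)))
    (trans (cong₂ (λ v c → v ⊕ c ⊙ β) p (sym e)) (⊖-⊕-cancel s (u s ⊙ β)))

  -- L = (1 − 𝐱^β) H

  record Multiple (β : Vec ℚ d) (L H : Formal d) : Set where
    constructor multiple
    field
      pairing : ∀ φ → ⟨ L , φ ⟩ ≡ ⟨ H , φ ⟩ - ⟨ H , (λ q → φ (q ⊕ β)) ⟩

  open Multiple

  module _ {β} (uβ : u β ≡ 1ℚ) {L H : Formal d} (mult : Multiple β L H) (β′ : Vec ℚ d) where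

    private
      κ = π β′ β

      shifted : ∀ p i q → δ p (π β′ (q ⊕ β)) * falling i (u (q ⊕ β)) ≡ δ (p ⊖ κ) (π β′ q) * falling i (u q + 1ℚ)
      shifted p i q = cong₂ (λ a b → a * falling i b)
        (δ-⇔ (λ e → trans (sym (⊕-⊖-cancel (π β′ q) κ)) (cong (_⊖ κ) (trans (sym (π-⊕ β′ q β)) e)))
             (λ e → trans (π-⊕ β′ q β) (trans (cong (_⊕ κ) e) (⊖-⊕-cancel p κ))))
        (trans (homo-⊕ q β) (cong (u q +_) uβ))

    -- Multiplication by `𝐱^β` carries the line over `p ⊖ κ` parallel to `β′` to the line over `p`,
    -- and raises `u` by one. For `β = β′` the shift `κ` is zero and every line stays in place.
    moment-zero : ∀ p → moment 0 β′ p L ≡ moment 0 β′ p H - moment 0 β′ (p ⊖ κ) H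
    moment-zero p = trans (pairing mult _) (cong (λ x → moment 0 β′ p H - x) (pair-≗ H (shifted p 0)))

    -- The rise of `u` by one brings in a moment of lower order, through the Leibniz rule
    -- `falling-suc`.
    moment-suc : ∀ i p → moment (suc i) β′ p L ≡
      moment (suc i) β′ p H - (moment (suc i) β′ (p ⊖ κ) H + fromℕ (suc i) * moment i β′ (p ⊖ κ) H)
    moment-suc i p = trans (pairing mult _) (cong (λ x → moment (suc i) β′ p H - x) (begin
      ⟨ H , (λ q → δ p (π β′ (q ⊕ β)) * falling (suc i) (u (q ⊕ β))) ⟩
        ≡⟨ pair-≗ H (λ q → trans (shifted p (suc i) q) (trans (cong (δ (p ⊖ κ) (π β′ q) *_) (falling-suc i (u q)))
             (lemma (δ (p ⊖ κ) (π β′ q)) (falling (suc i) (u q)) (fromℕ (suc i)) (falling i (u q))))) ⟩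
      ⟨ H , (λ q → δ (p ⊖ κ) (π β′ q) * falling (suc i) (u q) + fromℕ (suc i) * (δ (p ⊖ κ) (π β′ q) * falling i (u q))) ⟩
        ≡⟨ pair-+ H _ _ ⟩
      moment (suc i) β′ (p ⊖ κ) H + ⟨ H , (λ q → fromℕ (suc i) * (δ (p ⊖ κ) (π β′ q) * falling i (u q))) ⟩
        ≡⟨ cong (moment (suc i) β′ (p ⊖ κ) H +_) (pair-scale H (fromℕ (suc i)) _) ⟩
      moment (suc i) β′ (p ⊖ κ) H + fromℕ (suc i) * moment i β′ (p ⊖ κ) H ∎))
      where
      open ≡-Reasoning
      lemma : ∀ a f n g → a * (f + n * g) ≡ a * f + n * (a * g)
      lemma = solve-∀ ℚring

  -- In the direction `β` itself, the moments of `H` of the highest order cancel and only those of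
  -- one order less remain, so that the order of vanishing grows by one. In any other direction, the
  -- moments of `L` combine moments of `H` of no higher order.
  flat-up : ∀ {β βs L H} → u β ≡ 1ℚ → Multiple β L H → Flat βs H → Flat (β ∷ βs) L
  flat-up {β} {L = L} {H} uβ mult flat .β zero (inj₁ refl) p =
    trans (moment-zero uβ mult β p)
      (trans (cong (λ r → moment 0 β p H - moment 0 β r H) (trans (cong (p ⊖_) (π-self uβ)) (⊖-0ᵛ p)))
        (ℚₚ.+-inverseʳ (moment 0 β p H)))
  flat-up {β} {L = L} {H} uβ mult flat β′ zero (inj₂ o) p =
    trans (moment-zero uβ mult β′ p) (cong₂ _-_ (flat β′ 0 o p) (flat β′ 0 o _))
  flat-up {β} {L = L} {H} uβ mult flat .β (suc i) (inj₁ (refl , o)) p =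
    trans (moment-suc uβ mult β i p)
      (trans (cong₂ (λ r m → moment (suc i) β p H - (moment (suc i) β r H + fromℕ (suc i) * m))
                (trans (cong (p ⊖_) (π-self uβ)) (⊖-0ᵛ p)) (flat β i o _))
        (lemma (moment (suc i) β p H) (fromℕ (suc i))))
    where
    lemma : ∀ m n → m - (m + n * 0ℚ) ≡ 0ℚ
    lemma = solve-∀ ℚring
  flat-up {β} {L = L} {H} uβ mult flat β′ (suc i) (inj₂ o) p =
    trans (moment-suc uβ mult β′ i p)
      (trans (cong₂ (λ x y → x - y) (flat β′ (suc i) o p)
               (cong₂ (λ y z → y + fromℕ (suc i) * z) (flat β′ (suc i) o _) (flat β′ i (order-pred i o) _)))
        (lemma (fromℕ (suc i))))
    where
    lemma : ∀ n → 0ℚ - (0ℚ + n * 0ℚ) ≡ 0ℚ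
    lemma = solve-∀ ℚring

  -- Moments along lines translated by multiples of `κ` agree, while the finitely many exponents
  -- meet only finitely many lines.
  moment-periodic : ∀ i β κ H → κ ≢ 0ᵛ → (∀ p → moment i β p H ≡ moment i β (p ⊖ κ) H) → ∀ p → moment i β p H ≡ 0ℚ
  moment-periodic i β κ H κ≢0 periodic p = trans (iterate (proj₁ escape) p) (proj₂ escape (proj₁ escape) ℕₚ.≤-refl)
    where
    escape : Ev (λ n → moment i β (back n κ p) H ≡ 0ℚ)
    escape = pair-escapes κ≢0 p H (π β) (λ s → falling i (u s))
    iterate : ∀ n p → moment i β p H ≡ moment i β (back n κ p) H
    iterate zero p = refl
    iterate (suc n) p = trans (periodic p) (iterate n (p ⊖ κ))

  -- In the direction `β`, the moment of `L` of order `i + 1` is `−(i + 1)` times the moment of `H`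
  -- of order `i`. In another direction, once the moments of lower order vanish, those of order `i`
  -- are invariant under the nonzero translation `κ`, hence zero.
  flat-down : ∀ {β βs L H} → u β ≡ 1ℚ → Multiple β L H → Flat (β ∷ βs) L → Flat βs H
  flat-down {β} {βs} {L} {H} uβ mult flat β′ i o with β′ ≟ᵛ β
  ... | yes refl = λ p → *-cancel-0 (pos≢0 (0<fromℕ-suc i))
        (trans (lemma (moment (suc i) β p H) (fromℕ (suc i) * moment i β p H))
          (cong -_ (trans (cong (λ r → moment (suc i) β p H - (moment (suc i) β r H + fromℕ (suc i) * moment i β r H))
                                   (sym (trans (cong (p ⊖_) (π-self uβ)) (⊖-0ᵛ p))))
                            (trans (sym (moment-suc uβ mult β i p)) (flat β (suc i) (inj₁ (refl , o)) p)))))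
    where
    lemma : ∀ m n → n ≡ - (m - (m + n))
    lemma = solve-∀ ℚring
  ... | no β′≢β = go i o
    where
    κ = π β′ β
    κ≢0 : κ ≢ 0ᵛ
    κ≢0 e = β′≢β (sym (⊖≡0 (trans (sym (π-direction β′ uβ)) e)))
    go : ∀ i → Order β′ βs i → ∀ p → moment i β′ p H ≡ 0ℚ
    go zero o = moment-periodic 0 β′ κ H κ≢0 λ p →
      diff≡0 (trans (sym (moment-zero uβ mult β′ p)) (flat β′ 0 (inj₂ o) p))
    go (suc i) o = moment-periodic (suc i) β′ κ H κ≢0 λ p → diff≡0
      (trans (lemma (moment (suc i) β′ p H) (moment (suc i) β′ (p ⊖ κ) H) (fromℕ (suc i)))
        (trans (cong (λ z → moment (suc i) β′ p H - (moment (suc i) β′ (p ⊖ κ) H + fromℕ (suc i) * z))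
                  (sym (go i (order-pred i o) (p ⊖ κ))))
          (trans (sym (moment-suc uβ mult β′ i p)) (flat β′ (suc i) (inj₂ o) p))))
      where
      lemma : ∀ m m′ n → m - m′ ≡ m - (m′ + n * 0ℚ)
      lemma = solve-∀ ℚring

  module _ {u₀ β L} (uβ : u β ≡ 1ℚ) (lpβ : LP β) (D : Division u₀ β L) {Y} (tameY : Tame Y) (∇Y≐L : ∇ β Y ≐ L) where

    open Division D

    private
      -- Here `(1 − 𝐱^β) Z` is the remainder, concentrated on the level `u₀`. On a progression
      -- `s + ℤβ` through that level, `Z` is therefore zero below it and constant from it upwards.
      Z : Series d
      Z s = Y s - coeff quotient s

      tameZ : Tame Z
      tameZ = tame-− tameY (tame-coeff quotient)

      ∇Z : ∇ β Z ≐ remainder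
      ∇Z s = begin
        ∇ β Z s                                      ≡⟨ ∇-− β Y (coeff quotient) s ⟩
        ∇ β Y s - ∇ β (coeff quotient) s             ≡⟨ cong (_- ∇ β (coeff quotient) s) (trans (∇Y≐L s) (division (δ s))) ⟩
        coeff remainder s + (coeff quotient s - ⟨ quotient , (λ q → δ s (q ⊕ β)) ⟩) - ∇ β (coeff quotient) s
          ≡⟨ cong (λ x → coeff remainder s + (coeff quotient s - x) - ∇ β (coeff quotient) s) (coeff-shift β quotient s) ⟩
        coeff remainder s + ∇ β (coeff quotient) s - ∇ β (coeff quotient) s
          ≡⟨ lemma (coeff remainder s) (∇ β (coeff quotient) s) ⟩
        coeff remainder s                            ∎
        where
        open ≡-Reasoning
        lemma : ∀ x y → x + y - y ≡ x
        lemma = solve-∀ ℚring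

      off-level : ∀ {s} → u s ≢ u₀ → ∇ β Z s ≡ 0ℚ
      off-level {s} ne = trans (∇Z s) (level-coeff remainder-level ne)

      forward : ℕ → Vec ℚ d → Vec ℚ d
      forward zero s = s
      forward (suc n) s = forward n s ⊕ β

      u-forward : ∀ n s → u (forward n s) ≡ u s + fromℕ n
      u-forward zero s = sym (ℚₚ.+-identityʳ (u s))
      u-forward (suc n) s = trans (homo-⊕ (forward n s) β) (trans (cong₂ _+_ (u-forward n s) uβ)
        (trans (lemma (u s) (fromℕ n)) (cong (u s +_) (sym (fromℕ-suc n)))))
        where
        lemma : ∀ x n → x + n + 1ℚ ≡ x + (1ℚ + n)
        lemma = solve-∀ ℚring

      +≢ : ∀ {x y z} → z ≡ x + y → 0ℚ < y → z ≢ x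
      +≢ {x} {y} refl 0<y e = pos≢0 0<y (trans (lemma x y) (trans (cong (_- x) e) (ℚₚ.+-inverseʳ x)))
        where
        lemma : ∀ x y → y ≡ x + y - x
        lemma = solve-∀ ℚring

    -- The constant value of `Z` above the level `u₀` is the coefficient of the remainder at `s`.
    -- Boundedness makes `Z` zero far up the progression, so this constant is zero.
    bounded⇒remainder≡0 : Bounded Y → ∀ s → coeff remainder s ≡ 0ℚ
    bounded⇒remainder≡0 bY s with u s ℚₚ.≟ u₀
    ... | no ne = level-coeff remainder-level ne
    ... | yes us≡u₀ = trans (sym (trans initial (∇Z s))) at-infinity
      where
      bZ : Bounded Z
      bZ = bounded-− bY (bounded-coeff quotient)
      below : ∀ n → u (back n β (s ⊖ β)) ≢ u₀
      below n e = pos≢0 (0<fromℕ-suc n) (trans (lemma (u s) (fromℕ (suc n)))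
        (trans (cong (λ x → u s - (u s - x)) (sym (trans (cong (fromℕ (suc n) *_) uβ) (ℚₚ.*-identityʳ (fromℕ (suc n))))))
          (trans (cong₂ _-_ us≡u₀ (trans (sym (back-linear lin (suc n) β s)) e)) (ℚₚ.+-inverseʳ u₀))))
        where
        lemma : ∀ x n → n ≡ x - (x - n)
        lemma = solve-∀ ℚring
      initial : Z s ≡ ∇ β Z s
      initial = trans (sym (ℚₚ.+-identityʳ (Z s))) (cong (λ x → Z s - x)
        (sym (tame-zero-along {b = β} {G = Z} lpβ tameZ λ n → off-level (below n))))
      constant : ∀ n → Z (forward n s) ≡ Z s
      constant zero = refl
      constant (suc n) = trans (diff≡0 (off-level {forward n s ⊕ β} (+≢ (trans (u-forward (suc n) s) (cong (_+ fromℕ (suc n)) us≡u₀)) (0<fromℕ-suc n))))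
        (trans (cong Z (⊕-⊖-cancel (forward n s) β)) (constant n))
      at-infinity : Z s ≡ 0ℚ
      at-infinity with archimedean (bound bZ - u s)
      ... | n , large = trans (sym (constant (suc n))) (beyond bZ (forward (suc n) s)
              (diff-pos⁻ (subst (0ℚ <_) (trans (lemma (bound bZ) (u s) (fromℕ n)) (cong (_- bound bZ) (trans (cong (u s +_) (sym (fromℕ-suc n))) (sym (u-forward (suc n) s)))))
                (+-pos-nonneg 0<1 (diff-nonneg (large n ℕₚ.≤-refl))))))
        where
        lemma : ∀ b x n → 1ℚ + (n - (b - x)) ≡ (x + (1ℚ + n)) - b
        lemma = solve-∀ ℚring

    -- A line parallel to `β` meets the level `u₀` in one point, so a coefficient of the remainder
    -- is a moment of order zero along that line. The quotient contributes nothing, since this test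
    -- function is invariant under translation by `β`; the moment is that of `L`.
    flat⇒remainder≡0 : (∀ p → moment 0 β p L ≡ 0ℚ) → ∀ s → coeff remainder s ≡ 0ℚ
    flat⇒remainder≡0 flat s with u s ℚₚ.≟ u₀
    ... | no ne = level-coeff remainder-level ne
    ... | yes us≡u₀ = begin
        coeff remainder s
          ≡⟨ pair-cong (All.map (λ {(_ , q)} uq≡u₀ → trans (δ-level {β} {s} {q} (trans us≡u₀ (sym uq≡u₀))) (sym (ℚₚ.*-identityʳ _))) remainder-level) ⟩
        ⟨ remainder , φ ⟩
          ≡⟨ lemma ⟨ remainder , φ ⟩ ⟨ quotient , φ ⟩ ⟩
        ⟨ remainder , φ ⟩ + (⟨ quotient , φ ⟩ - ⟨ quotient , φ ⟩)
          ≡⟨ cong (λ x → ⟨ remainder , φ ⟩ + (⟨ quotient , φ ⟩ - x)) (pair-≗ quotient invariant) ⟩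
        ⟨ remainder , φ ⟩ + (⟨ quotient , φ ⟩ - ⟨ quotient , φ ∘ (_⊕ β) ⟩)
          ≡⟨ division φ ⟨
        ⟨ L , φ ⟩
          ≡⟨ flat (π β s) ⟩
        0ℚ ∎
      where
      open ≡-Reasoning
      φ : Vec ℚ d → ℚ
      φ q = δ (π β s) (π β q) * falling 0 (u q)
      lemma : ∀ x y → x ≡ x + (y - y)
      lemma = solve-∀ ℚring
      invariant : ∀ q → φ q ≡ φ (q ⊕ β)
      invariant q = cong (λ v → δ (π β s) v * 1ℚ)
        (sym (trans (π-⊕ β q β) (trans (cong (π β q ⊕_) (π-self uβ)) (⊕-identityʳ (π β q)))))

    remainder≡0⇒multiple : (∀ s → coeff remainder s ≡ 0ℚ) → Multiple β L quotient
    remainder≡0⇒multiple z = multiple λ φ → trans (division φ)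
      (trans (cong (_+ (⟨ quotient , φ ⟩ - ⟨ quotient , φ ∘ (_⊕ β) ⟩)) (pair-coeff≡0 {L = remainder} z φ))
        (ℚₚ.+-identityˡ (⟨ quotient , φ ⟩ - ⟨ quotient , φ ∘ (_⊕ β) ⟩)))

    remainder≡0⇒≐ : (∀ s → coeff remainder s ≡ 0ℚ) → Y ≐ quotient
    remainder≡0⇒≐ z s = diff≡0 (tame-zero-along {b = β} {G = Z} lpβ tameZ λ n → trans (∇Z _) (z _))

  -- Boundedness and flatness each force the remainder modulo `1 − 𝐱^β` to vanish. The factor then
  -- divides out exactly, `Y` solves the shorter system with the quotient as numerator, and
  -- `flat-up` and `flat-down` transport flatness.
  bounded⇔flat-directions : ∀ {u₀ βs L Y} → All (λ β → LP β × u β ≡ 1ℚ) βs → Graded u₀ L → Tame Y → ∇* βs Y ≐ L →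
                            (Bounded Y → Flat βs L) × (Flat βs L → Bounded Y)
  bounded⇔flat-directions {L = L} [] gr tY e = (λ _ _ _ ()) , λ _ → bounded-cong (λ s → sym (e s)) (bounded-coeff L)
  bounded⇔flat-directions {u₀} {β ∷ βs} {L} {Y} ((lp , uβ) ∷ ps) gr tY e = to , from
    where
    D : Division u₀ β L
    D = divide uβ gr
    open Division D
    t₁ : Tame (∇* βs Y)
    t₁ = tame-∇* βs tY
    module _ (z : ∀ s → coeff remainder s ≡ 0ℚ) where
      divisible : Multiple β L quotient
      divisible = remainder≡0⇒multiple uβ lp D t₁ e z
      rest : (Bounded Y → Flat βs quotient) × (Flat βs quotient → Bounded Y)
      rest = bounded⇔flat-directions {u₀} ps quotient-graded tY (remainder≡0⇒≐ uβ lp D t₁ e z)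
    to : Bounded Y → Flat (β ∷ βs) L
    to bY = flat-up uβ (divisible z) (proj₁ (rest z) bY)
      where
      z = bounded⇒remainder≡0 uβ lp D t₁ e (bounded-∇* βs bY)
    from : Flat (β ∷ βs) L → Bounded Y
    from flat = proj₂ (rest z) (flat-down uβ (divisible z) flat)
      where
      z = flat⇒remainder≡0 uβ lp D t₁ e (flat β 0 (inj₁ refl))

  -- avg β n G = (1 + 𝐱^β + ⋯ + 𝐱^((n−1)β)) G

  avg : Vec ℚ d → ℕ → Series d → Series d
  avg β zero G s = 0ℚ
  avg β (suc n) G s = G s + avg β n G (s ⊖ β)

  avg-cong : ∀ β n {G H : Series d} → G ≗ H → avg β n G ≗ avg β n H
  avg-cong β zero e s = refl
  avg-cong β (suc n) e s = cong₂ _+_ (e s) (avg-cong β n e (s ⊖ β))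

  ∇-avg : ∀ b β n G → ∇ b (avg β n G) ≗ avg β n (∇ b G)
  ∇-avg b β zero G s = refl
  ∇-avg b β (suc n) G s = begin
    G s + A (s ⊖ β) - (G (s ⊖ b) + A (s ⊖ b ⊖ β))      ≡⟨ cong (λ v → G s + A (s ⊖ β) - (G (s ⊖ b) + A v)) (⊖-⊖-comm s b β) ⟩
    G s + A (s ⊖ β) - (G (s ⊖ b) + A (s ⊖ β ⊖ b))      ≡⟨ lemma (G s) (A (s ⊖ β)) (G (s ⊖ b)) (A (s ⊖ β ⊖ b)) ⟩
    (G s - G (s ⊖ b)) + (A (s ⊖ β) - A (s ⊖ β ⊖ b))    ≡⟨ cong (∇ b G s +_) (∇-avg b β n G (s ⊖ β)) ⟩
    ∇ b G s + avg β n (∇ b G) (s ⊖ β)                  ∎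
    where
    open ≡-Reasoning
    A = avg β n G
    lemma : ∀ g a h c → g + a - (h + c) ≡ (g - h) + (a - c)
    lemma = solve-∀ ℚring

  ∇*-avg : ∀ bs β n G → ∇* bs (avg β n G) ≗ avg β n (∇* bs G)
  ∇*-avg [] β n G s = refl
  ∇*-avg (b ∷ bs) β n G s = trans (∇-cong b (∇*-avg bs β n G) s) (∇-avg b β n (∇* bs G) s)

  ∇-avg-telescope : ∀ β n G s → ∇ β (avg β n G) s ≡ G s - G (back n β s)
  ∇-avg-telescope β zero G s = trans (ℚₚ.+-inverseʳ 0ℚ) (sym (ℚₚ.+-inverseʳ (G s)))
  ∇-avg-telescope β (suc n) G s = trans (lemma (G s) (A (s ⊖ β)) (G (s ⊖ β)) (A (s ⊖ β ⊖ β)))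
    (trans (cong ((G s - G (s ⊖ β)) +_) (∇-avg-telescope β n G (s ⊖ β))) (lemma′ (G s) (G (s ⊖ β)) (G (back n β (s ⊖ β)))))
    where
    A = avg β n G
    lemma : ∀ g a h c → g + a - (h + c) ≡ (g - h) + (a - c)
    lemma = solve-∀ ℚring
    lemma′ : ∀ g h k → (g - h) + (h - k) ≡ g - k
    lemma′ = solve-∀ ℚring

  avg-nonneg : ∀ β n {G} → (∀ s → 0ℚ ≤ G s) → ∀ s → 0ℚ ≤ avg β n G s
  avg-nonneg β zero g s = ℚₚ.≤-refl
  avg-nonneg β (suc n) g s = +-nonneg (g s) (avg-nonneg β n g (s ⊖ β))

  tame-avg : ∀ β n {G} → Tame G → Tame (avg β n G)
  tame-avg β zero g = tame λ _ _ → Ev-always λ _ → refl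
  tame-avg β (suc n) g = tame λ p s → Ev-map₂ (λ _ → cong₂ _+_) (vanishes g p s) (vanishes (tame-shift β (tame-avg β n g)) p s)

  bounded-avg : ∀ β n {G} → Bounded G → Bounded (avg β n G)
  bounded-avg β zero g = bounded 0ℚ λ _ _ → refl
  bounded-avg β (suc n) g = bounded-combine (λ _ → cong₂ _+_) g (bounded-shift β (bounded-avg β n g))

  -- Multiplication by a polynomial with nonnegative coefficients cannot cancel anything.

  bounded-avg⁻¹ : ∀ β n {G} → (∀ s → 0ℚ ≤ G s) → Bounded (avg β (suc n) G) → Bounded G
  bounded-avg⁻¹ β n {G} g (bounded B h) = bounded B λ s lt → ℚₚ.≤-antisym
    (subst (G s ≤_) (h s lt) (diff-nonneg⁻ (subst (0ℚ ≤_) (lemma (G s) (avg β n G (s ⊖ β))) (avg-nonneg β n g (s ⊖ β))))) (g s)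
    where
    lemma : ∀ x y → y ≡ x + y - x
    lemma = solve-∀ ℚring

  Positive : Vec ℚ d → Set
  Positive b = LP b × ∃[ n ] u b ≡ fromℕ (suc n)

  -- Parallel vectors with positive values of `u` receive the same direction, so that multiplicities
  -- in the list of directions count the poles at `𝐱^β = 1`.
  direction : Vec ℚ d → Vec ℚ d
  direction b = inverse (u b) ⊙ b

  positive⇒0< : ∀ {b} → Positive b → 0ℚ < u b
  positive⇒0< (_ , n , e) = subst (0ℚ <_) (sym e) (0<fromℕ-suc n)

  direction-normalised : ∀ {b} → Positive b → LP (direction b) × u (direction b) ≡ 1ℚ
  direction-normalised {b} p@(lp , _) = LP-⊙ (inverse-pos (positive⇒0< p)) lp ,
    trans (homo-⊙ (inverse (u b)) b) (trans (ℚₚ.*-comm (inverse (u b)) (u b)) (*-inverse (pos≢0 (positive⇒0< p))))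

  avg* : ∀ {bs} → All Positive bs → Series d → Series d
  avg* [] G = G
  avg* {b ∷ _} ((_ , n , _) ∷ ps) G = avg (direction b) (suc n) (avg* ps G)

  avg*-nonneg : ∀ {bs} (ps : All Positive bs) {G} → (∀ s → 0ℚ ≤ G s) → ∀ s → 0ℚ ≤ avg* ps G s
  avg*-nonneg [] g = g
  avg*-nonneg {b ∷ _} ((_ , n , _) ∷ ps) g = avg-nonneg (direction b) (suc n) (avg*-nonneg ps g)

  tame-avg* : ∀ {bs} (ps : All Positive bs) {G} → Tame G → Tame (avg* ps G)
  tame-avg* [] g = g
  tame-avg* {b ∷ _} ((_ , n , _) ∷ ps) g = tame-avg (direction b) (suc n) (tame-avg* ps g)

  bounded-avg* : ∀ {bs} (ps : All Positive bs) {G} → Bounded G → Bounded (avg* ps G)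
  bounded-avg* [] g = g
  bounded-avg* {b ∷ _} ((_ , n , _) ∷ ps) g = bounded-avg (direction b) (suc n) (bounded-avg* ps g)

  bounded-avg*⁻¹ : ∀ {bs} (ps : All Positive bs) {G} → (∀ s → 0ℚ ≤ G s) → Bounded (avg* ps G) → Bounded G
  bounded-avg*⁻¹ [] g h = h
  bounded-avg*⁻¹ {b ∷ _} ((_ , n , _) ∷ ps) g h = bounded-avg*⁻¹ ps g (bounded-avg⁻¹ (direction b) n (avg*-nonneg ps g) h)

  ∇-direction-avg : ∀ {b} ((_ , n , _) : Positive b) G → ∇ (direction b) (avg (direction b) (suc n) G) ≗ ∇ b G
  ∇-direction-avg {b} p@(_ , n , e) G s = trans (∇-avg-telescope (direction b) (suc n) G s)
    (cong (λ v → G s - G v) (trans (back-⊙ (suc n) (direction b) s) (cong (s ⊖_) (begin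
      fromℕ (suc n) ⊙ inverse (u b) ⊙ b  ≡⟨ cong (_⊙ inverse (u b) ⊙ b) e ⟨
      u b ⊙ inverse (u b) ⊙ b            ≡⟨ ⊙-assoc (u b) (inverse (u b)) b ⟩
      (u b * inverse (u b)) ⊙ b          ≡⟨ cong (_⊙ b) (*-inverse (pos≢0 (positive⇒0< p))) ⟩
      1ℚ ⊙ b                             ≡⟨ 1⊙ b ⟩
      b                                  ∎))))
    where
    open ≡-Reasoning
    ⊙-assoc : ∀ {n} a c (v : Vec ℚ n) → a ⊙ c ⊙ v ≡ (a * c) ⊙ v
    ⊙-assoc a c [] = refl
    ⊙-assoc a c (x ∷ v) = cong₂ _∷_ (sym (ℚₚ.*-assoc a c x)) (⊙-assoc a c v)

  ∇*-directions-avg* : ∀ {bs} (ps : All Positive bs) G → ∇* (List.map direction bs) (avg* ps G) ≗ ∇* bs G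
  ∇*-directions-avg* [] G s = refl
  ∇*-directions-avg* {b ∷ bs} (p@(_ , n , _) ∷ ps) G s = trans
    (∇-cong (direction b) (λ t → trans (∇*-avg (List.map direction bs) (direction b) (suc n) (avg* ps G) t)
      (avg-cong (direction b) (suc n) (∇*-directions-avg* ps G) t)) s)
    (∇-direction-avg p (∇* bs G) s)

  -- Averaging turns each `1 − 𝐱ᵇ` with `u b > 0` into `1 − 𝐱^β`; nonnegativity of `F` allows the
  -- averaging to be undone. The factors with `u b ≤ 0` are undone by `bounded-∇*⁻¹`.
  bounded⇔flat : ∀ {u₀ bs₀ bs₁ L F} → (∀ s → 0ℚ ≤ F s) → Tame F →
                 All (λ b → LP b × u b ≤ 0ℚ) bs₀ → All Positive bs₁ → Graded u₀ L → ∇* bs₁ (∇* bs₀ F) ≐ L →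
                 (Bounded F → Flat (List.map direction bs₁) L) × (Flat (List.map direction bs₁) L → Bounded F)
  bounded⇔flat {u₀} {bs₀} {bs₁} {L} {F} F≥0 tF ps₀ ps₁ gr e =
    (λ bF → proj₁ directions (bounded-∇* bs₀ (bounded-avg* ps₁ bF))) ,
    (λ flat → bounded-avg*⁻¹ ps₁ F≥0 (bounded-∇*⁻¹ ps₀ tF̃ (proj₂ directions flat)))
    where
    F̃ : Series d
    F̃ = avg* ps₁ F
    tF̃ : Tame F̃
    tF̃ = tame-avg* ps₁ tF
    βs = List.map direction bs₁
    directions : (Bounded (∇* bs₀ F̃) → Flat βs L) × (Flat βs L → Bounded (∇* bs₀ F̃))
    directions = bounded⇔flat-directions {u₀} (Allₚ.map⁺ (All.map direction-normalised ps₁)) gr (tame-∇* bs₀ tF̃) λ s →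
      trans (∇*-comm βs bs₀ F̃ s) (trans (∇*-cong bs₀ (∇*-directions-avg* ps₁ F) s) (trans (∇*-comm bs₀ bs₁ F s) (e s)))

-- Vectors and formal sums varying with t

record VGerm {d} (v : ℕ → Vec ℚ d) : Set where
  constructor vgerm
  field
    coordinate : ∀ i → Germ (λ t → lookup (v t) i)

open VGerm

module _ {d : ℕ} where

  vgerm-const : ∀ (v : Vec ℚ d) → VGerm (λ _ → v)
  vgerm-const v = vgerm λ i → germ-const (lookup v i)

  vgerm-⊕ : ∀ {v w : ℕ → Vec ℚ d} → VGerm v → VGerm w → VGerm (λ t → v t ⊕ w t)
  vgerm-⊕ {v} {w} a b = vgerm λ i → germ-≗ (λ t → sym (IsLinear.homo-⊕ (lookup-linear i) (v t) (w t))) (germ-+ (coordinate a i) (coordinate b i))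

  vgerm-⊖ : ∀ {v w : ℕ → Vec ℚ d} → VGerm v → VGerm w → VGerm (λ t → v t ⊖ w t)
  vgerm-⊖ {v} {w} a b = vgerm λ i → germ-≗ (λ t → sym (IsLinear.homo-⊖ (lookup-linear i) (v t) (w t))) (germ-- (coordinate a i) (coordinate b i))

  vgerm-⊙ : ∀ {a : ℕ → ℚ} {v : ℕ → Vec ℚ d} → Germ a → VGerm v → VGerm (λ t → a t ⊙ v t)
  vgerm-⊙ {a} {v} g b = vgerm λ i → germ-≗ (λ t → sym (IsLinear.homo-⊙ (lookup-linear i) (a t) (v t))) (germ-* g (coordinate b i))

vgerm-head : ∀ {d} {v : ℕ → Vec ℚ (suc d)} → VGerm v → Germ (λ t → Vec.head (v t))
vgerm-head {v = v} g = germ-≗ (λ t → lemma (v t)) (coordinate g zero)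
  where
  lemma : ∀ {d} (w : Vec ℚ (suc d)) → lookup w zero ≡ Vec.head w
  lemma (x ∷ w) = refl

vgerm-tail : ∀ {d} {v : ℕ → Vec ℚ (suc d)} → VGerm v → VGerm (λ t → Vec.tail (v t))
vgerm-tail {v = v} g = vgerm λ i → germ-≗ (λ t → lemma (v t)) (coordinate g (suc i))
  where
  lemma : ∀ {d} (w : Vec ℚ (suc d)) {i} → lookup w (suc i) ≡ lookup (Vec.tail w) i
  lemma (x ∷ w) = refl

germ-dot : ∀ {d} (c : Vec ℚ d) {v : ℕ → Vec ℚ d} → VGerm v → Germ (λ t → dot c (v t))
germ-dot [] {v} g = germ-≗ (λ t → lemma (v t)) (germ-const 0ℚ)
  where
  lemma : ∀ w → 0ℚ ≡ dot [] w
  lemma [] = refl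
germ-dot (c ∷ cs) {v} g = germ-≗ (λ t → lemma (v t)) (germ-+ (germ-* (germ-const c) (vgerm-head g)) (germ-dot cs (vgerm-tail g)))
  where
  lemma : ∀ w → c * Vec.head w + dot cs (Vec.tail w) ≡ dot (c ∷ cs) w
  lemma (x ∷ w) = refl

settled-Fin : ∀ {n} {P : Fin n → ℕ → Set} → (∀ i → Settled (P i)) → Settled (λ t → ∀ i → P i t)
settled-Fin {zero} s = inj₁ (Ev-always λ _ ())
settled-Fin {suc n} s = settled-⇔ (λ { _ (a , b) zero → a ; _ (a , b) (suc i) → b i }) (λ _ f → f zero , f ∘ suc)
  (settled-× (s zero) (settled-Fin (s ∘ suc)))

settled-≡ᵛ : ∀ {d} {v w : ℕ → Vec ℚ d} → VGerm v → VGerm w → Settled (λ t → v t ≡ w t)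
settled-≡ᵛ a b = settled-⇔ (λ _ → lookup-ext) (λ _ e i → cong (λ v → lookup v i) e) (settled-Fin λ i → settled-≡ (coordinate a i) (coordinate b i))

settled-LP : ∀ {d} {v : ℕ → Vec ℚ d} → VGerm v → Settled (λ t → LP (v t))
settled-LP {zero} {v} g = inj₂ (Ev-always λ t → empty (v t))
  where
  empty : ∀ w → ¬ LP {zero} w
  empty [] ()
settled-LP {suc d} {v} g = settled-⇔ (λ t → to (v t)) (λ t → from (v t))
  (settled-⊎ (settled-pos (vgerm-head g)) (settled-× (settled-≡0 (vgerm-head g)) (settled-LP (vgerm-tail g))))
  where
  to : ∀ w → 0ℚ < Vec.head w ⊎ (Vec.head w ≡ 0ℚ × LP (Vec.tail w)) → LP w
  to (x ∷ w) p = p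
  from : ∀ w → LP w → 0ℚ < Vec.head w ⊎ (Vec.head w ≡ 0ℚ × LP (Vec.tail w))
  from (x ∷ w) p = p

germ-δ : ∀ {d} {v w : ℕ → Vec ℚ d} → VGerm v → VGerm w → Germ (λ t → δ (v t) (w t))
germ-δ {v = v} {w} a b = germ-if (settled-≡ᵛ b a) (germ-const 1ℚ) (germ-const 0ℚ) (λ t → δ-≡ {s = v t} {w t}) (λ t → δ-≢ {s = v t} {w t})

germ-falling : ∀ i {f} → Germ f → Germ (λ t → falling i (f t))
germ-falling zero g = germ-const 1ℚ
germ-falling (suc i) g = germ-* (germ-falling i g) (germ-- g (germ-const (fromℕ i)))

VFormal : ℕ → Set
VFormal d = List (ℚ × (ℕ → Vec ℚ d))

Vectors : ℕ → Set
Vectors d = List (ℕ → Vec ℚ d)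

module _ {d : ℕ} where

  at : VFormal d → ℕ → Formal d
  at L t = List.map (λ (α , q) → α , q t) L

  vectorsAt : Vectors d → ℕ → List (Vec ℚ d)
  vectorsAt bs t = List.map (λ b → b t) bs

  FGerm : VFormal d → Set
  FGerm = All (λ (_ , q) → VGerm q)

  germ-pair : ∀ {L : VFormal d} {φ : ℕ → Vec ℚ d → ℚ} → All (λ (_ , q) → Germ (λ t → φ t (q t))) L →
              Germ (λ t → ⟨ at L t , φ t ⟩)
  germ-pair [] = germ-const 0ℚ
  germ-pair {(α , _) ∷ _} (g ∷ gs) = germ-+ (germ-* (germ-const α) g) (germ-pair gs)

  germ-coeff : ∀ {L : VFormal d} {s} → FGerm L → VGerm s → Germ (λ t → coeff (at L t) (s t))
  germ-coeff {s = s} gs g = germ-pair (All.map (λ {(_ , q)} gq → germ-δ {v = s} {q} g gq) gs)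

  coeff≢0⇒exponent : ∀ {L : Formal d} {s} → coeff L s ≢ 0ℚ → Any (λ (_ , q) → q ≡ s) L
  coeff≢0⇒exponent {[]} ne = ⊥-elim (ne refl)
  coeff≢0⇒exponent {(α , q) ∷ L} {s} ne with q ≟ᵛ s
  ... | yes e = here e
  ... | no _ = there (coeff≢0⇒exponent λ z → ne (cong₂ _+_ (ℚₚ.*-zeroʳ α) z))

  settled-All-at : ∀ {P : ℕ → ℚ × Vec ℚ d → Set} {L} → All (λ (α , q) → Settled (λ t → P t (α , q t))) L →
                   Settled (λ t → All (P t) (at L t))
  settled-All-at s = settled-⇔ (λ _ → Allₚ.map⁺) (λ _ → Allₚ.map⁻) (settled-All s)

  settled-All-vectorsAt : ∀ {P : ℕ → Vec ℚ d → Set} {bs} → All (λ b → Settled (λ t → P t (b t))) bs →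
                          Settled (λ t → All (P t) (vectorsAt bs t))
  settled-All-vectorsAt s = settled-⇔ (λ _ → Allₚ.map⁺) (λ _ → Allₚ.map⁻) (settled-All s)

  settled-Order : ∀ {β : ℕ → Vec ℚ d} {βs} → VGerm β → All VGerm βs → ∀ i → Settled (λ t → Order (β t) (vectorsAt βs t) i)
  settled-Order g [] i = settled-const (no λ ())
  settled-Order g (h ∷ hs) zero = settled-⊎ (settled-≡ᵛ g h) (settled-Order g hs zero)
  settled-Order g (h ∷ hs) (suc i) = settled-⊎ (settled-× (settled-≡ᵛ g h) (settled-Order g hs i)) (settled-Order g hs (suc i))

  order<length : ∀ {β : Vec ℚ d} {βs} i → Order β βs i → i ℕ.< length βs
  order<length {βs = _ ∷ _} zero o = ℕ.s≤s ℕ.z≤n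
  order<length {βs = _ ∷ _} (suc i) (inj₁ (_ , o)) = ℕ.s≤s (order<length i o)
  order<length {βs = _ ∷ _} (suc i) (inj₂ o) = ℕₚ.m≤n⇒m≤1+n (order<length (suc i) o)

  order-∈ : ∀ {β : Vec ℚ d} {βs} i → Order β βs i → Any (β ≡_) βs
  order-∈ {βs = _ ∷ _} zero (inj₁ e) = here e
  order-∈ {βs = _ ∷ _} zero (inj₂ o) = there (order-∈ zero o)
  order-∈ {βs = _ ∷ _} (suc i) (inj₁ (e , _)) = here e
  order-∈ {βs = _ ∷ _} (suc i) (inj₂ o) = there (order-∈ (suc i) o)

  module _ {u : Vec ℚ d → ℚ} (lin : IsLinear u) (germ-u : ∀ {v : ℕ → Vec ℚ d} → VGerm v → Germ (λ t → u (v t))) where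

    vgerm-π : ∀ {β s : ℕ → Vec ℚ d} → VGerm β → VGerm s → VGerm (λ t → π lin (β t) (s t))
    vgerm-π {β} {s} g h = vgerm-⊖ h (vgerm-⊙ (germ-u h) g)

    germ-moment : ∀ i {β p : ℕ → Vec ℚ d} {L} → VGerm β → VGerm p → FGerm L → Germ (λ t → moment lin i (β t) (p t) (at L t))
    germ-moment i {β} {p} g h gs = germ-pair (All.map (λ {(_ , q)} gq →
      germ-* (germ-δ h (vgerm-π {β} {q} g gq)) (germ-falling i (germ-u gq))) gs)

    -- Only the lines through exponents of L matter, so that flatness is a finite conjunction.

    FlatOnExponents : List (Vec ℚ d) → Formal d → Set
    FlatOnExponents βs L = All (λ β → ∀ i → i ℕ.< length βs → Order β βs i →
      All (λ (_ , q) → moment lin i β (π lin β q) L ≡ 0ℚ) L) βs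

    -- A line through no exponent has zero moments, and multiplicities stay below `length βs`, so
    -- the finite list of conditions is exhaustive.
    flatOnExponents⇒flat : ∀ {βs L} → FlatOnExponents βs L → Flat lin βs L
    flatOnExponents⇒flat {βs} {L} f β i o p with Any.any? (λ (_ , q) → π lin β q ≟ᵛ p) L
    ... | no none = trans (pair-cong (All.map (λ {(_ , q)} ne → trans (cong (_* falling i (u q)) (δ-≢ ne)) (ℚₚ.*-zeroˡ (falling i (u q)))) (Allₚ.¬Any⇒All¬ L none))) (pair-zero L)
    ... | yes some = on-exponent (on-direction (order-∈ i o) f i (order<length i o) o) some
      where
      on-direction : ∀ {P : Vec ℚ d → Set} {xs} → Any (β ≡_) xs → All P xs → P β
      on-direction (here refl) (a ∷ _) = a
      on-direction (there m) (_ ∷ as) = on-direction m as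
      on-exponent : ∀ {M} → All (λ (_ , q) → moment lin i β (π lin β q) L ≡ 0ℚ) M → Any (λ (_ , q) → π lin β q ≡ p) M →
                    moment lin i β p L ≡ 0ℚ
      on-exponent (a ∷ _) (here refl) = a
      on-exponent (_ ∷ as) (there m) = on-exponent as m

    settled-Flat : ∀ {βs L} → All VGerm βs → FGerm L → Settled (λ t → Flat lin (vectorsAt βs t) (at L t))
    settled-Flat {βs} {L} gβ gL = settled-⇔ (λ _ → flatOnExponents⇒flat)
      (λ t f → All.universal (λ β i _ o → All.universal (λ (_ , q) → f β i o (π lin β q)) (at L t)) (vectorsAt βs t))
      (settled-All-vectorsAt (All.map (λ {β} g → settled-⇔
          (λ t f i lt → f i (subst (i ℕ.<_) (sym-length t) lt)) (λ t f i lt → f i (subst (i ℕ.<_) (sym (sym-length t)) lt))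
          (settled-bounded (length βs) λ i → settled-→ (settled-Order g gβ i)
            (settled-All-at (All.map (λ {(_ , q)} gq → settled-≡0 (germ-moment i g (vgerm-π {β} {q} g gq) gL)) gL)))) gβ))
      where
      import Data.List.Properties as Listₚ
      sym-length : ∀ t → length (vectorsAt βs t) ≡ length βs
      sym-length t = Listₚ.length-map (λ b → b t) βs

-- Translation-invariant total orders, given by their positive cones

record IsCone {d} (Pos : Vec ℚ d → Set) : Set where
  field
    sum : ∀ {v w} → Pos v → Pos w → Pos (v ⊕ w)
    irrefl : ¬ Pos 0ᵛ
    total : ∀ v → Pos v ⊎ v ≡ 0ᵛ ⊎ Pos (0ᵛ ⊖ v)

module _ {d : ℕ} where

  ⊖-via-negation : ∀ (s b : Vec ℚ d) → (s ⊖ b) ⊖ (0ᵛ ⊖ b) ≡ s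
  ⊖-via-negation s b = lookup-ext λ i → trans (homo-⊖ i (s ⊖ b) (0ᵛ ⊖ b))
    (trans (cong₂ _-_ (homo-⊖ i s b) (trans (homo-⊖ i 0ᵛ b) (cong (_- lookup b i) (Vecₚ.lookup-replicate i 0ℚ)))) (lemma (lookup s i) (lookup b i)))
    where
    homo-⊖ : ∀ (i : Fin d) → ∀ v w → lookup (v ⊖ w) i ≡ lookup v i - lookup w i
    homo-⊖ i = IsLinear.homo-⊖ (lookup-linear i)
    lemma : ∀ x y → (x - y) - (0ℚ - y) ≡ x
    lemma = solve-∀ ℚring

  ⊖-cancel-middle : ∀ (s b a : Vec ℚ d) → ((s ⊖ b) ⊖ a) ⊕ b ≡ s ⊖ a
  ⊖-cancel-middle s b a = trans (cong (_⊕ b) (⊖-⊖-comm s b a)) (⊖-⊕-cancel (s ⊖ a) b)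

  ⊕-⊖-cancelˡ : ∀ (a b : Vec ℚ d) → (a ⊕ b) ⊖ a ≡ b
  ⊕-⊖-cancelˡ a b = trans (cong (_⊖ a) (⊕-comm a b)) (⊕-⊖-cancel b a)

  module _ {Pos : Vec ℚ d → Set} (cone : IsCone Pos) where

    open IsCone cone

    pos-irrefl : ∀ {v} → v ≡ 0ᵛ → ¬ Pos v
    pos-irrefl refl = irrefl

    IsMin : Series d → Vec ℚ d → Set
    IsMin G s₀ = G s₀ ≢ 0ℚ × (∀ s → G s ≢ 0ℚ → s ≡ s₀ ⊎ Pos (s ⊖ s₀))

    min-cong : ∀ {G H s₀} → G ≗ H → IsMin G s₀ → IsMin H s₀
    min-cong e (ne , least) = (λ z → ne (trans (e _) z)) , λ s ne′ → least s (λ z → ne′ (trans (sym (e s)) z))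

    min-unique : ∀ {G r s} → IsMin G r → IsMin G s → r ≡ s
    min-unique {G} {r} {s} (r≢0 , least) (s≢0 , least′) with least s s≢0 | least′ r r≢0
    ... | inj₁ e | _ = sym e
    ... | inj₂ _ | inj₁ e = e
    ... | inj₂ p | inj₂ q = ⊥-elim (pos-irrefl (⊖-sum s r) (sum p q))
      where
      ⊖-sum : ∀ {n} (a b : Vec ℚ n) → (a ⊖ b) ⊕ (b ⊖ a) ≡ 0ᵛ
      ⊖-sum [] [] = refl
      ⊖-sum (x ∷ a) (y ∷ b) = cong₂ _∷_ (lemma x y) (⊖-sum a b)
        where
        lemma : ∀ x y → (x - y) + (y - x) ≡ 0ℚ
        lemma = solve-∀ ℚring

    -- The point `s₀ − b` precedes the least point, so nothing is subtracted at `s₀`. All shifted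
    -- terms lie strictly after `s₀`.
    min-∇⁺ : ∀ {b G s₀} → Pos b → IsMin G s₀ → IsMin (∇ b G) s₀
    min-∇⁺ {b} {G} {s₀} pb (ne , least) = (λ z → ne (trans (sym (ℚₚ.+-identityʳ (G s₀))) (trans (cong (λ x → G s₀ - x) (sym before)) z))) , least′
      where
      back-to : ((s₀ ⊖ b) ⊖ s₀) ⊕ b ≡ 0ᵛ
      back-to = trans (⊖-cancel-middle s₀ b s₀) (⊖-self s₀)
      before : G (s₀ ⊖ b) ≡ 0ℚ
      before with G (s₀ ⊖ b) ℚₚ.≟ 0ℚ
      ... | yes z = z
      ... | no nz with least (s₀ ⊖ b) nz
      ...   | inj₁ e = ⊥-elim (pos-irrefl (sym (⊖≡0′ e)) pb)
        where
        ⊖≡0′ : s₀ ⊖ b ≡ s₀ → 0ᵛ ≡ b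
        ⊖≡0′ e = trans (sym back-to) (trans (cong (λ v → (v ⊖ s₀) ⊕ b) e)
          (trans (cong (_⊕ b) (⊖-self s₀)) (trans (⊕-comm 0ᵛ b) (⊕-identityʳ b))))
      ...   | inj₂ p = ⊥-elim (pos-irrefl back-to (sum p pb))
      least′ : ∀ s → ∇ b G s ≢ 0ℚ → s ≡ s₀ ⊎ Pos (s ⊖ s₀)
      least′ s nz with G s ℚₚ.≟ 0ℚ
      ... | no Gs≢0 = least s Gs≢0
      ... | yes Gs≡0 with least (s ⊖ b) (λ z → nz (cong₂ _-_ Gs≡0 z))
      ...   | inj₁ e = inj₂ (subst Pos (trans (sym (⊕-⊖-cancelˡ s₀ b)) (cong (_⊖ s₀) (trans (cong (_⊕ b) (sym e)) (⊖-⊕-cancel s b)))) pb)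
      ...   | inj₂ p = inj₂ (subst Pos (⊖-cancel-middle s b s₀) (sum p pb))

    -- From `1 − 𝐱ᵇ = −𝐱ᵇ (1 − 𝐱⁻ᵇ)`: the second factor keeps the least exponent and the first one
    -- moves it by `b`.
    min-∇⁻ : ∀ {b G s₀} → Pos (0ᵛ ⊖ b) → IsMin G s₀ → IsMin (∇ b G) (s₀ ⊕ b)
    min-∇⁻ {b} {G} {s₀} pb m with min-∇⁺ pb m
    ... | ne , least = (λ z → ne (trans (cong (∇ -b G) (sym (⊕-⊖-cancel s₀ b))) (trans (neg-swap (s₀ ⊕ b)) (cong -_ z)))) , λ s nz →
        shifted s (least (s ⊖ b) λ z → nz (trans (sym (neg-involutive (∇ b G s))) (cong -_ (trans (sym (neg-swap s)) z))))
      where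
      -b = 0ᵛ ⊖ b
      neg-swap : ∀ s → ∇ -b G (s ⊖ b) ≡ - ∇ b G s
      neg-swap s = trans (cong (λ v → G (s ⊖ b) - G v) (⊖-via-negation s b)) (minus-swap (G s) (G (s ⊖ b)))
      shifted : ∀ s → s ⊖ b ≡ s₀ ⊎ Pos ((s ⊖ b) ⊖ s₀) → s ≡ s₀ ⊕ b ⊎ Pos (s ⊖ (s₀ ⊕ b))
      shifted s (inj₁ e) = inj₁ (trans (sym (⊖-⊕-cancel s b)) (cong (_⊕ b) e))
      shifted s (inj₂ p) = inj₂ (subst Pos (⊖-⊖ s b s₀) p)
        where
        lemma : ∀ x y z → (x - y) - z ≡ x - (z + y)
        lemma = solve-∀ ℚring
        ⊖-⊖ : ∀ {n} (s b a : Vec ℚ n) → (s ⊖ b) ⊖ a ≡ s ⊖ (a ⊕ b)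
        ⊖-⊖ [] [] [] = refl
        ⊖-⊖ (x ∷ s) (y ∷ b) (z ∷ a) = cong₂ _∷_ (lemma x y z) (⊖-⊖ s b a)

    module _ (settled-Pos : ∀ {v : ℕ → Vec ℚ d} → VGerm v → Settled (λ t → Pos (v t))) where

      -- The displacement depends only on the signs of the vectors, which are settled; hence a
      -- single `e` serves every series with a least term.
      Displacement : Vectors d → Set
      Displacement bs = ∃[ e ] VGerm e × Ev (λ t → ∀ {G s₀} →
        All (_≢ 0ᵛ) (vectorsAt bs t) → IsMin G s₀ → IsMin (∇* (vectorsAt bs t) G) (s₀ ⊕ e t))

      displacement-cons : ∀ {b bs} → VGerm b → Settled (λ t → Pos (b t)) → Displacement bs → Displacement (b ∷ bs)
      displacement-cons g (inj₁ p) (e , ge , ev) = e , ge , Ev-map₂ (λ { t h pb (_ ∷ nz) m → min-∇⁺ pb (h nz m) }) ev p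
      displacement-cons {b} {bs} g (inj₂ n) (e , ge , ev) = (λ t → e t ⊕ b t) , vgerm-⊕ ge g ,
        Ev-map₂ (λ { t h ¬pb {G} {s₀} (b≢0 ∷ nz) m →
          subst (IsMin (∇* (vectorsAt (b ∷ bs) t) G)) (⊕-assoc s₀ (e t) (b t)) (min-∇⁻ (opposite ¬pb b≢0) (h nz m)) }) ev n
        where
        opposite : ∀ {v} → ¬ Pos v → v ≢ 0ᵛ → Pos (0ᵛ ⊖ v)
        opposite {v} ¬p v≢0 with total v
        ... | inj₁ p = ⊥-elim (¬p p)
        ... | inj₂ (inj₁ e) = ⊥-elim (v≢0 e)
        ... | inj₂ (inj₂ p) = p

      displacement : ∀ {bs} → All VGerm bs → Displacement bs
      displacement [] = (λ _ → 0ᵛ) , vgerm-const 0ᵛ , Ev-always λ t {G} {s₀} _ → subst (IsMin G) (sym (⊕-identityʳ s₀))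
      displacement (g ∷ gs) = displacement-cons g (settled-Pos g) (displacement gs)

      module _ {L : VFormal d} (gL : FGerm L) where

        -- Minimality is tested only against the exponents listed in `L`. Such a finite conjunction
        -- is settled.
        IsMinExponent : ℕ → Vec ℚ d → Set
        IsMinExponent t r = coeff (at L t) r ≢ 0ℚ × All (λ (_ , q) → coeff (at L t) q ≢ 0ℚ → q ≡ r ⊎ Pos (q ⊖ r)) (at L t)

        minExponent : ∀ {t r} → IsMinExponent t r → IsMin (coeff (at L t)) r
        minExponent {t} {r} (ne , least) = ne , λ s nz → find s nz least (coeff≢0⇒exponent nz)
          where
          find : ∀ s {M} → coeff (at L t) s ≢ 0ℚ → All (λ (_ , q) → coeff (at L t) q ≢ 0ℚ → q ≡ r ⊎ Pos (q ⊖ r)) M →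
                 Any (λ (_ , q) → q ≡ s) M → s ≡ r ⊎ Pos (s ⊖ r)
          find s nz (a ∷ _) (here refl) = a nz
          find s nz (_ ∷ as) (there m) = find s nz as m

        minExponent⁻ : ∀ {t r} → IsMin (coeff (at L t)) r → IsMinExponent t r
        minExponent⁻ {t} (ne , least) = ne , All.universal (λ (_ , q) → least q) (at L t)

        settled-IsMinExponent : ∀ {r} → VGerm r → Settled (λ t → IsMinExponent t (r t))
        settled-IsMinExponent g = settled-× (settled-¬ (settled-≡0 (germ-coeff gL g)))
          (settled-All-at (All.map (λ {(_ , q)} gq → settled-→ (settled-¬ (settled-≡0 (germ-coeff {s = q} gL gq)))
            (settled-⊎ (settled-≡ᵛ gq g) (settled-Pos (vgerm-⊖ gq g)))) gL))

        Selection : VFormal d → Set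
        Selection M = (∃[ q ] VGerm q × Ev (λ t → IsMinExponent t (q t))) ⊎
                      Ev (λ t → All (λ (_ , q) → ¬ IsMinExponent t (q t)) M)

        select-cons : ∀ {α q M} → VGerm q → Settled (λ t → IsMinExponent t (q t)) → Selection M → Selection ((α , q) ∷ M)
        select-cons {q = q} g (inj₁ p) _ = inj₁ (q , g , p)
        select-cons g (inj₂ _) (inj₁ found) = inj₁ found
        select-cons g (inj₂ n) (inj₂ ns) = inj₂ (Ev-map₂ (λ _ → _∷_) n ns)

        select : ∀ {M} → FGerm M → Selection M
        select [] = inj₂ (Ev-always λ _ → [])
        select (g ∷ gs) = select-cons g (settled-IsMinExponent g) (select gs)

        Location : Vectors d → Set
        Location bs = ∃[ v ] VGerm v × Ev (λ t → ∀ {G s₀} →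
          All (_≢ 0ᵛ) (vectorsAt bs t) → ∇* (vectorsAt bs t) G ≐ at L t → IsMin G s₀ → s₀ ≡ v t)

        locate-from : ∀ {bs} → Displacement bs → Selection L → Location bs
        locate-from (e , ge , ev) (inj₁ (q , gq , evq)) = (λ t → q t ⊖ e t) , vgerm-⊖ gq ge ,
          Ev-map₂ (λ t h mq {G} {s₀} nz eq m → trans (sym (⊕-⊖-cancel s₀ (e t)))
            (cong (_⊖ e t) (min-unique (min-cong eq (h nz m)) (minExponent {t} {q t} mq)))) ev evq
        -- A least term of `G` would make some exponent of the numerator minimal. As none is, no `G`
        -- of the required kind has a least term, and `0ᵛ` is an arbitrary value.
        locate-from (e , ge , ev) (inj₂ none) = (λ _ → 0ᵛ) , vgerm-const 0ᵛ , Ev-map₂ (λ t h none {G} {s₀} nz eq m →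
            absurd t (s₀ ⊕ e t) none (min-cong eq (h nz m))) ev none
          where
          contradict : ∀ {t r M} → All (λ (_ , q) → ¬ IsMinExponent t (q t)) M → IsMinExponent t r → Any (λ (_ , q) → q ≡ r) (at M t) → ⊥
          contradict {M = _ ∷ _} (a ∷ _) m (here refl) = a m
          contradict {M = _ ∷ _} (_ ∷ as) m (there i) = contradict as m i
          absurd : ∀ {A : Set} t r → All (λ (_ , q) → ¬ IsMinExponent t (q t)) L → IsMin (coeff (at L t)) r → A
          absurd t r none m = ⊥-elim (contradict none (minExponent⁻ {t} {r} m) (coeff≢0⇒exponent {L = at L t} {r} (proj₁ m)))

        locate : ∀ {bs} → All VGerm bs → Location bs
        locate gbs = locate-from (displacement gbs) (select gL)

-- v is positive when dot c v < 0, ties being broken lexicographically.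

DescendingPos : ∀ {d} → Vec ℚ d → Vec ℚ d → Set
DescendingPos c v = LP (- dot c v ∷ v)

descending-cone : ∀ {d} (c : Vec ℚ d) → IsCone (DescendingPos c)
descending-cone c = record { sum = sum ; irrefl = irrefl ; total = total }
  where
  open IsLinear (dot-linear c)
  dot-0ᵛ : dot c 0ᵛ ≡ 0ℚ
  dot-0ᵛ = trans (cong (dot c) (sym (⊖-self 0ᵛ))) (trans (homo-⊖ 0ᵛ 0ᵛ) (ℚₚ.+-inverseʳ (dot c 0ᵛ)))
  sum : ∀ {v w} → DescendingPos c v → DescendingPos c w → DescendingPos c (v ⊕ w)
  sum {v} {w} p q = subst (λ x → LP (x ∷ (v ⊕ w))) (trans (lemma (dot c v) (dot c w)) (cong -_ (sym (homo-⊕ v w)))) (LP-⊕ {v = _ ∷ v} {_ ∷ w} p q)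
    where
    lemma : ∀ x y → - x + - y ≡ - (x + y)
    lemma = solve-∀ ℚring
  irrefl : ¬ DescendingPos c 0ᵛ
  irrefl p = LP-irrefl (subst (λ x → LP (- x ∷ 0ᵛ)) dot-0ᵛ p)
  total : ∀ v → DescendingPos c v ⊎ v ≡ 0ᵛ ⊎ DescendingPos c (0ᵛ ⊖ v)
  total v with LP-cmp (- dot c v ∷ v)
  ... | inj₁ p = inj₁ p
  ... | inj₂ (inj₁ e) = inj₂ (inj₁ (proj₂ (Vecₚ.∷-injective e)))
  ... | inj₂ (inj₂ p) = inj₂ (inj₂ (subst (λ x → LP (x ∷ (0ᵛ ⊖ v))) (trans (lemma (dot c v)) (cong -_ (sym (trans (homo-⊖ 0ᵛ v) (cong (_- dot c v) dot-0ᵛ))))) p))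
    where
    lemma : ∀ x → 0ℚ - - x ≡ - (0ℚ - x)
    lemma = solve-∀ ℚring

settled-DescendingPos : ∀ {d} (c : Vec ℚ d) {v : ℕ → Vec ℚ d} → VGerm v → Settled (λ t → DescendingPos c (v t))
settled-DescendingPos c g = settled-LP (vgerm λ { zero → germ-neg (germ-dot c g) ; (suc i) → coordinate g i })

-- From Laurent series with integer exponents to series indexed by ℚᵈ.

ι : ∀ {d} → Vec ℤ d → Vec ℚ d
ι = Vec.map fromℤ

embed : ∀ {d} → Vec ℕ d → Vec ℚ d
embed = Vec.map fromℕ

ι-injective : ∀ {d} {v w : Vec ℤ d} → ι v ≡ ι w → v ≡ w
ι-injective {v = []} {[]} e = refl
ι-injective {v = x ∷ v} {y ∷ w} e = cong₂ _∷_ (fromℤ-injective {x} {y} (proj₁ (Vecₚ.∷-injective e))) (ι-injective (proj₂ (Vecₚ.∷-injective e)))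

embed-injective : ∀ {d} {v w : Vec ℕ d} → embed v ≡ embed w → v ≡ w
embed-injective {v = []} {[]} e = refl
embed-injective {v = x ∷ v} {y ∷ w} e = cong₂ _∷_ (fromℕ-injective {x} {y} (proj₁ (Vecₚ.∷-injective e))) (embed-injective (proj₂ (Vecₚ.∷-injective e)))

ι-map-+ : ∀ {d} (y : Vec ℕ d) → ι (Vec.map ℤ.+_ y) ≡ embed y
ι-map-+ [] = refl
ι-map-+ (x ∷ y) = cong (fromℕ x ∷_) (ι-map-+ y)

ι-- : ∀ {d} (v w : Vec ℤ d) → ι (zipWith ℤ._-_ v w) ≡ ι v ⊖ ι w
ι-- [] [] = refl
ι-- (x ∷ v) (y ∷ w) = cong₂ _∷_ (fromℤ-- x y) (ι-- v w)

ι-+ : ∀ {d} (v w : Vec ℤ d) → ι (zipWith ℤ._+_ v w) ≡ ι v ⊕ ι w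
ι-+ [] [] = refl
ι-+ (x ∷ v) (y ∷ w) = cong₂ _∷_ (fromℤ-+ x y) (ι-+ v w)

Integral : ∀ {d} → Vec ℚ d → Set
Integral k = ∃[ z ] ι z ≡ k

integral-embed : ∀ {d} (y : Vec ℕ d) → Integral (embed y)
integral-embed y = Vec.map ℤ.+_ y , ι-map-+ y

integral-⊕ : ∀ {d} {v w : Vec ℚ d} → Integral v → Integral w → Integral (v ⊕ w)
integral-⊕ (y , refl) (z , refl) = zipWith ℤ._+_ y z , ι-+ y z

LexPositive⇒LP : ∀ {d} {b : Vec ℤ d} → LexPositive b → LP (ι b)
LexPositive⇒LP {b = x ∷ b} (zero , 0<x , _) = inj₁ (fromℤ-mono-< {ℤ.+ 0} {x} 0<x)
LexPositive⇒LP {b = x ∷ b} (suc i , 0<bᵢ , z) = inj₂ (cong fromℤ (z zero (ℕ.s≤s ℕ.z≤n)) ,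
  LexPositive⇒LP (i , 0<bᵢ , λ j j<i → z (suc j) (ℕ.s≤s j<i)))

integral-dot : ∀ {d} (c : Vec ℤ d) {v} → Integral v → ∃[ z ] dot (ι c) v ≡ fromℤ z
integral-dot c (w , refl) = go c w
  where
  go : ∀ {d} (c v : Vec ℤ d) → ∃[ z ] dot (ι c) (ι v) ≡ fromℤ z
  go [] [] = ℤ.+ 0 , refl
  go (x ∷ c) (y ∷ v) with go c v
  ... | z , e = x ℤ.* y ℤ.+ z , trans (cong₂ _+_ (sym (fromℤ-* x y)) e) (sym (fromℤ-+ (x ℤ.* y) z))

dot-embed : ∀ {d} (c : Vec ℤ d) (y : Vec ℕ d) → dot (ι c) (embed y) ≡ fromℤ (c · y)
dot-embed [] [] = refl
dot-embed (x ∷ c) (n ∷ y) = trans (cong₂ _+_ (sym (fromℤ-* x (ℤ.+ n))) (dot-embed c y)) (sym (fromℤ-+ (x ℤ.* ℤ.+ n) (c · y)))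

sum-vanish : ∀ {f : ℕ → ℚ} N M → (∀ n → N ℕ.≤ n → f n ≡ 0ℚ) → N ℕ.≤ M →
             ℚSum.sum {M} (λ i → f (toℕ i)) ≡ ℚSum.sum {N} (λ i → f (toℕ i))
sum-vanish zero zero z _ = refl
sum-vanish {f} zero (suc M) z _ = cong₂ _+_ (z 0 ℕ.z≤n) (sum-vanish {f ∘ suc} 0 M (λ n _ → z (suc n) ℕ.z≤n) ℕ.z≤n)
sum-vanish {f} (suc N) (suc M) z (ℕ.s≤s N≤M) = cong (f 0 +_) (sum-vanish {f ∘ suc} N M (λ n le → z (suc n) (ℕ.s≤s le)) N≤M)

finiteSum-unfold : ∀ {f v w} → IsFiniteSum f v → IsFiniteSum (f ∘ suc) w → v ≡ f 0 + w
finiteSum-unfold {f} (N , z , refl) (N′ , z′ , refl) = trans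
  (sym (sum-vanish {f} N (suc (N ℕ.⊔ N′)) z (ℕₚ.≤-trans (ℕₚ.m≤m⊔n N N′) (ℕₚ.n≤1+n _))))
  (cong (f 0 +_) (sum-vanish {f ∘ suc} N′ (N ℕ.⊔ N′) z′ (ℕₚ.m≤n⊔m N N′)))

-- Without its first term, the geometric sum at `s` is the geometric sum at `s − b`, so
-- `G(s) = H(s) + G(s − b)`.
geometric-difference : ∀ {d} {H G : LaurentSeries d} {b} → IsGeometricMultiple H b G →
                       ∀ s → G s - G (zipWith ℤ._-_ s b) ≡ H s
geometric-difference {H = H} {G} {b} geo s = trans (cong (_- G (zipWith ℤ._-_ s b)) (finiteSum-unfold (geo s)
    (subst-sum (λ n → cong H (shifted n s b)) (geo (zipWith ℤ._-_ s b))))) (trans (lemma _ _) (cong H (unshifted s b)))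
  where
  lemma : ∀ x y → x + y - y ≡ x
  lemma = solve-∀ ℚring
  subst-sum : ∀ {f g v} → (∀ n → f n ≡ g n) → IsFiniteSum f v → IsFiniteSum g v
  subst-sum e (N , z , p) = N , (λ n le → trans (sym (e n)) (z n le)) , trans p (ℚSum.sum-cong-≗ {N} λ i → e (toℕ i))
  zlemma : ∀ x y n → (x ℤ.- y) ℤ.- n ℤ.* y ≡ x ℤ.- (ℤ.1ℤ ℤ.+ n) ℤ.* y
  zlemma = ℤSolver.solve-∀
  zlemma′ : ∀ x y → x ℤ.- ℤ.0ℤ ℤ.* y ≡ x
  zlemma′ = ℤSolver.solve-∀
  shifted : ∀ {d} n (s b : Vec ℤ d) → zipWith ℤ._-_ (zipWith ℤ._-_ s b) (Vec.map (ℤ.+ n ℤ.*_) b) ≡ zipWith ℤ._-_ s (Vec.map (ℤ.+ suc n ℤ.*_) b)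
  shifted n [] [] = refl
  shifted n (x ∷ s) (y ∷ b) = cong₂ _∷_ (zlemma x y (ℤ.+ n)) (shifted n s b)
  unshifted : ∀ {d} (s b : Vec ℤ d) → zipWith ℤ._-_ s (Vec.map (ℤ.+ 0 ℤ.*_) b) ≡ s
  unshifted [] [] = refl
  unshifted (x ∷ s) (y ∷ b) = cong₂ _∷_ (zlemma′ x y) (unshifted s b)

-- Extension by zero off ℤᵈ. Since the vectors `b` are integral, difference operators respect it.
record Extends {d} (G̃ : Series d) (G : LaurentSeries d) : Set where
  field
    on-ℤ : ∀ s → G̃ (ι s) ≡ G s
    off-ℤ : ∀ k → ¬ Integral k → G̃ k ≡ 0ℚ

open Extends

extends-∇ : ∀ {d} {G̃ : Series d} {G H : LaurentSeries d} {b} → Extends G̃ G →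
            (∀ s → G s - G (zipWith ℤ._-_ s b) ≡ H s) → Extends (∇ (ι b) G̃) H
extends-∇ {G̃ = G̃} {b = b} ext e = record
  { on-ℤ = λ s → trans (cong₂ _-_ (on-ℤ ext s) (trans (cong G̃ (sym (ι-- s b))) (on-ℤ ext (zipWith ℤ._-_ s b)))) (e s)
  ; off-ℤ = λ k ¬int → cong₂ _-_ (off-ℤ ext k ¬int) (off-ℤ ext (k ⊖ ι b) λ int →
      ¬int (subst Integral (⊖-⊕-cancel k (ι b)) (integral-⊕ int (b , refl))))
  }

extends-cong : ∀ {d} {G̃ H̃ : Series d} {G H : LaurentSeries d} → G̃ ≗ H̃ → (∀ s → G s ≡ H s) → Extends G̃ G → Extends H̃ H
extends-cong e e′ ext = record
  { on-ℤ = λ s → trans (sym (e (ι s))) (trans (on-ℤ ext s) (e′ s))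
  ; off-ℤ = λ k ¬int → trans (sym (e k)) (off-ℤ ext k ¬int)
  }

-- The expansion divides by the head factor last. That factor is undone first and then commuted past
-- the others to match the order in `∇*`.
extends-expansion : ∀ {d} k {F : LaurentSeries d} {b : Vector (Vec ℤ d) k} {G G̃} → IsExpansion k F b G → Extends G̃ G →
                    Extends (∇* (List.tabulate (λ j → ι (b j))) G̃) F
extends-expansion zero e ext = extends-cong (λ _ → refl) e ext
extends-expansion (suc k) {b = b} {G̃ = G̃} (H , expansion , geo) ext = extends-cong
  (∇*-∇ (List.tabulate (λ j → ι (b (suc j)))) (ι (b zero)) G̃) (λ _ → refl)
  (extends-expansion k expansion (extends-∇ {b = b zero} ext (geometric-difference geo)))

extends-laurentPolynomial : ∀ {d n} (α : Vector ℚ n) (q : Vector (Vec ℤ d) n) →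
                            Extends (coeff (List.tabulate (λ j → α j , ι (q j)))) (laurentPolynomial α q)
extends-laurentPolynomial {n = zero} α q = record { on-ℤ = λ _ → refl ; off-ℤ = λ _ _ → refl }
extends-laurentPolynomial {n = suc n} α q = record
  { on-ℤ = λ s → cong₂ (λ x y → α zero * x + y) (δ-monomial (q zero) s) (on-ℤ rest s)
  ; off-ℤ = λ k ¬int → trans (cong₂ (λ x y → α zero * x + y) (δ-≢ {s = k} {ι (q zero)} (λ e → ¬int (q zero , e))) (off-ℤ rest k ¬int))
                         (trans (ℚₚ.+-identityʳ (α zero * 0ℚ)) (ℚₚ.*-zeroʳ (α zero)))
  }
  where
  rest = extends-laurentPolynomial (α ∘ suc) (q ∘ suc)
  δ-monomial : ∀ {d} (q s : Vec ℤ d) → δ (ι s) (ι q) ≡ monomial q s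
  δ-monomial q s with Vecₚ.≡-dec ℤₚ._≟_ q s
  ... | yes e = δ-≡ (cong ι e)
  ... | no ne = δ-≢ (ne ∘ ι-injective)

evalᵛ : ∀ {d} → Vec Poly d → ℕ → Vec ℚ d
evalᵛ p t = Vec.map (λ q → eval q (fromℕ t)) p

vgerm-evalᵛ : ∀ {d} (p : Vec Poly d) → VGerm (evalᵛ p)
vgerm-evalᵛ p = vgerm λ i → germ-≗ (λ t → sym (Vecₚ.lookup-map i (λ q → eval q (fromℕ t)) p)) (germ-poly (lookup p i))

takesValue⇒evalᵛ : ∀ {d} {p : Vec Poly d} {t v} → TakesValue p t v → evalᵛ p t ≡ ι v
takesValue⇒evalᵛ {p = p} {t} {v} tv = lookup-ext λ i →
  trans (Vecₚ.lookup-map i (λ q → eval q (fromℕ t)) p) (trans (tv i) (sym (Vecₚ.lookup-map i fromℤ v)))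

-- Indicator series and representations of families.

module _ (em : ExcludedMiddle 0ℓ) where

  χ : ∀ {d} → Subset d → Series d
  χ A k = if does (em {∃[ y ] A y × embed y ≡ k}) then 1ℚ else 0ℚ

  module _ {d} {A : Subset d} where

    χ-∈ : ∀ {k} → (∃[ y ] A y × embed y ≡ k) → χ A k ≡ 1ℚ
    χ-∈ {k} m with em {∃[ y ] A y × embed y ≡ k}
    ... | yes _ = refl
    ... | no ¬m = ⊥-elim (¬m m)

    χ-∉ : ∀ {k} → ¬ (∃[ y ] A y × embed y ≡ k) → χ A k ≡ 0ℚ
    χ-∉ {k} ¬m with em {∃[ y ] A y × embed y ≡ k}
    ... | yes m = ⊥-elim (¬m m)
    ... | no _ = refl

    χ≢0 : ∀ {k} → χ A k ≢ 0ℚ → ∃[ y ] A y × embed y ≡ k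
    χ≢0 {k} ne with em {∃[ y ] A y × embed y ≡ k}
    ... | yes m = m
    ... | no _ = ⊥-elim (ne refl)

    χ-∈-≢0 : ∀ {y} → A y → χ A (embed y) ≢ 0ℚ
    χ-∈-≢0 {y} a e = pos≢0 0<1 (trans (sym (χ-∈ (y , a , refl))) e)

    χ-nonneg : ∀ k → 0ℚ ≤ χ A k
    χ-nonneg k with em {∃[ y ] A y × embed y ≡ k}
    ... | yes _ = ℚₚ.<⇒≤ 0<1
    ... | no _ = ℚₚ.≤-refl

    -- A lexicographically positive `b` has a positive coordinate. Repeated subtraction makes this
    -- coordinate of the point negative, and the point leaves ℕᵈ.
    tame-χ : Tame (χ A)
    tame-χ = tame λ {b} lp s → leaves b s (LP⇒positive-coordinate lp)
      where
      leaves : ∀ b s → (∃[ i ] 0ℚ < lookup b i) → Ev (λ n → χ A (back n b s) ≡ 0ℚ)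
      leaves b s (i , 0<bᵢ) = Ev-map (λ n le → χ-∉ (λ (y , _ , e) → outside n y le e)) (archimedean-* 0<bᵢ (1ℚ + lookup s i))
        where
        outside : ∀ n y → 1ℚ + lookup s i ≤ fromℕ n * lookup b i → embed y ≢ back n b s
        outside n y le e = ℚₚ.<-irrefl refl (ℚₚ.<-≤-trans 0<1 (diff-nonneg⁻ (subst (0ℚ ≤_)
          (lemma (fromℕ n * lookup b i) (lookup s i)) (+-nonneg (diff-nonneg le) (subst (0ℚ ≤_)
            (trans (sym (Vecₚ.lookup-map i fromℕ y)) (trans (cong (λ v → lookup v i) e) (back-linear (lookup-linear i) n b s)))
            (0≤fromℕ (lookup y i)))))))
          where
          lemma : ∀ m x → (m - (1ℚ + x)) + (x - m) ≡ 0ℚ - 1ℚ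
          lemma = solve-∀ ℚring

    extends-χ : ∀ {F} → IsGeneratingFunction A F → Extends (χ A) F
    extends-χ {F} (inside , outside) = record { on-ℤ = on ; off-ℤ = λ k ¬int → χ-∉ λ { (y , _ , refl) → ¬int (integral-embed y) } }
      where
      on : ∀ s → χ A (ι s) ≡ F s
      on s = by-membership em
        where
        by-membership : Dec (∃[ y ] A y × embed y ≡ ι s) → χ A (ι s) ≡ F s
        by-membership (yes (y , a , e)) = trans (χ-∈ (y , a , e)) (trans (sym (inside y a)) (cong F (ι-injective (trans (ι-map-+ y) e))))
        by-membership (no ¬m) = trans (χ-∉ ¬m) (sym (outside s λ y a e → ¬m (y , a , trans (sym (ι-map-+ y)) (cong ι e))))

  record RepresentedBy {d} (A : Subset d) (L : Formal d) (bs : List (Vec ℚ d)) : Set where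
    field
      exponents-integral : All (λ (_ , q) → Integral q) L
      denominators : All (λ b → Integral b × LP b) bs
      identity : ∇* bs (χ A) ≐ L

  -- Exponents are germs rather than polynomials so that the structure survives the removal of
  -- points whose coordinates are known only as rational functions of `t`.
  record Representation {d} (S : Family d) (Class : ℕ → Set) : Set where
    field
      numerator : VFormal d
      denominator : Vectors d
      numerator-germ : FGerm numerator
      denominator-germ : All VGerm denominator
      represented : Ev (λ t → Class t → RepresentedBy (S t) (at numerator t) (vectorsAt denominator t))

  property4⇒representation : ∀ {d} {S : Family d} ((m , _) : Property4 S) → ∀ i → Representation S (λ t → t mod suc m ≡ i)
  property4⇒representation {d} {S} (m , p4) i with p4 i
  ... | n , k , α , q , b , T , rep = record
    { numerator = List.tabulate (λ j → α j , evalᵛ (q j))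
    ; denominator = List.tabulate (λ j → evalᵛ (b j))
    ; numerator-germ = Allₚ.tabulate⁺ λ j → vgerm-evalᵛ (q j)
    ; denominator-germ = Allₚ.tabulate⁺ λ j → vgerm-evalᵛ (b j)
    ; represented = T , λ t T≤t class → at-time t (rep t T≤t class)
    }
    where
    at-time : ∀ t → RationalGeneratingFunctionAt (S t) t α q b →
              RepresentedBy (S t) (at (List.tabulate (λ j → α j , evalᵛ (q j))) t) (vectorsAt (List.tabulate (λ j → evalᵛ (b j))) t)
    at-time t (qₜ , bₜ , qv , bv , lex , F , gf , expansion) = subst₂ (RepresentedBy (S t))
        (sym (trans (Listₚ.map-tabulate _ _) (Listₚ.tabulate-cong λ j → cong (α j ,_) (takesValue⇒evalᵛ {p = q j} {t} {qₜ j} (qv j)))))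
        (sym (trans (Listₚ.map-tabulate _ _) (Listₚ.tabulate-cong λ j → takesValue⇒evalᵛ {p = b j} {t} {bₜ j} (bv j)))) (record
      { exponents-integral = Allₚ.tabulate⁺ λ j → qₜ j , refl
      ; denominators = Allₚ.tabulate⁺ λ j → (bₜ j , refl) , LexPositive⇒LP (lex j)
      ; identity = identity
      })
      where
      numeratorExtends = extends-laurentPolynomial α qₜ
      seriesExtends = extends-expansion k expansion (extends-χ gf)
      identity : ∇* (List.tabulate (λ j → ι (bₜ j))) (χ (S t)) ≐ List.tabulate (λ j → α j , ι (qₜ j))
      identity s with em {Integral s}
      ... | yes (z , refl) = trans (on-ℤ seriesExtends z) (sym (on-ℤ numeratorExtends z))
      ... | no ¬int = trans (off-ℤ seriesExtends s ¬int) (sym (off-ℤ numeratorExtends s ¬int))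

-- Existence and location of a maximiser of a linear functional.

module _ {d : ℕ} {u : Vec ℚ d → ℚ} (lin : IsLinear u) (germ-u : ∀ {v : ℕ → Vec ℚ d} → VGerm v → Germ (λ t → u (v t)))
         (Q : Vec ℚ d → Set) where

  -- The split is made once, according to the settled sign of `u (b t)`. The predicate `Q` travels
  -- along under a premise because it is available only for `t` in the class considered.
  record SignPartition (bs : Vectors d) : Set where
    field
      nonpositive positive : Vectors d
      nonpositive-germ : All VGerm nonpositive
      positive-germ : All VGerm positive
      signs : Ev (λ t → All Q (vectorsAt bs t) →
        All (λ b → Q b × u b ≤ 0ℚ) (vectorsAt nonpositive t) × All (λ b → Q b × 0ℚ < u b) (vectorsAt positive t))
      factors : ∀ t G → ∇* (vectorsAt positive t) (∇* (vectorsAt nonpositive t) G) ≗ ∇* (vectorsAt bs t) G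

  partition-cons : ∀ {b bs} → VGerm b → Settled (λ t → 0ℚ < u (b t)) → SignPartition bs → SignPartition (b ∷ bs)
  partition-cons {b} g (inj₁ pos) P = record
    { nonpositive = nonpositive ; positive = b ∷ positive
    ; nonpositive-germ = nonpositive-germ ; positive-germ = g ∷ positive-germ
    ; signs = Ev-map₂ (λ { t p h (q ∷ qs) → proj₁ (h qs) , (q , p) ∷ proj₂ (h qs) }) pos signs
    ; factors = λ t G → ∇-cong (b t) (factors t G)
    }
    where open SignPartition P
  partition-cons {b} g (inj₂ nonpos) P = record
    { nonpositive = b ∷ nonpositive ; positive = positive
    ; nonpositive-germ = g ∷ nonpositive-germ ; positive-germ = positive-germ
    ; signs = Ev-map₂ (λ { t n h (q ∷ qs) → (q , ℚₚ.≮⇒≥ n) ∷ proj₁ (h qs) , proj₂ (h qs) }) nonpos signs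
    ; factors = λ t G s → trans (∇*-∇ (vectorsAt positive t) (b t) (∇* (vectorsAt nonpositive t) G) s)
                                (∇-cong (b t) (factors t G) s)
    }
    where open SignPartition P

  partition : ∀ {bs} → All VGerm bs → SignPartition bs
  partition [] = record
    { nonpositive = [] ; positive = [] ; nonpositive-germ = [] ; positive-germ = []
    ; signs = Ev-always λ _ _ → [] , [] ; factors = λ _ _ _ → refl }
  partition (g ∷ gs) = partition-cons g (settled-pos (germ-u g)) (partition gs)

-- The level is minus the sum of the absolute values of `c` on the exponents: a lower bound from
-- which each value differs by a natural number.
graded : ∀ {d} (c : Vec ℤ d) {L : Formal d} → All (λ (_ , q) → Integral q) L → ∃[ u₀ ] Graded (dot-linear (ι c)) u₀ L
graded c {L} ints = - fromℕ (proj₁ (go ints)) , proj₂ (go ints)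
  where
  absolute : ∀ z → ∃[ n ] fromℤ z ≡ - fromℕ ℤ.∣ z ∣ + fromℕ n
  absolute (ℤ.+ k) = k ℕ.+ k , trans (lemma (fromℕ k)) (cong (- fromℕ k +_) (sym (fromℕ-+ k k)))
    where
    lemma : ∀ x → x ≡ - x + (x + x)
    lemma = solve-∀ ℚring
  absolute ℤ.-[1+ k ] = 0 , trans (fromℤ-neg (ℤ.+ suc k)) (sym (ℚₚ.+-identityʳ (- fromℕ (suc k))))
  lemma : ∀ N z n → - z + n ≡ - (N + z) + (N + n)
  lemma = solve-∀ ℚring
  lemma′ : ∀ N z m → - N + m ≡ - (N + z) + (m + z)
  lemma′ = solve-∀ ℚring
  extend : ∀ {α q L} N z → (∃[ n ] fromℤ z ≡ - fromℕ ℤ.∣ z ∣ + fromℕ n) → dot (ι c) q ≡ fromℤ z →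
           Graded (dot-linear (ι c)) (- fromℕ N) L → Graded (dot-linear (ι c)) (- fromℕ (N ℕ.+ ℤ.∣ z ∣)) ((α , q) ∷ L)
  extend N z (n , e′) e gr =
    (N ℕ.+ n , trans e (trans e′ (trans (lemma (fromℕ N) (fromℕ ℤ.∣ z ∣) (fromℕ n))
      (sym (cong₂ (λ x y → - x + y) (fromℕ-+ N ℤ.∣ z ∣) (fromℕ-+ N n)))))) ∷
    All.map (λ (m , e) → m ℕ.+ ℤ.∣ z ∣ , trans e (trans (lemma′ (fromℕ N) (fromℕ ℤ.∣ z ∣) (fromℕ m))
      (sym (cong₂ (λ x y → - x + y) (fromℕ-+ N ℤ.∣ z ∣) (fromℕ-+ m ℤ.∣ z ∣))))) gr
  go : ∀ {L : Formal _} → All (λ (_ , q) → Integral q) L → ∃[ N ] Graded (dot-linear (ι c)) (- fromℕ N) L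
  go [] = 0 , []
  go (int ∷ ints) = let z , e = integral-dot c int in
    proj₁ (go ints) ℕ.+ ℤ.∣ z ∣ , extend (proj₁ (go ints)) z (absolute z) e (proj₂ (go ints))

-- Stated for vectors of any length, so that maximisers and cardinalities (as vectors of length one)
-- pass through the same construction `choose`.
Selectable : ∀ {e} → (ℕ → Vec ℕ e → Set) → (ℕ → Set) → Set
Selectable Attain Class =
  Ev (λ t → Class t → ¬ (∃[ y ] Attain t y)) ⊎
  (∃[ v ] VGerm v × Ev (λ t → Class t → ∃[ y ] Attain t y × embed y ≡ v t))

module _ (em : ExcludedMiddle 0ℓ) where

  least : ∀ {P : ℕ → Set} n → P n → ∃[ m ] P m × (∀ k → k ℕ.< m → ¬ P k)
  least {P} zero p = 0 , p , λ _ ()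
  least {P} (suc n) p with em {P 0}
  ... | yes p₀ = 0 , p₀ , λ _ ()
  ... | no ¬p₀ with least {P ∘ suc} n p
  ...   | m , pm , below = suc m , pm , λ { zero _ → ¬p₀ ; (suc k) (ℕ.s≤s k<m) → below k k<m }

  lexMinimum : ∀ {d} (A : Vec ℕ d → Set) {y} → A y → ∃[ x ] A x × (∀ z → A z → z ≡ x ⊎ LP (embed z ⊖ embed x))
  lexMinimum {zero} A {[]} a = [] , a , λ { [] _ → inj₁ refl }
  lexMinimum {suc d} A {n ∷ y} a with least {λ n → ∃[ y ] A (n ∷ y)} n (y , a)
  ... | m , (w , b) , below with lexMinimum (λ y → A (m ∷ y)) b
  ...   | x , ax , minimal = (m ∷ x) , ax , compare
    where
    same-head : ∀ z → z ≡ x ⊎ LP (embed z ⊖ embed x) → m ∷ z ≡ m ∷ x ⊎ LP (embed (m ∷ z) ⊖ embed (m ∷ x))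
    same-head z = Sum.map (cong (m ∷_)) λ p → inj₂ (ℚₚ.+-inverseʳ (fromℕ m) , p)
    by-head : ∀ k z → A (k ∷ z) → Tri (k ℕ.< m) (k ≡ m) (m ℕ.< k) → k ∷ z ≡ m ∷ x ⊎ LP (embed (k ∷ z) ⊖ embed (m ∷ x))
    by-head k z az (tri< k<m _ _) = ⊥-elim (below k k<m (z , az))
    by-head k z az (tri> _ _ m<k) = inj₂ (inj₁ (diff-pos (fromℤ-mono-< {ℤ.+ m} {ℤ.+ k} (ℤ.+<+ m<k))))
    by-head k z az (tri≈ _ refl _) = same-head z (minimal z az)
    compare : ∀ z → A z → z ≡ m ∷ x ⊎ LP (embed z ⊖ embed (m ∷ x))
    compare (k ∷ z) az = by-head k z az (ℕₚ.<-cmp k m)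

  module _ {d : ℕ} (c : Vec ℤ d) where

    private
      cℚ : Vec ℚ d
      cℚ = ι c
      lin : IsLinear (dot cℚ)
      lin = dot-linear cℚ
      open IsLinear lin
      cone : IsCone (DescendingPos cℚ)
      cone = descending-cone cℚ

    -- The order breaks ties lexicographically, so the least point is the lexicographically least
    -- maximiser, which exists because ℕ is well-ordered.
    maximum⇒min : ∀ {A} → MaximumExists c A → ∃[ y ] AttainsMaximum c A y × IsMin cone (χ em A) (embed y)
    maximum⇒min {A} (x , ax , maximal) = from (lexMinimum (λ y → A y × c · y ≡ c · x) {x} (ax , refl))
      where
      from : (∃[ y ] (A y × c · y ≡ c · x) × (∀ z → (A z × c · z ≡ c · x) → z ≡ y ⊎ LP (embed z ⊖ embed y))) →
             ∃[ y ] AttainsMaximum c A y × IsMin cone (χ em A) (embed y)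
      from (y , (ay , cy≡cx) , minimal) = y , (ay , λ z az → subst (λ n → c · z ℤ.≤ n) (sym cy≡cx) (maximal z az)) ,
          χ-∈-≢0 em ay , λ s ne → compare s (χ≢0 em ne)
        where
        difference : ∀ z → dot cℚ (embed z ⊖ embed y) ≡ fromℤ (c · z) - fromℤ (c · y)
        difference z = trans (homo-⊖ (embed z) (embed y)) (cong₂ _-_ (dot-embed c z) (dot-embed c y))
        by-value : ∀ z → A z → Tri (c · z ℤ.< c · y) (c · z ≡ c · y) (c · y ℤ.< c · z) →
                   embed z ≡ embed y ⊎ DescendingPos cℚ (embed z ⊖ embed y)
        by-value z az (tri> _ _ cy<cz) = ⊥-elim (ℤₚ.<⇒≱ cy<cz (subst (λ n → c · z ℤ.≤ n) (sym cy≡cx) (maximal z az)))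
        by-value z az (tri< cz<cy _ _) = inj₂ (inj₁ (subst (0ℚ <_)
          (trans (minus-swap (fromℤ (c · z)) (fromℤ (c · y))) (cong -_ (sym (difference z)))) (diff-pos (fromℤ-mono-< cz<cy))))
        by-value z az (tri≈ _ cz≡cy _) = Sum.map (cong embed)
          (λ p → inj₂ (cong -_ (trans (difference z) (trans (cong (λ n → fromℤ (c · z) - fromℤ n) (sym cz≡cy)) (ℚₚ.+-inverseʳ (fromℤ (c · z))))) , p))
          (minimal z (az , trans cz≡cy cy≡cx))
        compare : ∀ s → (∃[ z ] A z × embed z ≡ s) → s ≡ embed y ⊎ DescendingPos cℚ (s ⊖ embed y)
        compare s (z , az , refl) = by-value z az (ℤₚ.<-cmp (c · z) (c · y))

    maximum⇒bounded : ∀ {A} → MaximumExists c A → Bounded lin (χ em A)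
    maximum⇒bounded {A} (x , _ , maximal) = bounded (fromℤ (c · x)) λ s lt → χ-∉ em λ { (y , ay , refl) →
      ℚₚ.<-irrefl refl (ℚₚ.<-≤-trans lt (subst (_≤ fromℤ (c · x)) (sym (dot-embed c y)) (fromℤ-mono-≤ (maximal y ay)))) }

    -- With a natural number `N` above the bound, the gaps `N − c · y` are natural numbers; a point
    -- of least gap is a maximiser.
    bounded⇒maximum : ∀ {A} → Satisfiable A → Bounded lin (χ em A) → MaximumExists c A
    bounded⇒maximum {A} (y₀ , ay₀) (bounded B beyond) with archimedean B
    ... | N , B≤ = from (least {Gap} ℤ.∣ ℤ.+ N ℤ.- c · y₀ ∣ (y₀ , ay₀ , gap y₀ ay₀))
      where
      Gap : ℕ → Set
      Gap n = ∃[ y ] A y × c · y ℤ.+ ℤ.+ n ≡ ℤ.+ N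
      below : ∀ y → A y → c · y ℤ.≤ ℤ.+ N
      below y ay = ℤₚ.≮⇒≥ λ N<cy → χ-∈-≢0 em ay (beyond (embed y) (subst (B <_) (sym (dot-embed c y))
        (ℚₚ.≤-<-trans (B≤ N ℕₚ.≤-refl) (fromℤ-mono-< {ℤ.+ N} {c · y} N<cy))))
      gap : ∀ y → A y → c · y ℤ.+ ℤ.+ ℤ.∣ ℤ.+ N ℤ.- c · y ∣ ≡ ℤ.+ N
      gap y ay = trans (cong (λ n → c · y ℤ.+ n) (ℤₚ.0≤i⇒+∣i∣≡i (ℤₚ.i≤j⇒0≤j-i (below y ay)))) (cancel (c · y) (ℤ.+ N))
        where
        cancel : ∀ x n → x ℤ.+ (n ℤ.- x) ≡ n
        cancel = ℤSolver.solve-∀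
      from : (∃[ m ] Gap m × (∀ k → k ℕ.< m → ¬ Gap k)) → MaximumExists c A
      from (m , (y , ay , e) , minimal) = y , ay , λ z az → compare z az
        where
        compare : ∀ z → A z → c · z ℤ.≤ c · y
        compare z az = ℤₚ.≮⇒≥ λ cy<cz → minimal ℤ.∣ ℤ.+ N ℤ.- c · z ∣ (smaller cy<cz) (z , az , gap z az)
          where
          smaller : c · y ℤ.< c · z → ℤ.∣ ℤ.+ N ℤ.- c · z ∣ ℕ.< m
          smaller lt = ℕₚ.≰⇒> λ m≤ → ℤₚ.<-irrefl (trans e (sym (gap z az))) (ℤₚ.+-mono-<-≤ lt (ℤ.+≤+ m≤))

    module _ {A : Subset d} {L bs bs₀ bs₁} (rep : RepresentedBy em A L bs)
             (factors : ∇* bs₁ (∇* bs₀ (χ em A)) ≗ ∇* bs (χ em A))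
             (np : All (λ b → (Integral b × LP b) × dot cℚ b ≤ 0ℚ) bs₀)
             (ps : All (λ b → (Integral b × LP b) × 0ℚ < dot cℚ b) bs₁) where

      open RepresentedBy rep

      bounded⇔flat-numerator : (Bounded lin (χ em A) → Flat lin (List.map (direction lin) bs₁) L) ×
                               (Flat lin (List.map (direction lin) bs₁) L → Bounded lin (χ em A))
      bounded⇔flat-numerator = bounded⇔flat lin {proj₁ (graded c exponents-integral)} {bs₀} {bs₁} (χ-nonneg em) (tame-χ em)
        (All.map (λ ((_ , lp) , le) → lp , le) np) (All.map positive ps) (proj₂ (graded c exponents-integral))
        (λ s → trans (factors s) (identity s))
        where
        positive : ∀ {b} → (Integral b × LP b) × 0ℚ < dot cℚ b → Positive lin b
        positive-integer : ∀ {z} → ℤ.0ℤ ℤ.< z → ∃[ n ] z ≡ ℤ.+ suc n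
        positive-integer {ℤ.+ suc n} _ = n , refl
        positive-integer {ℤ.+ zero} (ℤ.+<+ ())
        positive {b} ((int , lp) , 0<cb) = let z , e = integral-dot c int
                                               n , e′ = positive-integer (fromℤ-cancel-< {ℤ.+ 0} {z} (subst (0ℚ <_) e 0<cb))
                                           in lp , n , trans e (cong fromℤ e′)

      -- A tame series is determined by its numerator, so the indicator series is zero exactly if
      -- the numerator is. It is enough to look at coefficients of listed exponents.
      nonempty⇔numerator≢0 : (Satisfiable A → ¬ All (λ (_ , q) → coeff L q ≡ 0ℚ) L) ×
                             (¬ All (λ (_ , q) → coeff L q ≡ 0ℚ) L → Satisfiable A)
      nonempty⇔numerator≢0 = to , from
        where
        zero-at : ∀ {s M} → All (λ (_ , q) → coeff L q ≡ 0ℚ) M → Any (λ (_ , q) → q ≡ s) M → coeff L s ≡ 0ℚ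
        zero-at (z ∷ _) (here refl) = z
        zero-at (_ ∷ zs) (there i) = zero-at zs i
        to : Satisfiable A → ¬ All (λ (_ , q) → coeff L q ≡ 0ℚ) L
        to (y , ay) zs = χ-∈-≢0 em ay (tame-∇*≡0 (All.map proj₂ denominators) (tame-χ em) vanish (embed y))
          where
          vanish : ∀ s → ∇* bs (χ em A) s ≡ 0ℚ
          vanish s = trans (identity s) (decidable-stable (coeff L s ℚₚ.≟ 0ℚ) λ nz → nz (zero-at zs (coeff≢0⇒exponent nz)))
        from : ¬ All (λ (_ , q) → coeff L q ≡ 0ℚ) L → Satisfiable A
        from nz = decidable-stable em λ empty → nz (All.universal (λ (_ , q) → trans (sym (identity q))
          (∇*-zero bs (λ s → χ-∉ em λ (y , ay , _) → empty (y , ay)) q)) L)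

      -- The empty set is bounded without having a maximum, hence the separate condition that the
      -- numerator is nonzero.
      maximumExists⇔ : (MaximumExists c A → ¬ All (λ (_ , q) → coeff L q ≡ 0ℚ) L × Flat lin (List.map (direction lin) bs₁) L) ×
                       (¬ All (λ (_ , q) → coeff L q ≡ 0ℚ) L × Flat lin (List.map (direction lin) bs₁) L → MaximumExists c A)
      maximumExists⇔ =
        (λ m → proj₁ nonempty⇔numerator≢0 (proj₁ m , proj₁ (proj₂ m)) , proj₁ bounded⇔flat-numerator (maximum⇒bounded m)) ,
        (λ (nz , flat) → bounded⇒maximum (proj₂ nonempty⇔numerator≢0 nz) (proj₂ bounded⇔flat-numerator flat))

  -- The condition `Φ` is a finite combination of statements about germs, so it is settled. Where it
  -- eventually holds, a maximiser exists and the least term of the numerator locates it.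
  selectable-maximum : ∀ {d} {S : Family d} {Class} → Representation em S Class → ∀ c →
                       Selectable (λ t → AttainsMaximum c (S t)) Class
  selectable-maximum {d} {S} {Class} R c = decide settled
    where
    open Representation R
    cℚ : Vec ℚ d
    cℚ = ι c
    lin : IsLinear (dot cℚ)
    lin = dot-linear cℚ
    germ-c : ∀ {v : ℕ → Vec ℚ d} → VGerm v → Germ (λ t → dot cℚ (v t))
    germ-c = germ-dot cℚ
    open SignPartition (partition lin germ-c (λ b → Integral b × LP b) denominator-germ)
    directions : Vectors d
    directions = List.map (λ b t → direction lin (b t)) positive
    directions-germ : All VGerm directions
    directions-germ = Allₚ.map⁺ (All.map (λ g → vgerm-⊙ (germ-inverse (germ-c g)) g) positive-germ)
    directions-at : ∀ t → vectorsAt directions t ≡ List.map (direction lin) (vectorsAt positive t)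
    directions-at t = trans (sym (Listₚ.map-∘ positive)) (Listₚ.map-∘ positive)
    Φ : ℕ → Set
    Φ t = ¬ All (λ (_ , q) → coeff (at numerator t) q ≡ 0ℚ) (at numerator t) × Flat lin (vectorsAt directions t) (at numerator t)
    settled : Settled Φ
    settled = settled-×
      (settled-¬ (settled-All-at (All.map (λ {(_ , q)} g → settled-≡0 (germ-coeff {s = q} numerator-germ g)) numerator-germ)))
      (settled-Flat lin germ-c directions-germ numerator-germ)
    Φ⇔ : ∀ t → RepresentedBy em (S t) (at numerator t) (vectorsAt denominator t) →
         (All (λ b → (Integral b × LP b)) (vectorsAt denominator t) →
           All (λ b → (Integral b × LP b) × dot cℚ b ≤ 0ℚ) (vectorsAt nonpositive t) ×
           All (λ b → (Integral b × LP b) × 0ℚ < dot cℚ b) (vectorsAt positive t)) →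
         (MaximumExists c (S t) → Φ t) × (Φ t → MaximumExists c (S t))
    Φ⇔ t rep sg = subst (λ βs → (MaximumExists c (S t) → Nonzero × Flat lin βs (at numerator t)) ×
                                (Nonzero × Flat lin βs (at numerator t) → MaximumExists c (S t)))
        (sym (directions-at t)) (maximumExists⇔ c rep (factors t (χ em (S t))) (proj₁ np,ps) (proj₂ np,ps))
      where
      Nonzero : Set
      Nonzero = ¬ All (λ (_ , q) → coeff (at numerator t) q ≡ 0ℚ) (at numerator t)
      np,ps = sg (RepresentedBy.denominators rep)
    equivalent : Ev (λ t → Class t → (MaximumExists c (S t) → Φ t) × (Φ t → MaximumExists c (S t)))
    equivalent = Ev-map₂ (λ t rep sg class → Φ⇔ t (rep class) sg) represented signs
    location : Location (descending-cone cℚ) (settled-DescendingPos cℚ) numerator-germ denominator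
    location = locate (descending-cone cℚ) (settled-DescendingPos cℚ) numerator-germ denominator-germ
    attained : ∀ t → MaximumExists c (S t) → RepresentedBy em (S t) (at numerator t) (vectorsAt denominator t) →
               (∀ {G s₀} → All (_≢ 0ᵛ) (vectorsAt denominator t) → ∇* (vectorsAt denominator t) G ≐ at numerator t →
                 IsMin (descending-cone cℚ) G s₀ → s₀ ≡ proj₁ location t) →
               ∃[ y ] AttainsMaximum c (S t) y × embed y ≡ proj₁ location t
    attained t m rep h = let y , attains , isMin = maximum⇒min c m in
      y , attains , h (All.map (λ (_ , lp) → LP⇒≢0 lp) (RepresentedBy.denominators rep)) (RepresentedBy.identity rep) isMin
    decide : Settled Φ → Selectable (λ t → AttainsMaximum c (S t)) Class
    decide (inj₂ n) = inj₁ (Ev-map₂ (λ t ¬φ eq class m → ¬φ (proj₁ (eq class) m)) n equivalent)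
    decide (inj₁ p) = inj₂ (proj₁ location , proj₁ (proj₂ location) ,
      Ev-map₂ (λ t (φ , eq) (rep , h) class → attained t (proj₂ (eq class) φ) (rep class) h)
        (Ev-× p equivalent) (Ev-× represented (proj₂ (proj₂ location))))

-- Polynomial division

-- The leading coefficient `z` is kept apart from the `n` lower ones, so that a remainder of length
-- `n` visibly has smaller degree.
evalTop : ∀ {n} → ℚ → Vec ℚ n → ℚ → ℚ
evalTop x v z = eval (toList v ++ [ z ]) x

evalTop-⊕ : ∀ {n} x (v w : Vec ℚ n) z → evalTop x (v ⊕ w) z ≡ evalTop x v z + evalAt x w
evalTop-⊕ x [] [] z = sym (ℚₚ.+-identityʳ (evalTop x [] z))
evalTop-⊕ x (a ∷ v) (b ∷ w) z = trans (cong (λ e → a + b + x * e) (evalTop-⊕ x v w z)) (horner-+ a b x (evalTop x v z) (evalAt x w))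

evalTop-eliminate : ∀ {n} x (w v : Vec ℚ n) c z → evalTop x w (c * z) ≡ evalAt x (w ⊖ c ⊙ v) + c * evalTop x v z
evalTop-eliminate x [] [] c z = lemma x c z
  where
  lemma : ∀ x c z → c * z + x * 0ℚ ≡ 0ℚ + c * (z + x * 0ℚ)
  lemma = solve-∀ ℚring
evalTop-eliminate x (a ∷ w) (b ∷ v) c z = trans (cong (λ e → a + x * e) (evalTop-eliminate x w v c z))
    (lemma a b x c (evalAt x (w ⊖ c ⊙ v)) (evalTop x v z))
  where
  lemma : ∀ a b x c u t → a + x * (u + c * t) ≡ a - c * b + x * u + c * (b + x * t)
  lemma = solve-∀ ℚring

split-last : ∀ {n} (v : Vec ℚ (suc n)) → ∃[ w ] ∃[ r ] (∀ x → evalAt x v ≡ evalTop {n} x w r)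
split-last (a ∷ []) = [] , a , λ x → refl
split-last (a ∷ b ∷ v) with split-last (b ∷ v)
... | w , r , e = a ∷ w , r , λ x → cong (λ u → a + x * u) (e x)

-- Division in Horner form: `a + x R` has degree at most `n`, and subtracting `r / z` times the
-- divisor removes its top coefficient `r`.
divideP : ∀ {n} (v : Vec ℚ n) {z} → z ≢ 0ℚ → ∀ P → ∃[ p ] ∃[ R ] (∀ x → eval P x ≡ eval p x * evalTop x v z + evalAt {n} x R)
divideP {n} v {z} z≢0 [] = [] , 0ᵛ , λ x → trans (sym (zeros n x))
  (sym (trans (cong (_+ evalAt x (0ᵛ {n})) (ℚₚ.*-zeroˡ (evalTop x v z))) (ℚₚ.+-identityˡ (evalAt x (0ᵛ {n})))))
  where
  zeros : ∀ n x → evalAt x (0ᵛ {n}) ≡ 0ℚ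
  zeros zero x = refl
  zeros (suc n) x = trans (cong (λ e → 0ℚ + x * e) (zeros n x)) (trans (ℚₚ.+-identityˡ (x * 0ℚ)) (ℚₚ.*-zeroʳ x))
divideP {n} v {z} z≢0 (a ∷ P) with divideP v z≢0 P
... | p , R , e with split-last (a ∷ R)
...   | w , r , e′ = c ∷ p , w ⊖ c ⊙ v , λ x → begin
    a + x * eval P x                                            ≡⟨ cong (λ u → a + x * u) (e x) ⟩
    a + x * (eval p x * evalTop x v z + evalAt x R)             ≡⟨ lemma a x (eval p x) (evalTop x v z) (evalAt x R) ⟩
    x * eval p x * evalTop x v z + (a + x * evalAt x R)         ≡⟨ cong (x * eval p x * evalTop x v z +_) (trans (e′ x) (cong (evalTop x w) r≡cz)) ⟩
    x * eval p x * evalTop x v z + evalTop x w (c * z)          ≡⟨ cong (x * eval p x * evalTop x v z +_) (evalTop-eliminate x w v c z) ⟩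
    x * eval p x * evalTop x v z + (evalAt x (w ⊖ c ⊙ v) + c * evalTop x v z)
      ≡⟨ lemma′ x (eval p x) (evalTop x v z) (evalAt x (w ⊖ c ⊙ v)) c ⟩
    (c + x * eval p x) * evalTop x v z + evalAt x (w ⊖ c ⊙ v)   ∎
  where
  open ≡-Reasoning
  c = r * inverse z
  r≡cz : r ≡ c * z
  r≡cz = trans (sym (ℚₚ.*-identityʳ r)) (trans (cong (r *_) (trans (sym (*-inverse z≢0)) (ℚₚ.*-comm z (inverse z)))) (sym (ℚₚ.*-assoc r (inverse z) z)))
  lemma : ∀ a x p q r → a + x * (p * q + r) ≡ x * p * q + (a + x * r)
  lemma = solve-∀ ℚring
  lemma′ : ∀ x p q r c → x * p * q + (r + c * q) ≡ (c + x * p) * q + r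
  lemma′ = solve-∀ ℚring

common-denominator : ∀ p → ∃[ D ] fromℤ D ≢ 0ℚ × (∀ t → ∃[ z ] fromℤ D * eval p (fromℕ t) ≡ fromℤ z)
common-denominator [] = ℤ.+ 1 , pos≢0 0<1 , λ t → ℤ.+ 0 , refl
common-denominator (a ∷ p) with common-denominator p
... | D , D≢0 , clears = ℚ.↧ a ℤ.* D , subst (_≢ 0ℚ) (sym (fromℤ-* (ℚ.↧ a) D)) (*-≢0 {fromℤ (ℚ.↧ a)} (pos≢0 (0<fromℕ-suc (ℚ.denominator-1 a))) D≢0) ,
    λ t → step (fromℕ t) (ℤ.+ t) refl (clears t)
  where
  lemma : ∀ d D a x e → (d * D) * (a + x * e) ≡ (a * d) * D + d * (x * (D * e))
  lemma = solve-∀ ℚring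
  step : ∀ x k → fromℤ k ≡ x → (∃[ z ] fromℤ D * eval p x ≡ fromℤ z) →
         ∃[ z ] fromℤ (ℚ.↧ a ℤ.* D) * (a + x * eval p x) ≡ fromℤ z
  step x k refl (z , e) = ℚ.↥ a ℤ.* D ℤ.+ ℚ.↧ a ℤ.* (k ℤ.* z) , (begin
    fromℤ (ℚ.↧ a ℤ.* D) * (a + x * eval p x)                              ≡⟨ cong (_* (a + x * eval p x)) (fromℤ-* (ℚ.↧ a) D) ⟩
    (fromℤ (ℚ.↧ a) * fromℤ D) * (a + x * eval p x)                        ≡⟨ lemma (fromℤ (ℚ.↧ a)) (fromℤ D) a x (eval p x) ⟩
    (a * fromℤ (ℚ.↧ a)) * fromℤ D + fromℤ (ℚ.↧ a) * (x * (fromℤ D * eval p x))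
      ≡⟨ cong₂ (λ u v → u * fromℤ D + fromℤ (ℚ.↧ a) * (x * v)) (fromℤ-↥ a) e ⟩
    fromℤ (ℚ.↥ a) * fromℤ D + fromℤ (ℚ.↧ a) * (fromℤ k * fromℤ z)
      ≡⟨ cong₂ _+_ (sym (fromℤ-* (ℚ.↥ a) D)) (trans (cong (fromℤ (ℚ.↧ a) *_) (sym (fromℤ-* k z))) (sym (fromℤ-* (ℚ.↧ a) (k ℤ.* z)))) ⟩
    fromℤ (ℚ.↥ a ℤ.* D) + fromℤ (ℚ.↧ a ℤ.* (k ℤ.* z))                     ≡⟨ fromℤ-+ (ℚ.↥ a ℤ.* D) (ℚ.↧ a ℤ.* (k ℤ.* z)) ⟨
    fromℤ (ℚ.↥ a ℤ.* D ℤ.+ ℚ.↧ a ℤ.* (k ℤ.* z))                           ∎)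
    where open ≡-Reasoning

integer-square<1 : ∀ k → 0ℚ < 1ℚ - fromℤ k * fromℤ k → fromℤ k ≡ 0ℚ
integer-square<1 k p = cong fromℤ (square<1 k (fromℤ-cancel-< {k ℤ.* k} {ℤ.+ 1} (subst (_< 1ℚ) (sym (fromℤ-* k k)) (diff-pos⁻ p))))
  where
  square<1 : ∀ k → k ℤ.* k ℤ.< ℤ.+ 1 → k ≡ ℤ.+ 0
  square<1 (ℤ.+ zero) _ = refl
  square<1 (ℤ.+ suc n) (ℤ.+<+ (ℕ.s≤s ()))
  square<1 ℤ.-[1+ n ] (ℤ.+<+ (ℕ.s≤s ()))

EvOn : (ℕ → Set) → (ℕ → Set) → Set
EvOn Class P = Ev (λ t → Class t → P t)

module _ {n} (v R : Vec ℚ n) {z : ℚ} (z≢0 : z ≢ 0ℚ) where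

  -- Adding or subtracting `R`, which has smaller degree, leaves the leading coefficient `z`, so
  -- both factors eventually have the sign of `z`. The product form expresses that the divisor
  -- exceeds `R` in absolute value.
  dominates : Ev (λ t → 0ℚ < (evalTop (fromℕ t) v z + evalAt (fromℕ t) R) * (evalTop (fromℕ t) v z - evalAt (fromℕ t) R))
  dominates = by-sign (sign z)
    where
    minus-R : Vec ℚ n
    minus-R = (- 1ℚ) ⊙ R
    lemma : ∀ x → - 1ℚ * x ≡ - x
    lemma = solve-∀ ℚring
    plus-top : ∀ x → evalTop x (v ⊕ R) z ≡ evalTop x v z + evalAt x R
    plus-top x = evalTop-⊕ x v R z
    minus-top : ∀ x → evalTop x (v ⊕ minus-R) z ≡ evalTop x v z - evalAt x R
    minus-top x = trans (evalTop-⊕ x v minus-R z) (cong (evalTop x v z +_) (trans (IsLinear.homo-⊙ (evalAt-linear x) (- 1ℚ) R) (lemma (evalAt x R))))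
    neg-neg : ∀ a b → - a * - b ≡ a * b
    neg-neg = solve-∀ ℚring
    by-sign : 0ℚ < z ⊎ z ≡ 0ℚ ⊎ 0ℚ < - z → Ev (λ t → 0ℚ < (evalTop (fromℕ t) v z + evalAt (fromℕ t) R) * (evalTop (fromℕ t) v z - evalAt (fromℕ t) R))
    by-sign (inj₁ 0<z) = Ev-map₂ (λ t a b → subst (0ℚ <_) (cong₂ _*_ (plus-top (fromℕ t)) (minus-top (fromℕ t))) (*-pos a b))
      (growth-pos (toList (v ⊕ R)) 0<z) (growth-pos (toList (v ⊕ minus-R)) 0<z)
    by-sign (inj₂ (inj₁ z≡0)) = ⊥-elim (z≢0 z≡0)
    by-sign (inj₂ (inj₂ z<0)) = Ev-map₂ (λ t a b → subst (0ℚ <_)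
        (trans (neg-neg (evalTop (fromℕ t) (v ⊕ R) z) (evalTop (fromℕ t) (v ⊕ minus-R) z)) (cong₂ _*_ (plus-top (fromℕ t)) (minus-top (fromℕ t)))) (*-pos a b))
      (growth-neg (toList (v ⊕ R)) z<0) (growth-neg (toList (v ⊕ minus-R)) z<0)

-- Division with remainder gives f = P / Q = p + R / Q. If f is integral then so is h = D R / Q, for D a common denominator
-- of p; as eventually (Q − D R)(Q + D R) > 0, we get h² < 1 and h = 0.

germ-integral⇒poly : ∀ {Class : ℕ → Set} {f} → Germ f → EvOn Class (λ t → ∃[ z ] f t ≡ fromℤ z) →
                     ∃[ p ] EvOn Class (λ t → f t ≡ eval p (fromℕ t))
germ-integral⇒poly {Class} {f} (germ P Q ev) integral = by-leading (leadingForm Q)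
  where
  by-leading : All (_≡ 0ℚ) Q ⊎ (∃[ p′ ] ∃[ z ] z ≢ 0ℚ × (∀ x → eval Q x ≡ eval (p′ ++ [ z ]) x)) →
               ∃[ p ] EvOn Class (λ t → f t ≡ eval p (fromℕ t))
  by-leading (inj₁ zs) = ⊥-elim (proj₁ (proj₂ ev (proj₁ ev) ℕₚ.≤-refl) (eval-zeros zs (fromℕ (proj₁ ev))))
  by-leading (inj₂ (Q′ , z , z≢0 , Q≡)) = with-division (divideP v z≢0 P)
    where
    v : Vec ℚ (length Q′)
    v = Vec.fromList Q′
    top : ∀ x → eval Q x ≡ evalTop x v z
    top x = trans (Q≡ x) (cong (λ l → eval (l ++ [ z ]) x) (sym (Vecₚ.toList∘fromList Q′)))
    with-division : (∃[ p ] ∃[ R ] (∀ x → eval P x ≡ eval p x * evalTop x v z + evalAt x R)) →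
                    ∃[ p ] EvOn Class (λ t → f t ≡ eval p (fromℕ t))
    with-division (p , R , e) with common-denominator p
    ... | D , D≢0 , clears = p , Ev-map₂ (λ t (a , dom) int class →
            conclude (fromℕ t) (f t) a dom (int class) (clears t)) (Ev-× ev (dominates v (fromℤ D ⊙ R) z≢0)) integral
      where
      conclude : ∀ x u → eval Q x ≢ 0ℚ × u * eval Q x ≡ eval P x →
                 0ℚ < (evalTop x v z + evalAt x (fromℤ D ⊙ R)) * (evalTop x v z - evalAt x (fromℤ D ⊙ R)) →
                 (∃[ k ] u ≡ fromℤ k) → (∃[ k ] fromℤ D * eval p x ≡ fromℤ k) → u ≡ eval p x
      conclude x u (Q≢0 , uQ≡P) dom (k , u≡k) (l , Dp≡l) = diff≡0 (*-cancel-0 D≢0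
            (trans (sym h≡) (integer-square<1 h (*-pos-cancel (square-pos q≢0) (subst (0ℚ <_) factorised dom)))))
        where
        q = evalTop x v z
        q≢0 : q ≢ 0ℚ
        q≢0 = subst (_≢ 0ℚ) (top x) Q≢0
        h : ℤ
        h = D ℤ.* k ℤ.- l
        h≡ : fromℤ h ≡ fromℤ D * (u - eval p x)
        h≡ = trans (fromℤ-- (D ℤ.* k) l) (trans (cong₂ _-_ (trans (fromℤ-* D k) (cong (fromℤ D *_) (sym u≡k))) (sym Dp≡l)) (lemma (fromℤ D) u (eval p x)))
          where
          lemma : ∀ d u p → d * u - d * p ≡ d * (u - p)
          lemma = solve-∀ ℚring
        DR≡ : evalAt x (fromℤ D ⊙ R) ≡ fromℤ h * q
        DR≡ = begin
          evalAt x (fromℤ D ⊙ R)              ≡⟨ IsLinear.homo-⊙ (evalAt-linear x) (fromℤ D) R ⟩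
          fromℤ D * evalAt x R                ≡⟨ lemma (fromℤ D) (eval p x * q) (evalAt x R) ⟩
          fromℤ D * ((eval p x * q + evalAt x R) - eval p x * q)
            ≡⟨ cong (λ y → fromℤ D * (y - eval p x * q)) (trans (sym (e x)) (trans (sym uQ≡P) (cong (u *_) (top x)))) ⟩
          fromℤ D * (u * q - eval p x * q)    ≡⟨ lemma′ (fromℤ D) u q (eval p x) ⟩
          fromℤ D * (u - eval p x) * q        ≡⟨ cong (_* q) h≡ ⟨
          fromℤ h * q                         ∎
          where
          open ≡-Reasoning
          lemma : ∀ d a r → d * r ≡ d * ((a + r) - a)
          lemma = solve-∀ ℚring
          lemma′ : ∀ d u q p → d * (u * q - p * q) ≡ d * (u - p) * q
          lemma′ = solve-∀ ℚring
        factorised : (q + evalAt x (fromℤ D ⊙ R)) * (q - evalAt x (fromℤ D ⊙ R)) ≡ (1ℚ - fromℤ h * fromℤ h) * (q * q)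
        factorised = trans (cong (λ y → (q + y) * (q - y)) DR≡) (lemma q (fromℤ h))
          where
          lemma : ∀ q h → (q + h * q) * (q - h * q) ≡ (1ℚ - h * h) * (q * q)
          lemma = solve-∀ ℚring

-- Residue classes

Residue : ∀ m → Fin (suc m) → ℕ → Set
Residue m i t = t mod suc m ≡ i

mod-shift : ∀ m t k → (t ℕ.+ k ℕ.* suc m) mod suc m ≡ t mod suc m
mod-shift m t k = Finₚ.toℕ-injective (trans (Finₚ.toℕ-fromℕ< _) (trans ([m+kn]%n≡m%n t k (suc m)) (sym (Finₚ.toℕ-fromℕ< _))))

mod-period : ∀ m t → (t ℕ.+ suc m) mod suc m ≡ t mod suc m
mod-period m t = trans (cong (λ k → (t ℕ.+ k) mod suc m) (sym (ℕₚ.+-identityʳ (suc m)))) (mod-shift m t 1)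

residue-unbounded : ∀ m i T → ∃[ t ] T ℕ.≤ t × Residue m i t
residue-unbounded m i T = toℕ i ℕ.+ T ℕ.* suc m , ℕₚ.≤-trans (ℕₚ.m≤m*n T (suc m)) (ℕₚ.m≤n+m (T ℕ.* suc m) (toℕ i)) ,
  trans (mod-shift m (toℕ i) T) (Finₚ.toℕ-injective (trans (Finₚ.toℕ-fromℕ< _) (m<n⇒m%n≡m (Finₚ.toℕ<n i))))

SettledOn : (ℕ → Set) → (ℕ → Set) → Set
SettledOn Class P = EvOn Class P ⊎ EvOn Class (λ t → ¬ P t)

-- Beyond a common threshold the outcome depends only on the residue class, which `t` and
-- `t + suc m` share.
settledOn⇒periodic : ∀ {m} {P : ℕ → Set} → (∀ i → SettledOn (Residue m i) P) → EventuallyPeriodic P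
settledOn⇒periodic {m} {P} s = proj₁ eventually , m , λ t T≤t →
    agree (s (t mod suc m)) (proj₂ eventually t T≤t (t mod suc m) refl)
      (proj₂ eventually (t ℕ.+ suc m) (ℕₚ.≤-trans T≤t (ℕₚ.m≤m+n t (suc m))) (t mod suc m) (mod-period m t))
  where
  Outcome : ∀ {i} → SettledOn (Residue m i) P → ℕ → Set
  Outcome (inj₁ _) t = P t
  Outcome (inj₂ _) t = ¬ P t
  outcome : ∀ {i} (o : SettledOn (Residue m i) P) → EvOn (Residue m i) (Outcome o)
  outcome (inj₁ e) = e
  outcome (inj₂ e) = e
  eventually : Ev (λ t → ∀ i → Residue m i t → Outcome (s i) t)
  eventually = Ev-Fin λ i → outcome (s i)
  agree : ∀ {i t t′} (o : SettledOn (Residue m i) P) → Outcome o t → Outcome o t′ → P t ⇔ P t′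
  agree (inj₁ _) a b = mk⇔ (λ _ → b) (λ _ → a)
  agree (inj₂ _) ¬a ¬b = mk⇔ (λ a → ⊥-elim (¬a a)) (λ b → ⊥-elim (¬b b))

poly-on-residues⇒quasi : ∀ {m f} → (∀ i → ∃[ p ] EvOn (Residue m i) (λ t → f t ≡ eval p (fromℕ t))) → EventuallyQuasiPolynomial f
poly-on-residues⇒quasi {m} {f} ps = (λ t → eval (proj₁ (ps (t mod suc m))) (fromℕ t)) , (m , (λ i → proj₁ (ps i)) , λ _ → refl) ,
    proj₁ eventually , λ t T≤t → proj₂ eventually t T≤t (t mod suc m) refl
  where
  eventually : Ev (λ t → ∀ i → Residue m i t → f t ≡ eval (proj₁ (ps i)) (fromℕ t))
  eventually = Ev-Fin λ i → proj₂ (ps i)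

GermOn : ∀ {e} → (ℕ → Vec ℕ e) → (ℕ → Set) → Set
GermOn x Class = ∃[ v ] VGerm v × EvOn Class (λ t → embed (x t) ≡ v t)

-- Each coordinate is a germ with integer values on the class, hence a polynomial there.
germOn⇒quasi : ∀ {m e} {x : ℕ → Vec ℕ e} → (∀ i → GermOn x (Residue m i)) → CoordinatesEventuallyQuasiPolynomial x
germOn⇒quasi {x = x} g j = poly-on-residues⇒quasi λ i → on-residue (g i)
  where
  on-residue : ∀ {Class} → GermOn x Class → ∃[ p ] EvOn Class (λ t → fromℕ (lookup (x t) j) ≡ eval p (fromℕ t))
  on-residue {Class} (v , gv , ev) = proj₁ polynomial , Ev-map₂ (λ t e p class → trans (coordinate-≡ (e class)) (p class)) ev (proj₂ polynomial)
    where
    coordinate-≡ : ∀ {t} → embed (x t) ≡ v t → fromℕ (lookup (x t) j) ≡ lookup (v t) j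
    coordinate-≡ {t} e = trans (sym (Vecₚ.lookup-map j fromℕ (x t))) (cong (λ w → lookup w j) e)
    polynomial : ∃[ p ] EvOn Class (λ t → lookup (v t) j ≡ eval p (fromℕ t))
    polynomial = germ-integral⇒poly (VGerm.coordinate gv j)
      (Ev-map (λ t e class → ℤ.+ lookup (x t) j , sym (coordinate-≡ (e class))) ev)

-- Assembling one choice from the residue classes.

record Choice {e} (m : ℕ) (Attain : ℕ → Vec ℕ e → Set) : Set where
  field
    choice : ℕ → Vec ℕ e
    attains : ∀ t → (∃[ y ] Attain t y) → Attain t (choice t)
    germs : ∀ i → GermOn choice (Residue m i)
    settled : ∀ i → SettledOn (Residue m i) (λ t → ∃[ y ] Attain t y)

module _ (em : ExcludedMiddle 0ℓ) where

  -- A solution on the prescribed germ is preferred. Any other solution serves as a fallback for the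
  -- finitely many `t` before the germ takes over, so that `attains` holds for every `t`.
  choose : ∀ {e m} {Attain : ℕ → Vec ℕ e → Set} → (∀ i → Selectable Attain (Residue m i)) → Choice m Attain
  choose {e} {m} {Attain} sel = record { choice = x ; attains = attains ; germs = germs ; settled = settled }
    where
    targetOf : ∀ {Class} → Selectable Attain Class → ℕ → Vec ℚ e
    targetOf (inj₁ _) t = 0ᵛ
    targetOf (inj₂ (v , _)) t = v t
    target : ℕ → Vec ℚ e
    target t = targetOf (sel (t mod suc m)) t
    pick : ∀ t → Dec (∃[ y ] Attain t y × embed y ≡ target t) → Dec (∃[ y ] Attain t y) → Vec ℕ e
    pick t (yes (y , _)) _ = y
    pick t (no _) (yes (y , _)) = y
    -- A fixed default keeps the choice polynomial on classes that eventually have no solution.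
    pick t (no _) (no _) = replicate e 0
    x : ℕ → Vec ℕ e
    x t = pick t em em
    pick-attains : ∀ t D D′ → (∃[ y ] Attain t y) → Attain t (pick t D D′)
    pick-attains t (yes (y , a , _)) _ _ = a
    pick-attains t (no _) (yes (y , a)) _ = a
    pick-attains t (no _) (no n) a = ⊥-elim (n a)
    attains : ∀ t → (∃[ y ] Attain t y) → Attain t (x t)
    attains t = pick-attains t em em
    pick-target : ∀ t D D′ → (∃[ y ] Attain t y × embed y ≡ target t) → embed (pick t D D′) ≡ target t
    pick-target t (yes (y , _ , e)) _ _ = e
    pick-target t (no n) _ a = ⊥-elim (n a)
    embed-zeros : ∀ n → embed (replicate n 0) ≡ 0ᵛ
    embed-zeros zero = refl
    embed-zeros (suc n) = cong (0ℚ ∷_) (embed-zeros n)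
    pick-zero : ∀ t D D′ → ¬ (∃[ y ] Attain t y) → embed (pick t D D′) ≡ 0ᵛ
    pick-zero t (yes (y , a , _)) _ n = ⊥-elim (n (y , a))
    pick-zero t (no _) (yes a) n = ⊥-elim (n a)
    pick-zero t (no _) (no _) _ = embed-zeros e
    target-≡ : ∀ {i t} → Residue m i t → target t ≡ targetOf (sel i) t
    target-≡ refl = refl
    germ-from : ∀ i (s : Selectable Attain (Residue m i)) → (∀ t → Residue m i t → target t ≡ targetOf s t) → GermOn x (Residue m i)
    germ-from i (inj₁ none) _ = (λ _ → 0ᵛ) , vgerm-const 0ᵛ , Ev-map (λ t n class → pick-zero t em em (n class)) none
    germ-from i (inj₂ (v , gv , ev)) e = v , gv , Ev-map (λ t a class → hit t class (a class)) ev
      where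
      hit : ∀ t → Residue m i t → (∃[ y ] Attain t y × embed y ≡ v t) → embed (x t) ≡ v t
      hit t class (y , a , ey) = trans (pick-target t em em (y , a , trans ey (sym (e t class)))) (e t class)
    germs : ∀ i → GermOn x (Residue m i)
    germs i = germ-from i (sel i) (λ t → target-≡ {i} {t})
    settled : ∀ i → SettledOn (Residue m i) (λ t → ∃[ y ] Attain t y)
    settled i with sel i
    ... | inj₁ none = inj₂ none
    ... | inj₂ (_ , _ , ev) = inj₁ (Ev-map (λ t a class → proj₁ (a class) , proj₁ (proj₂ (a class))) ev)

-- Finite subsets of ℕᵈ

-- On ℕᵈ, the functional `minus-ones` has a maximum on exactly the nonempty sets, and `ones` on
-- exactly the nonempty finite sets. Nonemptiness and finiteness thus become questions about maxima.
ones minus-ones : ∀ d → Vec ℤ d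
ones d = replicate d (ℤ.+ 1)
minus-ones d = replicate d (ℤ.- ℤ.+ 1)

ones-· : ∀ {d} (y : Vec ℕ d) → ones d · y ≡ ℤ.+ Vec.sum y
ones-· [] = refl
ones-· (n ∷ y) = cong₂ ℤ._+_ (ℤₚ.*-identityˡ (ℤ.+ n)) (ones-· y)

minus-ones-· : ∀ {d} (y : Vec ℕ d) → minus-ones d · y ≡ ℤ.- ℤ.+ Vec.sum y
minus-ones-· [] = refl
minus-ones-· (n ∷ y) = trans (cong₂ ℤ._+_ (ℤₚ.-1*i≡-i (ℤ.+ n)) (minus-ones-· y)) (sym (ℤₚ.neg-distrib-+ (ℤ.+ n) (ℤ.+ Vec.sum y)))

box : ∀ d → ℕ → List (Vec ℕ d)
box zero N = [] ∷ []
box (suc d) N = concatMap (λ n → List.map (n ∷_) (box d N)) (upTo (suc N))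

∈-box : ∀ {d N} (y : Vec ℕ d) → Vec.sum y ℕ.≤ N → y ∈ box d N
∈-box [] le = here refl
∈-box {suc d} {N} (n ∷ y) le = ∈-concatMap⁺ (λ n → List.map (n ∷_) (box d N))
  (Any.map (λ { refl → ∈-map⁺ (n ∷_) (∈-box y (ℕₚ.≤-trans (ℕₚ.m≤n+m (Vec.sum y) n) le)) })
    (∈-upTo⁺ (ℕ.s≤s (ℕₚ.≤-trans (ℕₚ.m≤m+n n (Vec.sum y)) le))))

indicatorSum : ∀ {d n} → (Fin n → Vec ℕ d) → Formal d
indicatorSum f = List.tabulate (λ i → 1ℚ , embed (f i))

coeff-indicatorSum-∉ : ∀ {d n} (f : Fin n → Vec ℕ d) {s} → (∀ i → embed (f i) ≢ s) → coeff (indicatorSum f) s ≡ 0ℚ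
coeff-indicatorSum-∉ {n = zero} f ne = refl
coeff-indicatorSum-∉ {n = suc n} f {s} ne = cong₂ (λ x y → 1ℚ * x + y) (δ-≢ {s = s} {embed (f zero)} (ne zero)) (coeff-indicatorSum-∉ (f ∘ suc) (ne ∘ suc))

coeff-indicatorSum-∈ : ∀ {d n} (f : Fin n → Vec ℕ d) → Injective _≡_ _≡_ f → ∀ i {s} → embed (f i) ≡ s → coeff (indicatorSum f) s ≡ 1ℚ
coeff-indicatorSum-∈ f inj zero {s} e = cong₂ (λ x y → 1ℚ * x + y) (δ-≡ {s = s} {embed (f zero)} e)
  (coeff-indicatorSum-∉ (f ∘ suc) λ j e′ → Finₚ.0≢1+n (inj (embed-injective (trans e (sym e′)))))
coeff-indicatorSum-∈ f inj (suc i) {s} e = cong₂ (λ x y → 1ℚ * x + y)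
    (δ-≢ {s = s} {embed (f zero)} λ e′ → Finₚ.0≢1+n (inj (embed-injective (trans e′ (sym e)))))
    (coeff-indicatorSum-∈ (f ∘ suc) (λ e → Finₚ.suc-injective (inj e)) i e)

pair-indicatorSum-1 : ∀ {d n} (f : Fin n → Vec ℕ d) → ⟨ indicatorSum f , (λ _ → 1ℚ) ⟩ ≡ fromℕ n
pair-indicatorSum-1 {n = zero} f = refl
pair-indicatorSum-1 {n = suc n} f = trans (cong (1ℚ * 1ℚ +_) (pair-indicatorSum-1 (f ∘ suc))) (sym (fromℕ-suc n))

-- f behaves under k-fold differencing like a polynomial of degree k with leading coefficient a.

LeadingDifference : ℕ → ℚ → (ℚ → ℚ) → Set
LeadingDifference zero a f = ∀ y → f y ≡ a
LeadingDifference (suc k) a f = ∀ h → LeadingDifference k (- (fromℕ (suc k) * a * h)) (λ y → f y - f (y + h))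

leading-cong : ∀ k {a a′ f g} → a ≡ a′ → (∀ y → f y ≡ g y) → LeadingDifference k a f → LeadingDifference k a′ g
leading-cong zero refl e l y = trans (sym (e y)) (l y)
leading-cong (suc k) refl e l h = leading-cong k refl (λ y → cong₂ _-_ (e y) (e (y + h))) (l h)

leading-+ : ∀ k {a b f g} → LeadingDifference k a f → LeadingDifference k b g → LeadingDifference k (a + b) (λ y → f y + g y)
leading-+ zero l l′ y = cong₂ _+_ (l y) (l′ y)
leading-+ (suc k) {a} {b} {f} {g} l l′ h = leading-cong k (lemma (fromℕ (suc k)) a b h) (λ y → lemma′ (f y) (f (y + h)) (g y) (g (y + h)))
    (leading-+ k (l h) (l′ h))
  where
  lemma : ∀ n a b h → - (n * a * h) + - (n * b * h) ≡ - (n * (a + b) * h)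
  lemma = solve-∀ ℚring
  lemma′ : ∀ f f′ g g′ → (f - f′) + (g - g′) ≡ (f + g) - (f′ + g′)
  lemma′ = solve-∀ ℚring

leading-scale : ∀ k c {a f} → LeadingDifference k a f → LeadingDifference k (c * a) (λ y → c * f y)
leading-scale zero c l y = cong (c *_) (l y)
leading-scale (suc k) c {a} {f} l h = leading-cong k (lemma c (fromℕ (suc k)) a h) (λ y → lemma′ c (f y) (f (y + h))) (leading-scale k c (l h))
  where
  lemma : ∀ c n a h → c * - (n * a * h) ≡ - (n * (c * a) * h)
  lemma = solve-∀ ℚring
  lemma′ : ∀ c f f′ → c * (f - f′) ≡ c * f - c * f′
  lemma′ = solve-∀ ℚring

leading-translate : ∀ k c {a f} → LeadingDifference k a f → LeadingDifference k a (λ y → f (y + c))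
leading-translate zero c l y = l (y + c)
leading-translate (suc k) c {a} {f} l h = leading-cong k refl (λ y → cong (λ z → f (y + c) - f z) (lemma y c h)) (leading-translate k c (l h))
  where
  lemma : ∀ y c h → y + c + h ≡ y + h + c
  lemma = solve-∀ ℚring

-- From `y f(y) − (y + h) f(y + h) = y (f(y) − f(y + h)) − h f(y + h)`: the first summand falls
-- under the induction. The leading coefficients `−k a h` and `−a h` of the two summands add up to
-- `−(k + 1) a h`.
leading-*-id : ∀ k {a f} → LeadingDifference k a f → LeadingDifference (suc k) a (λ y → y * f y)
leading-*-id zero {a} {f} l h y = trans (cong₂ (λ u v → y * u - (y + h) * v) (l y) (l (y + h))) (lemma y h a)
  where
  lemma : ∀ y h a → y * a - (y + h) * a ≡ - (1ℚ * a * h)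
  lemma = solve-∀ ℚring
leading-*-id (suc k) {a} {f} l h = leading-cong (suc k)
    (trans (lemma (fromℕ (suc k)) a h) (cong (λ n → - (n * a * h)) (sym (fromℕ-suc (suc k)))))
    (λ y → lemma′ y h (f y) (f (y + h)))
    (leading-+ (suc k) {f = λ y → y * (f y - f (y + h))} {λ y → - h * f (y + h)}
      (leading-*-id k (l h)) (leading-scale (suc k) (- h) {f = λ y → f (y + h)} (leading-translate (suc k) h {f = f} l)))
  where
  lemma : ∀ n a h → - (n * a * h) + - h * a ≡ - ((1ℚ + n) * a * h)
  lemma = solve-∀ ℚring
  lemma′ : ∀ y h f f′ → y * (f - f′) + - h * f′ ≡ y * f - (y + h) * f′
  lemma′ = solve-∀ ℚring

power : ℕ → ℚ → ℚ
power zero y = 1ℚ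
power (suc k) y = y * power k y

leading-power : ∀ k → LeadingDifference k 1ℚ (power k)
leading-power zero y = refl
leading-power (suc k) = leading-*-id k (leading-power k)

germ-power : ∀ k {f} → Germ f → Germ (λ t → power k (f t))
germ-power zero g = germ-const 1ℚ
germ-power (suc k) g = germ-* g (germ-power k g)

module _ {d : ℕ} (u : Vec ℚ d → ℚ) where

  -- For `k` vectors this is `(−1)^k k! a` times the product of the values `u b`.
  differences : List (Vec ℚ d) → ℚ → ℚ
  differences [] a = a
  differences (b ∷ bs) a = differences bs (- (fromℕ (suc (length bs)) * a * u b))

  differences-≢0 : ∀ {bs a} → All (λ b → u b ≢ 0ℚ) bs → a ≢ 0ℚ → differences bs a ≢ 0ℚ
  differences-≢0 [] a≢0 = a≢0
  differences-≢0 {b ∷ bs} {a} (ub≢0 ∷ ps) a≢0 = differences-≢0 ps λ e →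
    *-≢0 (*-≢0 (pos≢0 (0<fromℕ-suc (length bs))) a≢0) ub≢0 (trans (sym (neg-involutive (fromℕ (suc (length bs)) * a * u b))) (cong -_ e))

  germ-differences : (∀ {v : ℕ → Vec ℚ d} → VGerm v → Germ (λ t → u (v t))) →
                     ∀ {bs a} → All VGerm bs → Germ a → Germ (λ t → differences (vectorsAt bs t) (a t))
  germ-differences germ-u [] g = g
  germ-differences germ-u {b ∷ bs} {a} (gb ∷ gbs) g = germ-≗
    (λ t → cong (λ n → differences (vectorsAt bs t) (- (fromℕ (suc n) * a t * u (b t)))) (sym (Listₚ.length-map (λ b → b t) bs)))
    (germ-differences germ-u gbs (germ-neg (germ-* (germ-* (germ-const (fromℕ (suc (length bs)))) g) (germ-u gb))))

  -- Under the pairing, each factor `1 − 𝐱ᵇ` turns into a difference of `f` with step `u b`. After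
  -- all factors are used, `f` has become constant and only the sum of the coefficients of `M` is
  -- seen.
  pair-times*-leading : IsLinear u → ∀ bs (M : Formal d) {a f} → LeadingDifference (length bs) a f →
                        ⟨ times* bs M , (λ q → f (u q)) ⟩ ≡ differences bs a * ⟨ M , (λ _ → 1ℚ) ⟩
  pair-times*-leading lin [] M {a} {f} l = trans (pair-≗ M (λ q → trans (l (u q)) (sym (ℚₚ.*-identityʳ a)))) (pair-scale M a (λ _ → 1ℚ))
  pair-times*-leading lin (b ∷ bs) M {a} {f} l = begin
    ⟨ times b T , (λ q → f (u q)) ⟩                                   ≡⟨ pair-times b T _ ⟩
    ⟨ T , (λ q → f (u q)) ⟩ - ⟨ T , (λ q → f (u (q ⊕ b))) ⟩           ≡⟨ pair-− T (λ q → f (u q)) (λ q → f (u (q ⊕ b))) ⟨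
    ⟨ T , (λ q → f (u q) - f (u (q ⊕ b))) ⟩                           ≡⟨ pair-≗ T (λ q → cong (λ y → f (u q) - f y) (IsLinear.homo-⊕ lin q b)) ⟩
    ⟨ T , (λ q → f (u q) - f (u q + u b)) ⟩                           ≡⟨ pair-times*-leading lin bs M (l (u b)) ⟩
    differences (b ∷ bs) a * ⟨ M , (λ _ → 1ℚ) ⟩                       ∎
    where
    open ≡-Reasoning
    T = times* bs M
    lemma : ∀ α f g x y → α * (f - g) + (x - y) ≡ (α * f + x) - (α * g + y)
    lemma = solve-∀ ℚring
    pair-− : ∀ (L : Formal d) φ ψ → ⟨ L , (λ q → φ q - ψ q) ⟩ ≡ ⟨ L , φ ⟩ - ⟨ L , ψ ⟩
    pair-− [] φ ψ = refl
    pair-− ((α , q) ∷ L) φ ψ = trans (cong (α * (φ q - ψ q) +_) (pair-− L φ ψ)) (lemma α (φ q) (ψ q) ⟨ L , φ ⟩ ⟨ L , ψ ⟩)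

module _ (em : ExcludedMiddle 0ℓ) where

  finite-from-list : ∀ {d} xs (A : Subset d) → (∀ y → A y → y ∈ xs) → Finite A
  finite-from-list [] A cover = 0 , (λ ()) , (λ { {()} }) , λ y → mk⇔ (λ a → ⊥-elim (empty (cover y a))) λ ()
    where
    empty : ∀ {y} → ¬ (y ∈ [])
    empty ()
  finite-from-list {d} (x ∷ xs) A cover = extend (em {A x}) (finite-from-list xs (λ y → A y × y ≢ x) λ y (a , y≢x) → remaining y≢x (cover y a))
    where
    remaining : ∀ {y} → y ≢ x → y ∈ x ∷ xs → y ∈ xs
    remaining y≢x (here e) = ⊥-elim (y≢x e)
    remaining y≢x (there i) = i
    extend : Dec (A x) → Finite (λ y → A y × y ≢ x) → Finite A
    extend (no ¬ax) (n , f , inj , iff) = n , f , inj , λ y → mk⇔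
      (λ a → Equivalence.to (iff y) (a , λ { refl → ¬ax a })) (λ i → proj₁ (Equivalence.from (iff y) i))
    extend (yes ax) (n , f , inj , iff) = suc n , g , g-injective , λ y → mk⇔ to from
      where
      g : Fin (suc n) → Vec ℕ d
      g zero = x
      g (suc i) = f i
      f≢x : ∀ i → f i ≢ x
      f≢x i = proj₂ (Equivalence.from (iff (f i)) (i , refl))
      g-injective : Injective _≡_ _≡_ g
      g-injective {zero} {zero} e = refl
      g-injective {zero} {suc j} e = ⊥-elim (f≢x j (sym e))
      g-injective {suc i} {zero} e = ⊥-elim (f≢x i e)
      g-injective {suc i} {suc j} e = cong suc (inj e)
      to : ∀ {y} → A y → ∃[ i ] g i ≡ y
      to {y} a with Vecₚ.≡-dec ℕₚ._≟_ x y
      ... | yes e = zero , e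
      ... | no ne = let i , e = Equivalence.to (iff y) (a , ne ∘ sym) in suc i , e
      from : ∀ {y} → (∃[ i ] g i ≡ y) → A y
      from (zero , refl) = ax
      from (suc i , refl) = proj₁ (Equivalence.from (iff (f i)) (i , refl))

  χ-indicatorSum : ∀ {d n} {A : Subset d} (hc : HasCardinality A n) → χ em A ≐ indicatorSum (proj₁ hc)
  χ-indicatorSum {A = A} (f , inj , iff) s with em {∃[ i ] embed (f i) ≡ s}
  ... | yes (i , e) = trans (χ-∈ em (f i , Equivalence.from (iff (f i)) (i , refl) , e)) (sym (coeff-indicatorSum-∈ f inj i e))
  ... | no none = trans (χ-∉ em (λ (y , a , e) → let i , e′ = Equivalence.to (iff y) a in none (i , trans (cong embed e′) e)))
                        (sym (coeff-indicatorSum-∉ f (λ i e → none (i , e))))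

  module _ {d} {A : Subset d} where

    satisfiable⇒maximum : Satisfiable A → MaximumExists (minus-ones d) A
    satisfiable⇒maximum sat = bounded⇒maximum em (minus-ones d) sat (bounded 0ℚ λ s lt → χ-∉ em λ { (y , _ , refl) →
      ℚₚ.<-irrefl refl (ℚₚ.<-≤-trans lt (subst (_≤ 0ℚ) (sym (trans (dot-embed (minus-ones d) y) (cong fromℤ (minus-ones-· y))))
        (fromℤ-mono-≤ {ℤ.- ℤ.+ Vec.sum y} {ℤ.+ 0} (ℤₚ.neg-mono-≤ {ℤ.+ 0} {ℤ.+ Vec.sum y} (ℤ.+≤+ ℕ.z≤n))))) })

    finite⇒maximum : Finite A → Satisfiable A → MaximumExists (ones d) A
    finite⇒maximum (n , hc) sat = bounded⇒maximum em (ones d) sat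
      (bounded-cong (dot-linear (ι (ones d))) (λ s → sym (χ-indicatorSum hc s)) (bounded-coeff (dot-linear (ι (ones d))) (indicatorSum (proj₁ hc))))

    maximum⇒finite : MaximumExists (ones d) A → Finite A
    maximum⇒finite (x , _ , maximal) = finite-from-list (box d (Vec.sum x)) A λ y a →
      ∈-box y (ℤₚ.drop‿+≤+ (subst₂ ℤ._≤_ (ones-· y) (ones-· x) (maximal y a)))

    empty⇒finite : ¬ Satisfiable A → Finite A
    empty⇒finite empty = finite-from-list [] A λ y a → ⊥-elim (empty (y , a))

  settledOn-satisfiable : ∀ {d} {S : Family d} {Class} → Representation em S Class → SettledOn Class (λ t → Satisfiable (S t))
  settledOn-satisfiable {d} {S} R = from (selectable-maximum em R (minus-ones d))
    where
    from : Selectable (λ t → AttainsMaximum (minus-ones d) (S t)) _ → SettledOn _ (λ t → Satisfiable (S t))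
    from (inj₁ e) = inj₂ (Ev-map (λ t n class sat → n class (satisfiable⇒maximum sat)) e)
    from (inj₂ (_ , _ , e)) = inj₁ (Ev-map (λ t a class → proj₁ (a class) , proj₁ (proj₁ (proj₂ (a class)))) e)

  -- The empty set is finite but has no maximum. Classes that are eventually empty are therefore
  -- treated first; on the others, finiteness is the existence of a maximum for `ones`.
  settledOn-finite : ∀ {d} {S : Family d} {Class} → Representation em S Class → SettledOn Class (λ t → Finite (S t))
  settledOn-finite {d} {S} {Class} R = from (settledOn-satisfiable R) (selectable-maximum em R (ones d))
    where
    from : SettledOn Class (λ t → Satisfiable (S t)) → Selectable (λ t → AttainsMaximum (ones d) (S t)) Class → SettledOn Class (λ t → Finite (S t))
    from (inj₂ e) _ = inj₁ (Ev-map (λ t n class → empty⇒finite (n class)) e)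
    from (inj₁ e) (inj₁ e′) = inj₂ (Ev-map₂ (λ t s n class fin → n class (finite⇒maximum fin (s class))) e e′)
    from (inj₁ _) (inj₂ (_ , _ , e)) = inj₁ (Ev-map (λ t a class → maximum⇒finite (proj₁ (a class) , proj₁ (proj₂ (a class)))) e)

  -- For fixed μ₀ ≠ μ the values μ₀ b₀ + w and μ b₀ + w cannot both vanish eventually unless b₀ and w do.

  generic-functional : ∀ {d} {bs : Vectors d} → All VGerm bs →
                       ∃[ l ] All (λ b → Ev (λ t → b t ≡ 0ᵛ) ⊎ Ev (λ t → dot l (b t) ≢ 0ℚ)) bs
  generic-functional {zero} {bs} _ = [] , All.universal (λ b → inj₁ (Ev-always λ t → empty (b t))) bs
    where
    empty : ∀ (v : Vec ℚ 0) → v ≡ 0ᵛ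
    empty [] = refl
  generic-functional {suc d} {bs} gs with generic-functional {d} {List.map (λ b t → Vec.tail (b t)) bs} (Allₚ.map⁺ (All.map vgerm-tail gs))
  -- The outer `Ev` ranges over the new coefficient `μ`, not over `t`: if some `μ` makes the
  -- functional eventually vanish on `b`, then every larger one is good for `b`.
  ... | l , tails = from (Ev-All (All.zipWith (λ {b} (g , tl) → eventually-good b g tl) (gs , Allₚ.map⁻ tails)))
    where
    Good : (ℕ → Vec ℚ (suc d)) → ℕ → Set
    Good b μ = Ev (λ t → b t ≡ 0ᵛ) ⊎ Ev (λ t → dot (fromℕ μ ∷ l) (b t) ≢ 0ℚ)
    zero-or-good : ∀ b μ → VGerm b → Ev (λ t → dot (fromℕ μ ∷ l) (b t) ≡ 0ℚ) ⊎ Good b μ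
    zero-or-good b μ g = Sum.map₂ inj₂ (settled-≡0 (germ-dot (fromℕ μ ∷ l) g))
    both-zero : ∀ μ μ′ → μ ℕ.< μ′ → ∀ v → dot (fromℕ μ ∷ l) v ≡ 0ℚ → dot (fromℕ μ′ ∷ l) v ≡ 0ℚ → Vec.head v ≡ 0ℚ × dot l (Vec.tail v) ≡ 0ℚ
    both-zero μ μ′ lt (x ∷ v) e e′ = x≡0 , trans (lemma (fromℕ μ) x (dot l v)) (trans (cong₂ (λ a b → a - fromℕ μ * b) e x≡0) (lemma″ (fromℕ μ)))
      where
      lemma : ∀ m x w → w ≡ m * x + w - m * x
      lemma = solve-∀ ℚring
      lemma′ : ∀ m m′ x w → (m′ - m) * x ≡ (m′ * x + w) - (m * x + w)
      lemma′ = solve-∀ ℚring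
      lemma″ : ∀ m → 0ℚ - m * 0ℚ ≡ 0ℚ
      lemma″ = solve-∀ ℚring
      x≡0 : x ≡ 0ℚ
      x≡0 = *-cancel-0 (pos≢0 (diff-pos (fromℤ-mono-< {ℤ.+ μ} {ℤ.+ μ′} (ℤ.+<+ lt)))) (trans (lemma′ (fromℕ μ) (fromℕ μ′) x (dot l v)) (cong₂ _-_ e′ e))
    conclude : ∀ b μ → Ev (λ t → Vec.head (b t) ≡ 0ℚ × dot l (Vec.tail (b t)) ≡ 0ℚ) →
               Ev (λ t → Vec.tail (b t) ≡ 0ᵛ) ⊎ Ev (λ t → dot l (Vec.tail (b t)) ≢ 0ℚ) → Good b μ
    conclude b μ z (inj₁ tl) = inj₁ (Ev-map₂ (λ t (h , _) e → cons≡0 (b t) h e) z tl)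
      where
      cons≡0 : ∀ (v : Vec ℚ (suc d)) → Vec.head v ≡ 0ℚ → Vec.tail v ≡ 0ᵛ → v ≡ 0ᵛ
      cons≡0 (x ∷ v) refl refl = refl
    conclude b μ z (inj₂ tl) = inj₂ (Ev-map₂ (λ t (_ , w) nw → ⊥-elim (nw w)) z tl)
    after-bad : ∀ b μ → VGerm b → Ev (λ t → Vec.tail (b t) ≡ 0ᵛ) ⊎ Ev (λ t → dot l (Vec.tail (b t)) ≢ 0ℚ) →
                Ev (λ t → dot (fromℕ μ ∷ l) (b t) ≡ 0ℚ) → ∀ μ′ → μ ℕ.< μ′ → Good b μ′
    after-bad b μ g tl z μ′ lt = Sum.[ (λ z′ → conclude b μ′ (Ev-map₂ (λ t → both-zero μ μ′ lt (b t)) z z′) tl) , (λ good → good) ]′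
      (zero-or-good b μ′ g)
    eventually-good : ∀ b → VGerm b → Ev (λ t → Vec.tail (b t) ≡ 0ᵛ) ⊎ Ev (λ t → dot l (Vec.tail (b t)) ≢ 0ℚ) → Ev (Good b)
    eventually-good b g tl with em {∃[ μ ] Ev (λ t → dot (fromℕ μ ∷ l) (b t) ≡ 0ℚ)}
    ... | yes (μ , z) = suc μ , after-bad b μ g tl z
    ... | no none = Ev-always λ μ → good μ (zero-or-good b μ g)
      where
      good : ∀ μ → Ev (λ t → dot (fromℕ μ ∷ l) (b t) ≡ 0ℚ) ⊎ Good b μ → Good b μ
      good μ (inj₁ z) = ⊥-elim (none (μ , z))
      good μ (inj₂ p) = p
    from : Ev (λ μ → All (λ b → Good b μ) bs) → ∃[ l ] All (λ b → Ev (λ t → b t ≡ 0ᵛ) ⊎ Ev (λ t → dot l (b t) ≢ 0ℚ)) bs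
    from (μ , good) = (fromℕ μ ∷ l) , good μ ℕₚ.≤-refl

  module _ {d} {A : Subset d} {L bs} (rep : RepresentedBy em A L bs) (l : Vec ℚ d) where

    -- The exponent of the power is the number of factors. A lower power would be annihilated by the
    -- differences, while this one leaves a constant times the number of elements.
    cardinality-identity : ∀ {n} → HasCardinality A n →
      ⟨ L , (λ q → power (length bs) (dot l q)) ⟩ ≡ differences (dot l) bs 1ℚ * fromℕ n
    cardinality-identity {n} hc = begin
      ⟨ L , (λ q → power (length bs) (dot l q)) ⟩
        ≡⟨ pair-coeff {L = times* bs I} {L} (λ s → trans (sym (coeff-times* bs I s))
             (trans (∇*-cong bs (λ r → sym (χ-indicatorSum hc r)) s) (RepresentedBy.identity rep s))) (λ q → power (length bs) (dot l q)) ⟨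
      ⟨ times* bs I , (λ q → power (length bs) (dot l q)) ⟩
        ≡⟨ pair-times*-leading (dot l) (dot-linear l) bs I {1ℚ} {power (length bs)} (leading-power (length bs)) ⟩
      differences (dot l) bs 1ℚ * ⟨ I , (λ _ → 1ℚ) ⟩
        ≡⟨ cong (differences (dot l) bs 1ℚ *_) (pair-indicatorSum-1 (proj₁ hc)) ⟩
      differences (dot l) bs 1ℚ * fromℕ n ∎
      where
      open ≡-Reasoning
      I = indicatorSum (proj₁ hc)

  selectable-cardinality : ∀ {d} {S : Family d} {Class} → (∀ T → ∃[ t ] T ℕ.≤ t × Class t) → Representation em S Class →
                           Selectable {1} (λ t y → HasCardinality (S t) (Vec.head y)) Class
  selectable-cardinality {d} {S} {Class} unbounded R = decide (settledOn-finite R) (generic-functional denominator-germ)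
    where
    open Representation R
    Attain : ℕ → Vec ℕ 1 → Set
    Attain t y = HasCardinality (S t) (Vec.head y)
    k = length denominator
    decide : SettledOn Class (λ t → Finite (S t)) →
             (∃[ l ] All (λ b → Ev (λ t → b t ≡ 0ᵛ) ⊎ Ev (λ t → dot l (b t) ≢ 0ℚ)) denominator) → Selectable Attain Class
    decide (inj₂ e) _ = inj₁ (Ev-map (λ t n class (y , hc) → n class (Vec.head y , hc)) e)
    decide (inj₁ e) (l , generic) = inj₂ (v , vgerm (λ { zero → germ-* W-germ (germ-inverse Z-germ) }) ,
        Ev-map₂ (λ t (fin , rep) nz class → at-time t (fin class) (rep class) nz) (Ev-× e represented) nonzero)
      where
      W Z : ℕ → ℚ
      W t = ⟨ at numerator t , (λ q → power k (dot l q)) ⟩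
      Z t = differences (dot l) (vectorsAt denominator t) 1ℚ
      W-germ : Germ W
      W-germ = germ-pair (All.map (λ {(_ , q)} g → germ-power k (germ-dot l g)) numerator-germ)
      Z-germ : Germ Z
      Z-germ = germ-differences (dot l) (germ-dot l) denominator-germ (germ-const 1ℚ)
      v : ℕ → Vec ℚ 1
      v t = W t * inverse (Z t) ∷ []
      never-zero : ∀ {bs} → All (λ b → Ev (λ t → b t ≡ 0ᵛ) ⊎ Ev (λ t → dot l (b t) ≢ 0ℚ)) bs →
                   EvOn Class (λ t → All LP (vectorsAt bs t)) → Ev (λ t → All (λ b → dot l b ≢ 0ℚ) (vectorsAt bs t))
      never-zero [] _ = Ev-always λ _ → []
      never-zero (inj₂ p ∷ ps) lp = Ev-map₂ (λ _ → _∷_) p (never-zero ps (Ev-map (λ t f class → All.tail (f class)) lp))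
      -- The class contains arbitrarily large `t`, at which a vector that is eventually zero would
      -- have to be lexicographically positive.
      never-zero (inj₁ (T , z) ∷ ps) (T′ , lp) with unbounded (T ℕ.⊔ T′)
      ... | t , le , class = ⊥-elim (LP⇒≢0 (All.head (lp t (ℕₚ.≤-trans (ℕₚ.m≤n⊔m T T′) le) class)) (z t (ℕₚ.≤-trans (ℕₚ.m≤m⊔n T T′) le)))
      nonzero : Ev (λ t → Z t ≢ 0ℚ)
      nonzero = Ev-map (λ t ps → differences-≢0 (dot l) ps (pos≢0 0<1))
        (never-zero generic (Ev-map (λ t rep class → All.map proj₂ (RepresentedBy.denominators (rep class))) represented))
      at-time : ∀ t → Finite (S t) → RepresentedBy em (S t) (at numerator t) (vectorsAt denominator t) → Z t ≢ 0ℚ →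
                ∃[ y ] Attain t y × embed y ≡ v t
      at-time t (n , hc) rep Z≢0 = n ∷ [] , hc , cong (_∷ []) (begin
        fromℕ n                               ≡⟨ ℚₚ.*-identityʳ (fromℕ n) ⟨
        fromℕ n * 1ℚ                          ≡⟨ cong (fromℕ n *_) (*-inverse Z≢0) ⟨
        fromℕ n * (Z t * inverse (Z t))       ≡⟨ lemma (fromℕ n) (Z t) (inverse (Z t)) ⟩
        (Z t * fromℕ n) * inverse (Z t)       ≡⟨ cong (_* inverse (Z t)) (cardinality-identity rep l hc) ⟨
        ⟨ at numerator t , (λ q → power (length (vectorsAt denominator t)) (dot l q)) ⟩ * inverse (Z t)
          ≡⟨ cong (λ j → ⟨ at numerator t , (λ q → power j (dot l q)) ⟩ * inverse (Z t)) (Listₚ.length-map (λ b → b t) denominator) ⟩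
        W t * inverse (Z t)                   ∎)
        where
        open ≡-Reasoning
        lemma : ∀ n z i → n * (z * i) ≡ (z * n) * i
        lemma = solve-∀ ℚring

-- Eventual periodicity

periodic-iff : ∀ {P Q : ℕ → Set} → (∀ t → P t ⇔ Q t) → EventuallyPeriodic P → EventuallyPeriodic Q
periodic-iff e (T , m , p) = T , m , λ t T≤t → mk⇔
  (λ q → Equivalence.to (e _) (Equivalence.to (p t T≤t) (Equivalence.from (e t) q)))
  (λ q → Equivalence.to (e t) (Equivalence.from (p t T≤t) (Equivalence.from (e _) q)))

periodic-→ : ∀ {P Q : ℕ → Set} → EventuallyPeriodic P → EventuallyPeriodic Q → EventuallyPeriodic (λ t → P t → Q t)
-- The successor of this number is `suc m * suc m′`, the product of the two periods.
periodic-→ {P} {Q} (T , m , p) (T′ , m′ , q) = T ℕ.⊔ T′ , m′ ℕ.+ m ℕ.* suc m′ , λ t le → mk⇔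
    (λ f → Equivalence.to (Q-period t le) ∘ f ∘ Equivalence.from (P-period t le))
    (λ f → Equivalence.from (Q-period t le) ∘ f ∘ Equivalence.to (P-period t le))
  where
  iterate : ∀ {R : ℕ → Set} T m → (∀ t → T ℕ.≤ t → R t ⇔ R (t ℕ.+ suc m)) → ∀ k t → T ℕ.≤ t → R t ⇔ R (t ℕ.+ k ℕ.* suc m)
  iterate {R} T m r zero t le = subst (λ s → R t ⇔ R s) (sym (ℕₚ.+-identityʳ t)) (mk⇔ (λ x → x) (λ x → x))
  iterate {R} T m r (suc k) t le = subst (λ s → R t ⇔ R s) (ℕₚ.+-assoc t (suc m) (k ℕ.* suc m))
    (mk⇔ (λ x → Equivalence.to rest (Equivalence.to (r t le) x)) (λ x → Equivalence.from (r t le) (Equivalence.from rest x)))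
    where
    rest = iterate {R} T m r k (t ℕ.+ suc m) (ℕₚ.≤-trans le (ℕₚ.m≤m+n t (suc m)))
  P-period : ∀ t → T ℕ.⊔ T′ ℕ.≤ t → P t ⇔ P (t ℕ.+ (suc m ℕ.* suc m′))
  P-period t le = subst (λ s → P t ⇔ P (t ℕ.+ s)) (ℕₚ.*-comm (suc m′) (suc m)) (iterate {P} T m p (suc m′) t (ℕₚ.≤-trans (ℕₚ.m≤m⊔n T T′) le))
  Q-period : ∀ t → T ℕ.⊔ T′ ℕ.≤ t → Q t ⇔ Q (t ℕ.+ (suc m ℕ.* suc m′))
  Q-period t le = iterate {Q} T′ m′ q (suc m) t (ℕₚ.≤-trans (ℕₚ.m≤n⊔m T T′) le)

-- On each residue class the constituent polynomial is identically zero or eventually nonzero.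
quasi-≢0-periodic : ∀ {f} → EventuallyQuasiPolynomial f → EventuallyPeriodic (λ t → f t ≢ 0ℚ)
quasi-≢0-periodic {f} (h , (m , p , h≡) , T , f≡h) = settledOn⇒periodic λ i → on-residue i (poly-≢0 (p i))
  where
  f≡ : ∀ {i} t → T ℕ.≤ t → Residue m i t → f t ≡ eval (p i) (fromℕ t)
  f≡ t T≤t refl = trans (f≡h t T≤t) (h≡ t)
  on-residue : ∀ i → All (_≡ 0ℚ) (p i) ⊎ Ev (λ t → eval (p i) (fromℕ t) ≢ 0ℚ) → SettledOn (Residue m i) (λ t → f t ≢ 0ℚ)
  on-residue i (inj₁ zs) = inj₂ (T , λ t T≤t class f≢0 → f≢0 (trans (f≡ t T≤t class) (eval-zeros zs (fromℕ t))))
  on-residue i (inj₂ ev) = inj₁ (Ev-map₂ (λ t e ne class z → ne (trans (sym (e class)) z)) (T , f≡) ev)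

-- Removing a point from each member of a family

module _ {d : ℕ} where

  timesᵛ : (ℕ → Vec ℚ d) → VFormal d → VFormal d
  timesᵛ b L = L ++ List.map (λ (α , q) → - α , λ t → q t ⊕ b t) L

  timesᵛ* : Vectors d → VFormal d → VFormal d
  timesᵛ* [] L = L
  timesᵛ* (b ∷ bs) L = timesᵛ b (timesᵛ* bs L)

  at-timesᵛ : ∀ b L t → at (timesᵛ b L) t ≡ times (b t) (at L t)
  at-timesᵛ b L t = trans (Listₚ.map-++ _ L _) (cong (at L t ++_)
    (trans (sym (Listₚ.map-∘ L)) (trans (Listₚ.map-∘ L) (Listₚ.map-∘ (at L t)))))

  at-timesᵛ* : ∀ bs L t → at (timesᵛ* bs L) t ≡ times* (vectorsAt bs t) (at L t)
  at-timesᵛ* [] L t = refl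
  at-timesᵛ* (b ∷ bs) L t = trans (at-timesᵛ b (timesᵛ* bs L) t) (cong (times (b t)) (at-timesᵛ* bs L t))

  timesᵛ*-germ : ∀ {bs L} → All VGerm bs → FGerm L → FGerm (timesᵛ* bs L)
  timesᵛ*-germ [] gL = gL
  timesᵛ*-germ (g ∷ gs) gL = Allₚ.++⁺ rest (Allₚ.map⁺ (All.map (λ h → vgerm-⊕ h g) rest))
    where rest = timesᵛ*-germ gs gL

  negateᵛ : VFormal d → VFormal d
  negateᵛ = List.map λ (α , q) → - α , q

  at-negateᵛ : ∀ L t → at (negateᵛ L) t ≡ negate (at L t)
  at-negateᵛ L t = trans (sym (Listₚ.map-∘ L)) (Listₚ.map-∘ L)

  times*-integral : ∀ {bs} {L : Formal d} → All Integral bs → All (λ (_ , q) → Integral q) L → All (λ (_ , q) → Integral q) (times* bs L)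
  times*-integral [] ints = ints
  times*-integral (b ∷ bs) ints = Allₚ.++⁺ rest (Allₚ.map⁺ (Allₚ.map⁺ (All.map (λ i → integral-⊕ i b) rest)))
    where rest = times*-integral bs ints

  ∇*-− : ∀ bs (G H : Series d) s → ∇* bs (λ s → G s - H s) s ≡ ∇* bs G s - ∇* bs H s
  ∇*-− [] G H s = refl
  ∇*-− (b ∷ bs) G H s = trans (∇-cong b (∇*-− bs G H) s) (∇-− b (∇* bs G) (∇* bs H) s)

_∖_ : ∀ {d} → Subset d → Vec ℕ d → Subset d
(A ∖ x) y = A y × y ≢ x

module _ (em : ExcludedMiddle 0ℓ) where

  module _ {d} {A : Subset d} {x : Vec ℕ d} where

    χ-∖ : A x → ∀ s → χ em (A ∖ x) s ≡ χ em A s - coeff ((1ℚ , embed x) ∷ []) s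
    χ-∖ ax s = by-cases (embed x ≟ᵛ s)
      where
      same : Dec (∃[ y ] A y × embed y ≡ s) → embed x ≢ s → χ em (A ∖ x) s ≡ χ em A s
      same (yes (y , ay , e)) ne = trans (χ-∈ em (y , (ay , λ { refl → ne e }) , e)) (sym (χ-∈ em (y , ay , e)))
      same (no none) ne = trans (χ-∉ em λ (y , (ay , _) , e) → none (y , ay , e)) (sym (χ-∉ em none))
      lemma : ∀ a → a ≡ a - (1ℚ * 0ℚ + 0ℚ)
      lemma = solve-∀ ℚring
      by-cases : Dec (embed x ≡ s) → χ em (A ∖ x) s ≡ χ em A s - (1ℚ * δ s (embed x) + 0ℚ)
      by-cases (yes e) = trans (χ-∉ em λ { (y , (_ , y≢x) , e′) → y≢x (embed-injective (trans e′ (sym e))) })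
        (sym (cong₂ (λ a b → a - (1ℚ * b + 0ℚ)) (χ-∈ em (x , ax , e)) (δ-≡ {s = s} {embed x} e)))
      by-cases (no ne) = trans (same em ne) (trans (lemma (χ em A s)) (cong (λ b → χ em A s - (1ℚ * b + 0ℚ)) (sym (δ-≢ {s = s} {embed x} ne))))

    -- If `x` is among the given elements, its index is skipped by `punchIn`. Otherwise any index
    -- may be dropped, and the first one is.
    hasAtLeast-suc : A x → ∀ k → HasAtLeast (suc k) A ⇔ HasAtLeast k (A ∖ x)
    hasAtLeast-suc ax k = mk⇔ to from
      where
      from : HasAtLeast k (A ∖ x) → HasAtLeast (suc k) A
      from (f , inj , ins) = g , g-injective , λ { zero → ax ; (suc i) → proj₁ (ins i) }
        where
        g : Fin (suc k) → Vec ℕ d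
        g zero = x
        g (suc i) = f i
        g-injective : Injective _≡_ _≡_ g
        g-injective {zero} {zero} e = refl
        g-injective {zero} {suc j} e = ⊥-elim (proj₂ (ins j) (sym e))
        g-injective {suc i} {zero} e = ⊥-elim (proj₂ (ins i) e)
        g-injective {suc i} {suc j} e = cong suc (inj e)
      to : HasAtLeast (suc k) A → HasAtLeast k (A ∖ x)
      to (f , inj , ins) = omit (em {∃[ j ] f j ≡ x})
        where
        omit : Dec (∃[ j ] f j ≡ x) → HasAtLeast k (A ∖ x)
        omit (yes (j , e)) = f ∘ punchIn j , (λ e → Finₚ.punchIn-injective j _ _ (inj e)) ,
          λ i → ins (punchIn j i) , λ e′ → Finₚ.punchInᵢ≢i j i (inj (trans e′ (sym e)))
        omit (no none) = f ∘ suc , (λ e → Finₚ.suc-injective (inj e)) , λ i → ins (suc i) , λ e → none (suc i , e)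

    -- Removing `x` subtracts the monomial with exponent `x` from the series, hence that monomial
    -- times all the factors `1 − 𝐱ᵇ` from the numerator. The denominator stays the same.
    represented-∖ : ∀ {L bs} → A x → RepresentedBy em A L bs → RepresentedBy em (A ∖ x) (L ++ negate (times* bs ((1ℚ , embed x) ∷ []))) bs
    represented-∖ {L} {bs} ax rep = record
      { exponents-integral = Allₚ.++⁺ exponents-integral (Allₚ.map⁺ (times*-integral (All.map proj₁ denominators) (integral-embed x ∷ [])))
      ; denominators = denominators
      ; identity = λ s → begin
          ∇* bs (χ em (A ∖ x)) s                             ≡⟨ ∇*-cong bs (χ-∖ ax) s ⟩
          ∇* bs (λ s → χ em A s - coeff I s) s               ≡⟨ ∇*-− bs (χ em A) (coeff I) s ⟩
          ∇* bs (χ em A) s - ∇* bs (coeff I) s               ≡⟨ cong₂ _-_ (identity s) (coeff-times* bs I s) ⟩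
          coeff L s - coeff (times* bs I) s                  ≡⟨ cong (coeff L s +_) (pair-negate (times* bs I) (δ s)) ⟨
          coeff L s + coeff (negate (times* bs I)) s         ≡⟨ pair-++ L (negate (times* bs I)) (δ s) ⟨
          coeff (L ++ negate (times* bs I)) s                ∎
      }
      where
      open RepresentedBy rep
      open ≡-Reasoning
      I : Formal d
      I = (1ℚ , embed x) ∷ []

    represented-empty-∖ : ∀ {L bs} → ¬ Satisfiable A → RepresentedBy em A L bs → RepresentedBy em (A ∖ x) L bs
    represented-empty-∖ {L} {bs} empty rep = record
      { exponents-integral = exponents-integral ; denominators = denominators
      ; identity = λ s → trans (∇*-cong bs (λ r → trans (χ-∉ em λ (y , (ay , _) , _) → empty (y , ay)) (sym (χ-∉ em λ (y , ay , _) → empty (y , ay)))) s) (identity s)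
      }
      where open RepresentedBy rep

  -- On a class where the sets are nonempty, the removed point is a germ, so the new numerator has
  -- germs as exponents again. Where the sets are eventually empty, nothing is removed and the old
  -- numerator serves.
  remove-choice : ∀ {d} {S : Family d} {Class x} → Representation em S Class → GermOn x Class →
                  EvOn Class (λ t → S t (x t)) ⊎ EvOn Class (λ t → ¬ Satisfiable (S t)) → Representation em (λ t → S t ∖ x t) Class
  remove-choice {x = x} R (v , gv , ev) (inj₁ inside) = record
    { numerator = numerator ++ negateᵛ (timesᵛ* denominator ((1ℚ , v) ∷ []))
    ; denominator = denominator
    ; numerator-germ = Allₚ.++⁺ numerator-germ (Allₚ.map⁺ (timesᵛ*-germ denominator-germ (gv ∷ [])))
    ; denominator-germ = denominator-germ
    ; represented = Ev-map₂ (λ t rep (ins , e) class → subst (λ L → RepresentedBy em _ L (vectorsAt denominator t)) (numerator-at t (e class))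
        (represented-∖ (ins class) (rep class))) represented (Ev-× inside ev)
    }
    where
    open Representation R
    numerator-at : ∀ t → embed (x t) ≡ v t → at numerator t ++ negate (times* (vectorsAt denominator t) ((1ℚ , embed (x t)) ∷ [])) ≡
                   at (numerator ++ negateᵛ (timesᵛ* denominator ((1ℚ , v) ∷ []))) t
    numerator-at t e = trans (cong (λ w → at numerator t ++ negate (times* (vectorsAt denominator t) ((1ℚ , w) ∷ []))) e)
      (sym (trans (Listₚ.map-++ _ numerator _) (cong (at numerator t ++_)
        (trans (at-negateᵛ (timesᵛ* denominator ((1ℚ , v) ∷ [])) t) (cong negate (at-timesᵛ* denominator ((1ℚ , v) ∷ []) t))))))
  remove-choice R _ (inj₂ empty) = record
    { Representation R
    ; represented = Ev-map₂ (λ t n rep class → represented-empty-∖ (n class) (rep class)) empty (Representation.represented R)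
    }

  record Elements {d} (m : ℕ) (S : Family d) (k : ℕ) : Set where
    field
      element : Fin k → ℕ → Vec ℕ d
      distinct : ∀ t → HasAtLeast k (S t) → (∀ i → S t (element i t)) × (∀ i j → i ≢ j → element i t ≢ element j t)
      quasi : ∀ i → CoordinatesEventuallyQuasiPolynomial (element i)
      settled : ∀ i → SettledOn (Residue m i) (λ t → HasAtLeast k (S t))

  -- Induction on `k` over all represented families: after a first element is chosen, the remaining
  -- ones are found in the family with that element removed, which is represented as well.
  elements : ∀ {d m} {S : Family d} k → (∀ i → Representation em S (Residue m i)) → Elements m S k
  elements zero R = record
    { element = λ () ; distinct = λ _ _ → (λ ()) , λ () ; quasi = λ ()
    ; settled = λ _ → inj₁ (Ev-always λ _ _ → (λ ()) , (λ { {()} }) , λ ()) }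
  elements {d} {m} {S} (suc k) R = record { element = element ; distinct = distinct ; quasi = quasi ; settled = settled }
    where
    C : Choice m (λ t → AttainsMaximum (minus-ones d) (S t))
    C = choose em (λ i → selectable-maximum em (R i) (minus-ones d))
    x : ℕ → Vec ℕ d
    x = Choice.choice C
    member : ∀ t → Satisfiable (S t) → S t (x t)
    member t sat = proj₁ (Choice.attains C t (satisfiable⇒maximum em sat))
    settledOn-member : ∀ i → EvOn (Residue m i) (λ t → S t (x t)) ⊎ EvOn (Residue m i) (λ t → ¬ Satisfiable (S t))
    settledOn-member i = Sum.map₁ (Ev-map λ t sat class → member t (sat class)) (settledOn-satisfiable em (R i))
    rest : Elements m (λ t → S t ∖ x t) k
    rest = elements k λ i → remove-choice (R i) (Choice.germs C i) (settledOn-member i)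
    module Rest = Elements rest
    element : Fin (suc k) → ℕ → Vec ℕ d
    element zero = x
    element (suc i) = Rest.element i
    remaining : ∀ t → S t (x t) → HasAtLeast (suc k) (S t) ⇔ HasAtLeast k (S t ∖ x t)
    remaining t sx = hasAtLeast-suc {A = S t} {x = x t} sx k
    fewer : ∀ t → HasAtLeast (suc k) (S t) → S t (x t) × HasAtLeast k (S t ∖ x t)
    fewer t h@(f , _ , ins) = sx , Equivalence.to (remaining t sx) h
      where sx = member t (f zero , ins zero)
    distinct : ∀ t → HasAtLeast (suc k) (S t) → (∀ i → S t (element i t)) × (∀ i j → i ≢ j → element i t ≢ element j t)
    distinct t h = (λ { zero → proj₁ (fewer t h) ; (suc i) → proj₁ (inside i) }) , separate
      where
      inside : ∀ i → S t (Rest.element i t) × Rest.element i t ≢ x t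
      inside = proj₁ (Rest.distinct t (proj₂ (fewer t h)))
      separate : ∀ i j → i ≢ j → element i t ≢ element j t
      separate zero zero ne = ⊥-elim (ne refl)
      separate zero (suc j) _ e = proj₂ (inside j) (sym e)
      separate (suc i) zero _ e = proj₂ (inside i) e
      separate (suc i) (suc j) ne = proj₂ (Rest.distinct t (proj₂ (fewer t h))) i j (ne ∘ cong suc)
    quasi : ∀ i → CoordinatesEventuallyQuasiPolynomial (element i)
    quasi zero = germOn⇒quasi (Choice.germs C)
    quasi (suc i) = Rest.quasi i
    settled : ∀ i → SettledOn (Residue m i) (λ t → HasAtLeast (suc k) (S t))
    settled i = combine (settledOn-member i) (Rest.settled i)
      where
      combine : EvOn (Residue m i) (λ t → S t (x t)) ⊎ EvOn (Residue m i) (λ t → ¬ Satisfiable (S t)) →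
                SettledOn (Residue m i) (λ t → HasAtLeast k (S t ∖ x t)) → SettledOn (Residue m i) (λ t → HasAtLeast (suc k) (S t))
      combine (inj₂ n) _ = inj₂ (Ev-map (λ t n class (f , _ , ins) → n class (f zero , ins zero)) n)
      combine (inj₁ p) (inj₁ q) = inj₁ (Ev-map₂ (λ t p q class → Equivalence.from (remaining t (p class)) (q class)) p q)
      combine (inj₁ p) (inj₂ n) = inj₂ (Ev-map₂ (λ t p n class h → n class (Equivalence.to (remaining t (p class)) h)) p n)

  -- The implications between the properties.

  module _ {d : ℕ} {S : Family d} where

    property4⇒2 : Property4 S → Property2 S
    property4⇒2 p4@(m , _) = (g , (λ t (n , hc) → attains t (n ∷ [] , hc)) ,
        subst-quasi (λ t → head-lookup (choice t)) (germOn⇒quasi germs zero)) ,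
        settledOn⇒periodic (λ i → settledOn-finite em (R i))
      where
      R : ∀ i → Representation em S (Residue m i)
      R = property4⇒representation em p4
      C : Choice m (λ t y → HasCardinality (S t) (Vec.head {n = 0} y))
      C = choose em λ i → selectable-cardinality em (residue-unbounded m i) (R i)
      open Choice C
      g : ℕ → ℕ
      g t = Vec.head (choice t)
      head-lookup : ∀ (v : Vec ℕ 1) → lookup v zero ≡ Vec.head v
      head-lookup (_ ∷ _) = refl
      subst-quasi : ∀ {f g : ℕ → ℕ} → (∀ t → f t ≡ g t) → EventuallyQuasiPolynomial (fromℕ ∘ f) → EventuallyQuasiPolynomial (fromℕ ∘ g)
      subst-quasi e (h , q , T , f≡h) = h , q , T , λ t le → trans (cong fromℕ (sym (e t))) (f≡h t le)

    property4⇒3a : Property4 S → Property3a S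
    property4⇒3a p4@(m , _) c _ = (choice , attains , germOn⇒quasi germs) , settledOn⇒periodic settled
      where
      C : Choice m (λ t → AttainsMaximum c (S t))
      C = choose em λ i → selectable-maximum em (property4⇒representation em p4 i) c
      open Choice C

    property4⇒3b : Property4 S → Property3b S
    property4⇒3b p4@(m , _) k = (element , distinct , quasi) , settledOn⇒periodic settled
      where
      E : Elements m S k
      E = elements k (property4⇒representation em p4)
      open Elements E

    -- Infinite sets are nonempty, so nonemptiness amounts to the implication that a finite set has
    -- `g t ≠ 0`. Both sides of this implication are eventually periodic.
    property2⇒1 : Property2 S → Property1 S
    property2⇒1 ((g , cardinality , quasi) , periodic) = periodic-iff (λ t → mk⇔ (to t) (from t)) (periodic-→ periodic (quasi-≢0-periodic quasi))
      where
      to : ∀ t → (Finite (S t) → fromℕ (g t) ≢ 0ℚ) → Satisfiable (S t)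
      to t nonzero = decidable-stable em λ empty → let finite = empty⇒finite em empty in
          nonzero finite (cong fromℕ (zero-cardinality empty (cardinality t finite)))
        where
        zero-cardinality : ∀ {n} → ¬ Satisfiable (S t) → HasCardinality (S t) n → n ≡ 0
        zero-cardinality {zero} _ _ = refl
        zero-cardinality {suc n} empty (f , _ , iff) = ⊥-elim (empty (f zero , Equivalence.from (iff (f zero)) (zero , refl)))
      from : ∀ t → Satisfiable (S t) → Finite (S t) → fromℕ (g t) ≢ 0ℚ
      from t (y , sy) finite e = no-index (subst (HasCardinality (S t)) (fromℕ-injective {g t} {0} e) (cardinality t finite))
        where
        no-index : ¬ HasCardinality (S t) 0
        no-index (_ , _ , iff) with Equivalence.to (iff y) sy
        ... | () , _

    -- Taken at `c = −(1, …, 1)`, whose maximum exists on every nonempty subset of ℕᵈ; `1 ≤ d`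
    -- ensures that `c` is nonzero.
    property3a⇒3 : 1 ℕ.≤ d → Property3a S → Property3 S
    property3a⇒3 1≤d p3a = from (p3a (minus-ones d) (nonzero 1≤d))
      where
      nonzero : ∀ {d} → 1 ℕ.≤ d → minus-ones d ≢ replicate d ℤ.0ℤ
      nonzero (ℕ.s≤s _) ()
      from : (∃[ x ] (∀ t → MaximumExists (minus-ones d) (S t) → AttainsMaximum (minus-ones d) (S t) (x t)) ×
               CoordinatesEventuallyQuasiPolynomial x) × EventuallyPeriodic (λ t → MaximumExists (minus-ones d) (S t)) → Property3 S
      from ((x , attains , quasi) , periodic) = (x , (λ t sat → proj₁ (attains t (satisfiable⇒maximum em sat))) , quasi) ,
        periodic-iff (λ t → mk⇔ (λ (y , sy , _) → y , sy) (satisfiable⇒maximum em)) periodic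

    property3b⇒3 : Property3b S → Property3 S
    property3b⇒3 p3b = from (p3b 1)
      where
      one : ∀ {t} → Satisfiable (S t) → HasAtLeast 1 (S t)
      one (y , sy) = (λ _ → y) , (λ { {zero} {zero} _ → refl }) , λ _ → sy
      from : (∃[ x ] (∀ t → HasAtLeast 1 (S t) → (∀ i → S t (x i t)) × (∀ i j → i ≢ j → x i t ≢ x j t)) ×
               (∀ (i : Fin 1) → CoordinatesEventuallyQuasiPolynomial (x i))) × EventuallyPeriodic (λ t → HasAtLeast 1 (S t)) → Property3 S
      from ((x , distinct , quasi) , periodic) = (x zero , (λ t sat → proj₁ (distinct t (one sat)) zero) , quasi zero) ,
        periodic-iff (λ t → mk⇔ (λ (f , _ , ins) → f zero , ins zero) one) periodic

theorem3p3 : ExcludedMiddle 0ℓ → (d : ℕ) → 1 ℕ.≤ d → (S : Family d) →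
    (Property4 S → Property2 S) ×
    (Property4 S → Property3a S) ×
    (Property4 S → Property3b S) ×
    (Property2 S → Property1 S) ×
    (Property3a S → Property3 S) ×
    (Property3b S → Property3 S) ×
    (Property3 S → Property1 S)
theorem3p3 em d 1≤d S =
  property4⇒2 em , property4⇒3a em , property4⇒3b em , property2⇒1 em , property3a⇒3 em 1≤d , property3b⇒3 em , proj₂
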